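{- Let $a$ be a positive integer and suppose that $a\,T_k(m)=(2m+1)^k$ with positive integers $m>1$ and even $k$. Let $p$ be a prime dividing $2m+1$. Then: (a) $p$ is an irregular prime; (b) $k\not\equiv 0,2,4,6,8,10,14\pmod{p-1}$; (c) $\operatorname{ord}_p(B_k/k)\ge 2\operatorname{ord}_p(2m+1)\ge 2$; (d) $k\equiv r\pmod{p-1}$ for some irregular pair $(r,p)$.
   Context: $T_k(m):=\sum_{j=1}^{m}(2j-1)^k$. Bernoulli numbers $B_j$ are defined by $\frac{z}{e^z-1}=\sum_{j\ge0}B_j\frac{z^j}{j!}$ ($|z|<2\pi$); write $B_j=U_j/V_j$ with $\gcd(U_j,V_j)=1$, $V_j>0$. $\operatorname{ord}_p$ denotes the $p$-adic valuation (on nonzero rationals). An odd prime $p$ is irregular if $p\mid U_r$ for some even $r\le p-3$; the pairs $(r,p)$ with $p\mid U_r$ and $r$ even, $r\le p-3$, are called irregular pairs. -}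

module Defs where

open import Data.Nat as ℕ using (ℕ; zero; suc; _+_; _*_; _∸_; _^_; _≤_)
open import Data.Nat.Combinatorics using (_C_)
open import Data.Nat.Divisibility as ℕD using (_∣?_)
open import Data.Nat.Primality using (Prime)
open import Data.Integer as ℤ using (ℤ; +_)
open import Data.Integer.Divisibility as ℤD using ()
open import Data.Rational as ℚ using (ℚ; 0ℚ; 1ℚ)
open import Data.Vec using (Vec; []; _∷_; _∷ʳ_; last)
open import Data.Product using (_×_; ∃)
open import Relation.Nullary using (yes; no; ¬_)

T : ℕ → ℕ → ℕ
T k zero    = 0
T k (suc m) = T k m + (2 * m + 1) ^ k

binSum : ∀ {n} → ℕ → ℕ → Vec ℚ n → ℚ
binSum N j []       = 0ℚ
binSum N j (b ∷ bs) = ((+ (N C j)) ℚ./ 1) ℚ.* b ℚ.+ binSum N (suc j) bs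

-- bernVec n = B_0, ..., B_n  using  B_0 = 1,
-- B_{n} = -(1/(n+1)) Σ_{j<n} C(n+1, j) B_j   (n ≥ 1),
-- the standard recurrence for z/(e^z-1) = Σ B_j z^j/j!  (so B_1 = -1/2).
bernVec : (n : ℕ) → Vec ℚ (suc n)
bernVec zero    = 1ℚ ∷ []
bernVec (suc n) = bs ∷ʳ (ℚ.- ((+ 1 ℚ./ (suc (suc n))) ℚ.* binSum (suc (suc n)) 0 bs))
  where bs = bernVec n

B : ℕ → ℚ
B n = last (bernVec n)

U : ℕ → ℤ
U n = ℚ.↥ (B n)

-- p-adic valuation of a natural number (computed with fuel; ord p 0 = 0 by convention,
-- only ever used on nonzero arguments with p ≥ 2)
ordF : ℕ → ℕ → ℕ → ℕ
ordF zero    p             n       = 0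
ordF (suc f) zero          n       = 0
ordF (suc f) (suc zero)    n       = 0
ordF (suc f) (suc (suc q)) zero    = 0
ordF (suc f) (suc (suc q)) (suc n) with suc (suc q) ∣? suc n
... | no  _ = 0
... | yes _ = suc (ordF f (suc (suc q)) (suc n ℕ./ suc (suc q)))

ordℕ : ℕ → ℕ → ℕ
ordℕ p n = ordF n p n

ordℚ : ℕ → ℚ → ℤ
ordℚ p q = + ordℕ p ℤ.∣ ℚ.↥ q ∣ ℤ.- + ordℕ p (ℚ.↧ₙ q)

-- q / k for a positive integer k (returns 0 for k = 0; only used with k ≥ 1)
divℕ : ℚ → ℕ → ℚ
divℕ q zero    = 0ℚ
divℕ q (suc k) = q ℚ.* (+ 1 ℚ./ suc k)

_≡_[mod_] : ℕ → ℕ → ℕ → Set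
a ≡ b [mod n ] = (+ n) ℤD.∣ (+ a ℤ.- + b)

IrregularPair : ℕ → ℕ → Set
IrregularPair r p = Prime p × ¬ (2 ℕD.∣ p) × 2 ℕD.∣ r × r ≤ p ∸ 3 × (+ p) ℤD.∣ U r

Irregular : ℕ → Set
Irregular p = Prime p × ¬ (2 ℕD.∣ p) × ∃ λ r → 2 ℕD.∣ r × r ≤ p ∸ 3 × (+ p) ℤD.∣ U r

{-# OPTIONS --safe #-}
module Submission where

-- Write n = 2m + 1, v = ord_p n, and S_k(N) for the sum of the j^k with j < N.  With B_k = U/V the recurrence for the
-- Bernoulli numbers gives D V S_k(N) ≡ D U N (mod N²) for all N with a fixed D ≥ 1, so U can be read off p-adically
-- from any family of N that are divisible by ever higher powers of p.
--
-- Since T_k(m) ≥ (n - 2)^k, the factor a is at most (5/3)^k, so T_k(m) carries almost all of the p-part of n^k.  This is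
-- impossible if p - 1 divides k (then p^v does not divide T_k(m)); otherwise p ≥ 5, k ≥ 4 and p^(3v + ord_p k)
-- divides T_k(m).  Passing from n to p n multiplies T_k by p up to an error containing k n² T_{k-2}, and 2^k S_k(n) ≡ 2 T_k(m)
-- (mod n²); in the limit ord_p(B_k/k) ≥ v.  Kummer's congruence (from Voronoi's) turns this into p | U_r for the residue r of k
-- modulo p - 1.  As U_2 = 1, r ≠ 2, hence p^v also divides T_{k-2}, and the same limit now gives ord_p(B_k/k) ≥ 2v.  Finally,
-- none of the excluded residues is the index of an irregular pair, by inspection of the first Bernoulli numbers.

open import Defs
open import Data.Nat using (ℕ; zero; suc; _+_; _*_; _^_; _≤_; _<_; _∸_; z≤n; s≤s; NonZero)
import Data.Nat as ℕ
open import Data.Nat.Combinatorics using (_C_; nCk+nC[k+1]≡[n+1]C[k+1]; nCn≡1; nC1≡n; k>n⇒nCk≡0)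
open import Data.Nat.Coprimality as Coprimality using (Coprime)
open import Data.Nat.Divisibility using (_∣_; _∤_; divides; _∣?_)
import Data.Nat.Divisibility as ℕ∣
import Data.Nat.DivMod as ℕ/
open import Data.Nat.GCD using (module Bézout)
open import Data.Nat.Induction using (<-rec)
open import Data.Nat.Primality as Primality using (Prime)
import Data.Nat.Properties as ℕₚ
open import Data.Nat.Tactic.RingSolver using () renaming (solve-∀ to ring-ℕ)
open import Data.Integer as ℤ using (ℤ; +_; 0ℤ; 1ℤ; -1ℤ)
import Data.Integer.Divisibility as ℤᵘ
open import Data.Integer.Divisibility.Signed as ℤ∣ using () renaming (_∣_ to _∣ℤ_; divides to dividesℤ)
import Data.Integer.Properties as ℤₚ
open import Data.Integer.Tactic.RingSolver using () renaming (solve-∀ to ring-ℤ)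
open import Data.Rational as ℚ using (ℚ; 0ℚ; 1ℚ)
import Data.Rational.Properties as ℚₚ
import Data.Rational.Unnormalised as ℚᵘ
import Data.Rational.Unnormalised.Properties as ℚᵘₚ
open import Data.Fin using (Fin; toℕ; fromℕ<)
import Data.Fin.Properties as Finₚ
open import Data.Fin.Permutation using (Permutation; permutation)
open import Algebra.Properties.CommutativeMonoid.Sum ℤₚ.+-0-commutativeMonoid using (sum-permute; sum-cong-≗) renaming (sum to ∑ᶠ)
open import Data.Vec using (Vec; []; _∷_; _∷ʳ_; last)
open import Data.Vec.Properties using (last-∷ʳ)
open import Data.List using (List; _∷_; [])
open import Data.List.Membership.Propositional using (_∈_)
open import Data.List.Relation.Unary.Any using (here; there)
open import Data.Product using (_×_; ∃; _,_; proj₁; proj₂)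
open import Data.Sum using (_⊎_; inj₁; inj₂)
open import Data.Empty using (⊥; ⊥-elim)
open import Function using (_∘_)
open import Relation.Nullary using (¬_; ¬?; yes; no; contradiction)
open import Relation.Binary.PropositionalEquality using (_≡_; _≢_; refl; sym; trans; cong; cong₂; subst; subst₂; module ≡-Reasoning)
open import Level using (0ℓ)
open import Relation.Nullary.Decidable using (dec⇒maybe; from-yes; from-no)
import Tactic.RingSolver as RingSolver
open import Tactic.RingSolver.Core.AlmostCommutativeRing using (AlmostCommutativeRing; fromCommutativeRing)

-- Finite sums and congruences of integers

-- The obstacle: Bernoulli numbers enter only through congruences modulo N², so N = n alone
-- determines U to at most v p-adic digits, while 2v + ord_p k are wanted. Hence the passage to p^s
-- n, during which T_k has to gain a factor p at every step. With p = 2h + 1 the error of one step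
-- is 4 k (k-1) n² T_{k-2}(m) (1² + ... + h²). The sum of squares is divisible by p because p ≥ 5,
-- and this is the gained factor; if moreover p^u divides T_{k-2}, the error allows T_k the exponent
-- 2v + u + ord_p k. The value u = v explains the 3v + ord_p k asked of T_k(m). There is a circle: u
-- = v requires that p - 1 does not divide k - 2, which is known only once p | U_r. Therefore the
-- same descent runs twice, with u = 0 to feed Kummer's congruence and with u = v for the final
-- bound. No p-adic limit is formed. The factor D is not controlled at p, but it costs only the
-- fixed amount ord_p D, and a single large enough s absorbs it.

∑ : ℕ → (ℕ → ℤ) → ℤ
∑ zero    f = 0ℤ
∑ (suc n) f = ∑ n f ℤ.+ f n

∑-cong : ∀ n {f g : ℕ → ℤ} → (∀ i → i < n → f i ≡ g i) → ∑ n f ≡ ∑ n g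
∑-cong zero    e = refl
∑-cong (suc n) e = cong₂ ℤ._+_ (∑-cong n (λ i i<n → e i (ℕₚ.m<n⇒m<1+n i<n))) (e n ℕₚ.≤-refl)

∑-distrib-+ : ∀ n (f g : ℕ → ℤ) → ∑ n (λ i → f i ℤ.+ g i) ≡ ∑ n f ℤ.+ ∑ n g
∑-distrib-+ zero    f g = refl
∑-distrib-+ (suc n) f g = trans (cong (ℤ._+ (f n ℤ.+ g n)) (∑-distrib-+ n f g)) (lemma (∑ n f) (∑ n g) (f n) (g n))
  where
  lemma : ∀ a b c d → (a ℤ.+ b) ℤ.+ (c ℤ.+ d) ≡ (a ℤ.+ c) ℤ.+ (b ℤ.+ d)
  lemma = ring-ℤ

∑-*ˡ : ∀ n c (f : ℕ → ℤ) → ∑ n (λ i → c ℤ.* f i) ≡ c ℤ.* ∑ n f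
∑-*ˡ zero    c f = sym (ℤₚ.*-zeroʳ c)
∑-*ˡ (suc n) c f = trans (cong (ℤ._+ c ℤ.* f n) (∑-*ˡ n c f)) (sym (ℤₚ.*-distribˡ-+ c (∑ n f) (f n)))

∑-const : ∀ n c → ∑ n (λ _ → c) ≡ + n ℤ.* c
∑-const zero    c = refl
∑-const (suc n) c = trans (cong (ℤ._+ c) (∑-const n c)) (lemma (+ n) c)
  where
  lemma : ∀ n c → n ℤ.* c ℤ.+ c ≡ (1ℤ ℤ.+ n) ℤ.* c
  lemma = ring-ℤ

∑-split : ∀ m n (f : ℕ → ℤ) → ∑ (m + n) f ≡ ∑ m f ℤ.+ ∑ n (λ i → f (m + i))
∑-split m zero    f = trans (cong (λ l → ∑ l f) (ℕₚ.+-identityʳ m)) (sym (ℤₚ.+-identityʳ _))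
∑-split m (suc n) f = trans (cong (λ l → ∑ l f) (ℕₚ.+-suc m n))
  (trans (cong (ℤ._+ f (m + n)) (∑-split m n f)) (ℤₚ.+-assoc (∑ m f) _ _))

∑-first : ∀ n (f : ℕ → ℤ) → ∑ (suc n) f ≡ f 0 ℤ.+ ∑ n (f ∘ suc)
∑-first n f = trans (∑-split 1 n f) (cong (ℤ._+ ∑ n (f ∘ suc)) (ℤₚ.+-identityˡ (f 0)))

∑-∣ : ∀ n {d} {f : ℕ → ℤ} → (∀ i → i < n → d ∣ℤ f i) → d ∣ℤ ∑ n f
∑-∣ zero    h = dividesℤ 0ℤ refl
∑-∣ (suc n) h = ℤ∣.∣m∣n⇒∣m+n (∑-∣ n (λ i i<n → h i (ℕₚ.m<n⇒m<1+n i<n))) (h n ℕₚ.≤-refl)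

pos-^ : ∀ n k → + (n ^ k) ≡ (+ n) ℤ.^ k
pos-^ n zero    = refl
pos-^ n (suc k) = trans (ℤₚ.pos-* n (n ^ k)) (cong (+ n ℤ.*_) (pos-^ n k))

^-distribʳ-* : ∀ x y k → (x ℤ.* y) ℤ.^ k ≡ x ℤ.^ k ℤ.* y ℤ.^ k
^-distribʳ-* x y zero    = refl
^-distribʳ-* x y (suc k) = trans (cong ((x ℤ.* y) ℤ.*_) (^-distribʳ-* x y k)) (lemma x y (x ℤ.^ k) (y ℤ.^ k))
  where
  lemma : ∀ a b c d → (a ℤ.* b) ℤ.* (c ℤ.* d) ≡ (a ℤ.* c) ℤ.* (b ℤ.* d)
  lemma = ring-ℤ

∣-pos : ∀ {m n} → m ∣ n → + m ∣ℤ + n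
∣-pos = ℤ∣.∣ᵤ⇒∣

infix 4 _≅_[_]

record _≅_[_] (a b d : ℤ) : Set where
  constructor congruent
  field difference : d ∣ℤ a ℤ.- b

open _≅_[_]

≅-reflexive : ∀ {a b d} → a ≡ b → a ≅ b [ d ]
≅-reflexive {a} refl = congruent (dividesℤ 0ℤ (ℤₚ.+-inverseʳ a))

≅-refl : ∀ {a d} → a ≅ a [ d ]
≅-refl = ≅-reflexive refl

≅-sym : ∀ {a b d} → a ≅ b [ d ] → b ≅ a [ d ]
≅-sym {a} {b} {d} (congruent h) = congruent (subst (d ∣ℤ_) (lemma a b) (ℤ∣.∣m⇒∣-m h))
  where
  lemma : ∀ a b → ℤ.- (a ℤ.- b) ≡ b ℤ.- a
  lemma = ring-ℤ

≅-trans : ∀ {a b c d} → a ≅ b [ d ] → b ≅ c [ d ] → a ≅ c [ d ]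
≅-trans {a} {b} {c} {d} (congruent h) (congruent h′) = congruent (subst (d ∣ℤ_) (lemma a b c) (ℤ∣.∣m∣n⇒∣m+n h h′))
  where
  lemma : ∀ a b c → (a ℤ.- b) ℤ.+ (b ℤ.- c) ≡ a ℤ.- c
  lemma = ring-ℤ

≅-+ : ∀ {a b a′ b′ d} → a ≅ b [ d ] → a′ ≅ b′ [ d ] → a ℤ.+ a′ ≅ b ℤ.+ b′ [ d ]
≅-+ {a} {b} {a′} {b′} {d} (congruent h) (congruent h′) = congruent (subst (d ∣ℤ_) (lemma a b a′ b′) (ℤ∣.∣m∣n⇒∣m+n h h′))
  where
  lemma : ∀ a b c e → (a ℤ.- b) ℤ.+ (c ℤ.- e) ≡ (a ℤ.+ c) ℤ.- (b ℤ.+ e)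
  lemma = ring-ℤ

≅-* : ∀ {a b a′ b′ d} → a ≅ b [ d ] → a′ ≅ b′ [ d ] → a ℤ.* a′ ≅ b ℤ.* b′ [ d ]
≅-* {a} {b} {a′} {b′} {d} (congruent h) (congruent h′) = congruent
  (subst (d ∣ℤ_) (lemma a b a′ b′) (ℤ∣.∣m∣n⇒∣m+n (ℤ∣.∣m⇒∣m*n a′ h) (ℤ∣.∣n⇒∣m*n b h′)))
  where
  lemma : ∀ a b c e → (a ℤ.- b) ℤ.* c ℤ.+ b ℤ.* (c ℤ.- e) ≡ a ℤ.* c ℤ.- b ℤ.* e
  lemma = ring-ℤ

≅-*ˡ : ∀ c {a b d} → a ≅ b [ d ] → c ℤ.* a ≅ c ℤ.* b [ d ]
≅-*ˡ c = ≅-* (≅-refl {c})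

≅-^ : ∀ k {a b d} → a ≅ b [ d ] → a ℤ.^ k ≅ b ℤ.^ k [ d ]
≅-^ zero    h = ≅-refl
≅-^ (suc k) h = ≅-* h (≅-^ k h)

≅-∑ : ∀ n {f g d} → (∀ i → i < n → f i ≅ g i [ d ]) → ∑ n f ≅ ∑ n g [ d ]
≅-∑ zero    h = ≅-refl
≅-∑ (suc n) h = ≅-+ (≅-∑ n (λ i i<n → h i (ℕₚ.m<n⇒m<1+n i<n))) (h n ℕₚ.≤-refl)

≅-∣ : ∀ {a b d e} → e ∣ℤ d → a ≅ b [ d ] → a ≅ b [ e ]
≅-∣ e∣d (congruent h) = congruent (ℤ∣.∣-trans e∣d h)

≅0⇒∣ : ∀ {a d} → a ≅ 0ℤ [ d ] → d ∣ℤ a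
≅0⇒∣ {a} {d} (congruent h) = subst (d ∣ℤ_) (ℤₚ.+-identityʳ a) h

∣⇒≅0 : ∀ {a d} → d ∣ℤ a → a ≅ 0ℤ [ d ]
∣⇒≅0 {a} {d} h = congruent (subst (d ∣ℤ_) (sym (ℤₚ.+-identityʳ a)) h)

≅-∣-resp : ∀ {a b d} → a ≅ b [ d ] → d ∣ℤ b → d ∣ℤ a
≅-∣-resp h d∣b = ≅0⇒∣ (≅-trans h (∣⇒≅0 d∣b))

≅-+-multiple : ∀ a {b d} → d ∣ℤ b → a ℤ.+ b ≅ a [ d ]
≅-+-multiple a h = ≅-trans (≅-+ (≅-refl {a}) (∣⇒≅0 h)) (≅-reflexive (ℤₚ.+-identityʳ a))

-- Binomial coefficients and the binomial theorem

C-absorption : ∀ n i → suc i * (suc n C suc i) ≡ suc n * (n C i)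
C-absorption zero    zero    = refl
C-absorption zero    (suc i) = trans (cong (suc (suc i) *_) (k>n⇒nCk≡0 {1} {suc (suc i)} (s≤s (s≤s z≤n))))
  (trans (ℕₚ.*-zeroʳ (suc (suc i))) (sym (trans (ℕₚ.+-identityʳ (0 C suc i)) (k>n⇒nCk≡0 {0} {suc i} (s≤s z≤n)))))
C-absorption (suc n) zero    = trans (ℕₚ.+-identityʳ _) (trans (nC1≡n (suc (suc n))) (sym (ℕₚ.*-identityʳ (suc (suc n)))))
C-absorption (suc n) (suc i) = begin
  suc (suc i) * (suc (suc n) C suc (suc i))
    ≡⟨ cong (suc (suc i) *_) (nCk+nC[k+1]≡[n+1]C[k+1] (suc n) (suc i)) ⟨
  suc (suc i) * (suc n C suc i + suc n C suc (suc i))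
    ≡⟨ expand (suc i) (suc n C suc i) (suc n C suc (suc i)) ⟩
  suc n C suc i + suc i * (suc n C suc i) + suc (suc i) * (suc n C suc (suc i))
    ≡⟨ cong₂ (λ x y → suc n C suc i + x + y) (C-absorption n i) (C-absorption n (suc i)) ⟩
  suc n C suc i + suc n * (n C i) + suc n * (n C suc i)
    ≡⟨ collect (suc n C suc i) (suc n) (n C i) (n C suc i) ⟩
  suc n C suc i + suc n * (n C i + n C suc i)
    ≡⟨ cong (λ x → suc n C suc i + suc n * x) (nCk+nC[k+1]≡[n+1]C[k+1] n i) ⟩
  suc (suc n) * (suc n C suc i) ∎
  where
  open ≡-Reasoning
  expand : ∀ j a b → suc j * (a + b) ≡ a + j * a + suc j * b
  expand = ring-ℕ
  collect : ∀ c n a b → c + n * a + n * b ≡ c + n * (a + b)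
  collect = ring-ℕ

binomialTerm : ℤ → ℤ → ℕ → ℕ → ℤ
binomialTerm x y n i = + (n C i) ℤ.* (x ℤ.^ (n ∸ i) ℤ.* y ℤ.^ i)

binomialTerm-suc : ∀ x y n i → i ≤ n →
  binomialTerm x y (suc n) (suc i) ≡ y ℤ.* binomialTerm x y n i ℤ.+ x ℤ.* binomialTerm x y n (suc i)
binomialTerm-suc x y n i i≤n = trans
  (cong (λ c → + c ℤ.* (x ℤ.^ (n ∸ i) ℤ.* y ℤ.^ suc i)) (sym (nCk+nC[k+1]≡[n+1]C[k+1] n i)))
  (trans (cong (ℤ._* (x ℤ.^ (n ∸ i) ℤ.* y ℤ.^ suc i)) (ℤₚ.pos-+ (n C i) (n C suc i))) (shift (ℕₚ.m≤n⇒m<n∨m≡n i≤n)))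
  where
  equal : ∀ c d u y w → (c ℤ.+ d) ℤ.* (u ℤ.* (y ℤ.* w)) ≡ y ℤ.* (c ℤ.* (u ℤ.* w)) ℤ.+ d ℤ.* (u ℤ.* (y ℤ.* w))
  equal = ring-ℤ
  commute : ∀ x d u w → d ℤ.* ((x ℤ.* u) ℤ.* w) ≡ x ℤ.* (d ℤ.* (u ℤ.* w))
  commute = ring-ℤ
  right : i < n ⊎ i ≡ n → + (n C suc i) ℤ.* (x ℤ.^ (n ∸ i) ℤ.* y ℤ.^ suc i) ≡ x ℤ.* binomialTerm x y n (suc i)
  right (inj₁ i<n) = trans (cong (λ e → + (n C suc i) ℤ.* (x ℤ.^ e ℤ.* y ℤ.^ suc i)) (ℕₚ.+-∸-assoc 1 i<n))
    (commute x (+ (n C suc i)) (x ℤ.^ (n ∸ suc i)) (y ℤ.^ suc i))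
  -- At i = n the exponent `n ∸ suc i` is truncated, but the coefficient C(n, n+1) = 0 removes the
  -- term.
  right (inj₂ refl) rewrite k>n⇒nCk≡0 (ℕₚ.n<1+n n) = sym (ℤₚ.*-zeroʳ x)
  shift : i < n ⊎ i ≡ n → (+ (n C i) ℤ.+ + (n C suc i)) ℤ.* (x ℤ.^ (n ∸ i) ℤ.* y ℤ.^ suc i)
    ≡ y ℤ.* binomialTerm x y n i ℤ.+ x ℤ.* binomialTerm x y n (suc i)
  shift c = trans (equal (+ (n C i)) (+ (n C suc i)) (x ℤ.^ (n ∸ i)) y (y ℤ.^ i))
    (cong (λ z → y ℤ.* binomialTerm x y n i ℤ.+ z) (right c))

binomial-theorem : ∀ x y n → (x ℤ.+ y) ℤ.^ n ≡ ∑ (suc n) (binomialTerm x y n)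
binomial-theorem x y zero    = refl
binomial-theorem x y (suc n) = begin
  (x ℤ.+ y) ℤ.* (x ℤ.+ y) ℤ.^ n
    ≡⟨ cong ((x ℤ.+ y) ℤ.*_) (binomial-theorem x y n) ⟩
  (x ℤ.+ y) ℤ.* ∑ (suc n) b
    ≡⟨ distrib x y (∑ (suc n) b) ⟩
  y ℤ.* ∑ (suc n) b ℤ.+ x ℤ.* (∑ (suc n) b ℤ.+ 0ℤ)
    ≡⟨ cong (λ z → y ℤ.* ∑ (suc n) b ℤ.+ x ℤ.* (∑ (suc n) b ℤ.+ z)) top ⟨
  y ℤ.* ∑ (suc n) b ℤ.+ x ℤ.* ∑ (suc (suc n)) b
    ≡⟨ cong (λ z → y ℤ.* ∑ (suc n) b ℤ.+ x ℤ.* z) (∑-first (suc n) b) ⟩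
  y ℤ.* ∑ (suc n) b ℤ.+ x ℤ.* (b 0 ℤ.+ ∑ (suc n) (b ∘ suc))
    ≡⟨ regroup x (b 0) (∑ (suc n) (b ∘ suc)) (y ℤ.* ∑ (suc n) b) ⟩
  x ℤ.* b 0 ℤ.+ (y ℤ.* ∑ (suc n) b ℤ.+ x ℤ.* ∑ (suc n) (b ∘ suc))
    ≡⟨ cong₂ (λ u v → x ℤ.* b 0 ℤ.+ (u ℤ.+ v)) (∑-*ˡ (suc n) y b) (∑-*ˡ (suc n) x (b ∘ suc)) ⟨
  x ℤ.* b 0 ℤ.+ (∑ (suc n) (λ i → y ℤ.* b i) ℤ.+ ∑ (suc n) (λ i → x ℤ.* b (suc i)))
    ≡⟨ cong₂ ℤ._+_ (head x (x ℤ.^ n)) (sym (∑-distrib-+ (suc n) (λ i → y ℤ.* b i) (λ i → x ℤ.* b (suc i)))) ⟩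
  b′ 0 ℤ.+ ∑ (suc n) (λ i → y ℤ.* b i ℤ.+ x ℤ.* b (suc i))
    ≡⟨ cong (λ z → b′ 0 ℤ.+ z) (∑-cong (suc n) (λ { i (s≤s i≤n) → sym (binomialTerm-suc x y n i i≤n) })) ⟩
  b′ 0 ℤ.+ ∑ (suc n) (b′ ∘ suc)
    ≡⟨ ∑-first (suc n) b′ ⟨
  ∑ (suc (suc n)) b′ ∎
  where
  open ≡-Reasoning
  b = binomialTerm x y n
  b′ = binomialTerm x y (suc n)
  -- The vanishing term of index n + 1 is added so that the sum multiplied by x can be shifted by
  -- one and matched with the sum multiplied by y, as in Pascal's rule.
  top : b (suc n) ≡ 0ℤ
  top rewrite k>n⇒nCk≡0 (ℕₚ.n<1+n n) = refl
  distrib : ∀ x y s → (x ℤ.+ y) ℤ.* s ≡ y ℤ.* s ℤ.+ x ℤ.* (s ℤ.+ 0ℤ)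
  distrib = ring-ℤ
  regroup : ∀ x b s t → t ℤ.+ x ℤ.* (b ℤ.+ s) ≡ x ℤ.* b ℤ.+ (t ℤ.+ x ℤ.* s)
  regroup = ring-ℤ
  head : ∀ x u → x ℤ.* (1ℤ ℤ.* (u ℤ.* 1ℤ)) ≡ 1ℤ ℤ.* ((x ℤ.* u) ℤ.* 1ℤ)
  head = ring-ℤ

-- Power sums and Bernoulli numbers

S : ℕ → ℕ → ℤ
S k n = ∑ n (λ j → (+ j) ℤ.^ k)

-- Telescoping of (j+1)^(k+1) - j^(k+1), as an induction on N: the new summands N^i together form
-- the expansion of (N+1)^(k+1) without its top term. Since 0^0 = 1, `S 0 N` is N.
power-sum-recurrence : ∀ k N → ∑ (suc k) (λ i → + (suc k C i) ℤ.* S i N) ≡ (+ N) ℤ.^ suc k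
power-sum-recurrence k zero    = trans (∑-cong (suc k) (λ i _ → ℤₚ.*-zeroʳ (+ (suc k C i)))) (trans (∑-const (suc k) 0ℤ) (ℤₚ.*-zeroʳ (+ suc k)))
power-sum-recurrence k (suc N) = begin
  ∑ (suc k) (λ i → + (suc k C i) ℤ.* (S i N ℤ.+ (+ N) ℤ.^ i))
    ≡⟨ ∑-cong (suc k) (λ i _ → ℤₚ.*-distribˡ-+ (+ (suc k C i)) (S i N) ((+ N) ℤ.^ i)) ⟩
  ∑ (suc k) (λ i → + (suc k C i) ℤ.* S i N ℤ.+ + (suc k C i) ℤ.* (+ N) ℤ.^ i)
    ≡⟨ ∑-distrib-+ (suc k) (λ i → + (suc k C i) ℤ.* S i N) (λ i → + (suc k C i) ℤ.* (+ N) ℤ.^ i) ⟩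
  ∑ (suc k) (λ i → + (suc k C i) ℤ.* S i N) ℤ.+ ∑ (suc k) (λ i → + (suc k C i) ℤ.* (+ N) ℤ.^ i)
    ≡⟨ cong₂ ℤ._+_ (power-sum-recurrence k N) (∑-cong (suc k) (λ i _ → cong (+ (suc k C i) ℤ.*_) (one i))) ⟩
  (+ N) ℤ.^ suc k ℤ.+ ∑ (suc k) (binomialTerm 1ℤ (+ N) (suc k))
    ≡⟨ ℤₚ.+-comm ((+ N) ℤ.^ suc k) _ ⟩
  ∑ (suc k) (binomialTerm 1ℤ (+ N) (suc k)) ℤ.+ (+ N) ℤ.^ suc k
    ≡⟨ cong (λ z → ∑ (suc k) (binomialTerm 1ℤ (+ N) (suc k)) ℤ.+ z) top ⟨
  ∑ (suc (suc k)) (binomialTerm 1ℤ (+ N) (suc k))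
    ≡⟨ binomial-theorem 1ℤ (+ N) (suc k) ⟨
  (+ suc N) ℤ.^ suc k ∎
  where
  open ≡-Reasoning
  one : ∀ i → (+ N) ℤ.^ i ≡ 1ℤ ℤ.^ (suc k ∸ i) ℤ.* (+ N) ℤ.^ i
  one i = sym (trans (cong (ℤ._* (+ N) ℤ.^ i) (ℤₚ.^-zeroˡ (suc k ∸ i))) (ℤₚ.*-identityˡ _))
  w = 1ℤ ℤ.^ (suc k ∸ suc k) ℤ.* (+ N) ℤ.^ suc k
  top : binomialTerm 1ℤ (+ N) (suc k) (suc k) ≡ (+ N) ℤ.^ suc k
  top = trans (cong (λ c → + c ℤ.* w) (nCn≡1 (suc k))) (trans (ℤₚ.*-identityˡ w) (sym (one (suc k))))

-- Integers inside the rationals, and the Bernoulli recurrence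

ℚ-ring : AlmostCommutativeRing 0ℓ 0ℓ
ℚ-ring = fromCommutativeRing ℚₚ.+-*-commutativeRing (λ q → dec⇒maybe (0ℚ ℚₚ.≟ q))

ι : ℤ → ℚ
ι z = z ℚ./ 1

toℚᵘ-ι : ∀ z → ℚ.toℚᵘ (ι z) ℚᵘ.≃ ℚᵘ.mkℚᵘ z 0
toℚᵘ-ι z = ℚₚ.toℚᵘ-fromℚᵘ (ℚᵘ.mkℚᵘ z 0)

ι-+ : ∀ a b → ι (a ℤ.+ b) ≡ ι a ℚ.+ ι b
ι-+ a b = ℚₚ.toℚᵘ-injective (ℚᵘₚ.≃-trans (toℚᵘ-ι (a ℤ.+ b)) (ℚᵘₚ.≃-trans (ℚᵘ.*≡* (lemma a b))
  (ℚᵘₚ.≃-trans (ℚᵘₚ.+-cong (ℚᵘₚ.≃-sym (toℚᵘ-ι a)) (ℚᵘₚ.≃-sym (toℚᵘ-ι b))) (ℚᵘₚ.≃-sym (ℚₚ.toℚᵘ-homo-+ (ι a) (ι b))))))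
  where
  lemma : ∀ a b → (a ℤ.+ b) ℤ.* (1ℤ ℤ.* 1ℤ) ≡ (a ℤ.* 1ℤ ℤ.+ b ℤ.* 1ℤ) ℤ.* 1ℤ
  lemma = ring-ℤ

ι-* : ∀ a b → ι (a ℤ.* b) ≡ ι a ℚ.* ι b
ι-* a b = ℚₚ.toℚᵘ-injective (ℚᵘₚ.≃-trans (toℚᵘ-ι (a ℤ.* b)) (ℚᵘₚ.≃-trans (ℚᵘ.*≡* (lemma a b))
  (ℚᵘₚ.≃-trans (ℚᵘₚ.*-cong (ℚᵘₚ.≃-sym (toℚᵘ-ι a)) (ℚᵘₚ.≃-sym (toℚᵘ-ι b))) (ℚᵘₚ.≃-sym (ℚₚ.toℚᵘ-homo-* (ι a) (ι b))))))
  where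
  lemma : ∀ a b → (a ℤ.* b) ℤ.* (1ℤ ℤ.* 1ℤ) ≡ (a ℤ.* b) ℤ.* 1ℤ
  lemma = ring-ℤ

ι-injective : ∀ {a b} → ι a ≡ ι b → a ≡ b
ι-injective {a} {b} e with ℚᵘₚ.≃-trans (ℚᵘₚ.≃-sym (toℚᵘ-ι a)) (ℚᵘₚ.≃-trans (ℚₚ.toℚᵘ-cong e) (toℚᵘ-ι b))
... | ℚᵘ.*≡* h = trans (sym (ℤₚ.*-identityʳ a)) (trans h (ℤₚ.*-identityʳ b))

denominator-* : ∀ q → ι (ℚ.↧ q) ℚ.* q ≡ ι (ℚ.↥ q)
denominator-* q@record{} = ℚₚ.toℚᵘ-injective (ℚᵘₚ.≃-trans (ℚₚ.toℚᵘ-homo-* (ι (ℚ.↧ q)) q)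
  (ℚᵘₚ.≃-trans (ℚᵘₚ.*-congʳ (toℚᵘ-ι (ℚ.↧ q))) (ℚᵘₚ.≃-trans (ℚᵘ.*≡* (lemma (ℚ.↧ q) (ℚ.↥ q))) (ℚᵘₚ.≃-sym (toℚᵘ-ι (ℚ.↥ q))))))
  where
  lemma : ∀ d n → (d ℤ.* n) ℤ.* 1ℤ ≡ n ℤ.* (1ℤ ℤ.* d)
  lemma = ring-ℤ

∑ℚ : ℕ → (ℕ → ℚ) → ℚ
∑ℚ zero    f = 0ℚ
∑ℚ (suc n) f = ∑ℚ n f ℚ.+ f n

binSum-∷ʳ : ∀ {n} N j (bs : Vec ℚ n) x → binSum N j (bs ∷ʳ x) ≡ binSum N j bs ℚ.+ ι (+ (N C (j + n))) ℚ.* x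
binSum-∷ʳ N j []       x = trans (ℚₚ.+-comm (ι (+ (N C j)) ℚ.* x) 0ℚ) (cong (λ i → 0ℚ ℚ.+ ι (+ (N C i)) ℚ.* x) (sym (ℕₚ.+-identityʳ j)))
binSum-∷ʳ {suc n} N j (b ∷ bs) x = trans (cong (λ s → ι (+ (N C j)) ℚ.* b ℚ.+ s) (binSum-∷ʳ N (suc j) bs x))
  (trans (sym (ℚₚ.+-assoc (ι (+ (N C j)) ℚ.* b) (binSum N (suc j) bs) (ι (+ (N C (suc j + n))) ℚ.* x)))
    (cong (λ i → (ι (+ (N C j)) ℚ.* b ℚ.+ binSum N (suc j) bs) ℚ.+ ι (+ (N C i)) ℚ.* x) (sym (ℕₚ.+-suc j n))))

bernoulliStep : ℕ → ℚ
bernoulliStep n = ℚ.- ((+ 1 ℚ./ suc (suc n)) ℚ.* binSum (suc (suc n)) 0 (bernVec n))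

B-suc : ∀ n → B (suc n) ≡ bernoulliStep n
B-suc n = last-∷ʳ (bernoulliStep n) (bernVec n)

binSum-bernVec : ∀ N n → binSum N 0 (bernVec n) ≡ ∑ℚ (suc n) (λ i → ι (+ (N C i)) ℚ.* B i)
binSum-bernVec N zero    = ℚₚ.+-comm (ι (+ (N C 0)) ℚ.* 1ℚ) 0ℚ
binSum-bernVec N (suc n) = trans (binSum-∷ʳ N 0 (bernVec n) (bernoulliStep n))
  (cong₂ (λ s x → s ℚ.+ ι (+ (N C suc n)) ℚ.* x) (binSum-bernVec N n) (sym (B-suc n)))

nC[n-1]≡n : ∀ n → suc n C n ≡ suc n
nC[n-1]≡n zero    = refl
nC[n-1]≡n (suc n) = trans (sym (nCk+nC[k+1]≡[n+1]C[k+1] (suc n) n))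
  (trans (cong₂ _+_ (nC[n-1]≡n n) (nCn≡1 (suc n))) (ℕₚ.+-comm (suc n) 1))

-- The defining formula multiplied by n + 2 = C(n+2, n+1). It is the linear system of
-- `power-sum-recurrence` with right side 0, which is why the two can be subtracted.
bernoulli-recurrence : ∀ n → ∑ℚ (suc (suc n)) (λ i → ι (+ (suc (suc n) C i)) ℚ.* B i) ≡ 0ℚ
bernoulli-recurrence n = begin
  s ℚ.+ ι (+ (suc (suc n) C suc n)) ℚ.* B (suc n)
    ≡⟨ cong₂ (λ c b → s ℚ.+ ι (+ c) ℚ.* b) (nC[n-1]≡n (suc n)) (B-suc n) ⟩
  s ℚ.+ ι (+ suc (suc n)) ℚ.* bernoulliStep n
    ≡⟨ cong (λ t → s ℚ.+ ι (+ suc (suc n)) ℚ.* (ℚ.- (u ℚ.* t))) (binSum-bernVec (suc (suc n)) n) ⟩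
  s ℚ.+ ι (+ suc (suc n)) ℚ.* (ℚ.- (u ℚ.* s))
    ≡⟨ regroup s (ι (+ suc (suc n))) u ⟩
  s ℚ.+ (ℚ.- ((ι (+ suc (suc n)) ℚ.* u) ℚ.* s))
    ≡⟨ cong (λ t → s ℚ.+ (ℚ.- (t ℚ.* s))) unit ⟩
  s ℚ.+ (ℚ.- (1ℚ ℚ.* s))
    ≡⟨ cong (λ t → s ℚ.+ (ℚ.- t)) (ℚₚ.*-identityˡ s) ⟩
  s ℚ.+ (ℚ.- s)
    ≡⟨ ℚₚ.+-inverseʳ s ⟩
  0ℚ ∎
  where
  open ≡-Reasoning
  s = ∑ℚ (suc n) (λ i → ι (+ (suc (suc n) C i)) ℚ.* B i)
  u = + 1 ℚ./ suc (suc n)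
  regroup : ∀ s i u → s ℚ.+ i ℚ.* (ℚ.- (u ℚ.* s)) ≡ s ℚ.+ (ℚ.- ((i ℚ.* u) ℚ.* s))
  regroup = RingSolver.solve-∀ ℚ-ring
  unit : ι (+ suc (suc n)) ℚ.* u ≡ 1ℚ
  unit = ℚₚ.toℚᵘ-injective (ℚᵘₚ.≃-trans (ℚₚ.toℚᵘ-homo-* (ι (+ suc (suc n))) u)
    (ℚᵘₚ.≃-trans (ℚᵘₚ.*-cong (toℚᵘ-ι (+ suc (suc n))) (ℚₚ.toℚᵘ-fromℚᵘ (ℚᵘ.mkℚᵘ (+ 1) (suc n))))
      (ℚᵘ.*≡* (lemma (+ suc (suc n))))))
    where
    lemma : ∀ i → (i ℤ.* 1ℤ) ℤ.* 1ℤ ≡ 1ℤ ℤ.* (1ℤ ℤ.* i)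
    lemma = ring-ℤ

-- The denominator d + 1 must not depend on N.
Quadratic : (ℕ → ℚ) → Set
Quadratic f = ∃ λ d → ∀ N → ∃ λ z → ι (+ suc d) ℚ.* f N ≡ ι ((+ N ℤ.* + N) ℤ.* z)

quadratic-cong : ∀ {f g} → (∀ N → f N ≡ g N) → Quadratic f → Quadratic g
quadratic-cong e (d , h) = d , λ N → proj₁ (h N) , trans (cong (λ x → ι (+ suc d) ℚ.* x) (sym (e N))) (proj₂ (h N))

quadratic-+ : ∀ {f g} → Quadratic f → Quadratic g → Quadratic (λ N → f N ℚ.+ g N)
quadratic-+ {f} {g} (d , h) (e , k) = (e + d * suc e) , λ N →
  (+ suc e ℤ.* proj₁ (h N) ℤ.+ + suc d ℤ.* proj₁ (k N)) , (begin
  ι (+ (suc d * suc e)) ℚ.* (f N ℚ.+ g N)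
    ≡⟨ cong (λ x → x ℚ.* (f N ℚ.+ g N)) (trans (cong ι (ℤₚ.pos-* (suc d) (suc e))) (ι-* (+ suc d) (+ suc e))) ⟩
  (ι (+ suc d) ℚ.* ι (+ suc e)) ℚ.* (f N ℚ.+ g N)
    ≡⟨ distribute (ι (+ suc d)) (ι (+ suc e)) (f N) (g N) ⟩
  ι (+ suc e) ℚ.* (ι (+ suc d) ℚ.* f N) ℚ.+ ι (+ suc d) ℚ.* (ι (+ suc e) ℚ.* g N)
    ≡⟨ cong₂ (λ x y → ι (+ suc e) ℚ.* x ℚ.+ ι (+ suc d) ℚ.* y) (proj₂ (h N)) (proj₂ (k N)) ⟩
  ι (+ suc e) ℚ.* ι (n² N ℤ.* proj₁ (h N)) ℚ.+ ι (+ suc d) ℚ.* ι (n² N ℤ.* proj₁ (k N))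
    ≡⟨ cong₂ ℚ._+_ (ι-* (+ suc e) (n² N ℤ.* proj₁ (h N))) (ι-* (+ suc d) (n² N ℤ.* proj₁ (k N))) ⟨
  ι (+ suc e ℤ.* (n² N ℤ.* proj₁ (h N))) ℚ.+ ι (+ suc d ℤ.* (n² N ℤ.* proj₁ (k N)))
    ≡⟨ ι-+ (+ suc e ℤ.* (n² N ℤ.* proj₁ (h N))) (+ suc d ℤ.* (n² N ℤ.* proj₁ (k N))) ⟨
  ι (+ suc e ℤ.* (n² N ℤ.* proj₁ (h N)) ℤ.+ + suc d ℤ.* (n² N ℤ.* proj₁ (k N)))
    ≡⟨ cong ι (collect (n² N) (+ suc e) (+ suc d) (proj₁ (h N)) (proj₁ (k N))) ⟩
  ι (n² N ℤ.* (+ suc e ℤ.* proj₁ (h N) ℤ.+ + suc d ℤ.* proj₁ (k N))) ∎)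
  where
  open ≡-Reasoning
  n² : ℕ → ℤ
  n² N = + N ℤ.* + N
  distribute : ∀ d e f g → (d ℚ.* e) ℚ.* (f ℚ.+ g) ≡ e ℚ.* (d ℚ.* f) ℚ.+ d ℚ.* (e ℚ.* g)
  distribute = RingSolver.solve-∀ ℚ-ring
  collect : ∀ n e d x y → e ℤ.* (n ℤ.* x) ℤ.+ d ℤ.* (n ℤ.* y) ≡ n ℤ.* (e ℤ.* x ℤ.+ d ℤ.* y)
  collect = ring-ℤ

quadratic-* : ∀ {f} c → Quadratic f → Quadratic (λ N → ι c ℚ.* f N)
quadratic-* {f} c (d , h) = d , λ N → (c ℤ.* proj₁ (h N)) ,
  trans (swapℚ (ι (+ suc d)) (ι c) (f N)) (trans (cong (λ x → ι c ℚ.* x) (proj₂ (h N)))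
    (trans (sym (ι-* c ((+ N ℤ.* + N) ℤ.* proj₁ (h N)))) (cong ι (swapℤ c (+ N ℤ.* + N) (proj₁ (h N))))))
  where
  swapℚ : ∀ d c f → d ℚ.* (c ℚ.* f) ≡ c ℚ.* (d ℚ.* f)
  swapℚ = RingSolver.solve-∀ ℚ-ring
  swapℤ : ∀ c n z → c ℤ.* (n ℤ.* z) ≡ n ℤ.* (c ℤ.* z)
  swapℤ = ring-ℤ

-- The factor is moved into the denominator, which remains independent of N.
quadratic-cancel : ∀ {f} c → Quadratic (λ N → ι (+ suc c) ℚ.* f N) → Quadratic f
quadratic-cancel {f} c (d , h) = (c + d * suc c) , λ N → proj₁ (h N) ,
  trans (cong (λ x → x ℚ.* f N) (trans (cong ι (ℤₚ.pos-* (suc d) (suc c))) (ι-* (+ suc d) (+ suc c))))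
    (trans (ℚₚ.*-assoc (ι (+ suc d)) (ι (+ suc c)) (f N)) (proj₂ (h N)))

quadratic-0 : Quadratic (λ _ → 0ℚ)
quadratic-0 = 0 , λ N → 0ℤ , cong ι (sym (ℤₚ.*-zeroʳ (+ N ℤ.* + N)))

quadratic-∑ : ∀ n {f : ℕ → ℕ → ℚ} → (∀ i → i < n → Quadratic (f i)) → Quadratic (λ N → ∑ℚ n (λ i → f i N))
quadratic-∑ zero    h = quadratic-0
quadratic-∑ (suc n) h = quadratic-+ (quadratic-∑ n (λ i i<n → h i (ℕₚ.m<n⇒m<1+n i<n))) (h n ℕₚ.≤-refl)

quadratic-power : ∀ k → Quadratic (λ N → ι ((+ N) ℤ.^ suc (suc k)))
quadratic-power k = 0 , λ N → (+ N) ℤ.^ k ,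
  trans (ℚₚ.*-identityˡ _) (cong ι (sym (ℤₚ.*-assoc (+ N) (+ N) ((+ N) ℤ.^ k))))

-- S_k(N) is a polynomial in N without constant term and with linear coefficient B_k; this is what
-- is left of it, a rational polynomial divisible by N².
powerSumError : ℕ → ℕ → ℚ
powerSumError k N = ι (S k N) ℚ.+ ι (ℤ.- (+ N)) ℚ.* B k

∑-powerSumError : ∀ (c : ℕ → ℕ) n N → ∑ℚ n (λ i → ι (+ c i) ℚ.* powerSumError i N)
  ≡ ι (∑ n (λ i → + c i ℤ.* S i N)) ℚ.+ ι (ℤ.- (+ N)) ℚ.* ∑ℚ n (λ i → ι (+ c i) ℚ.* B i)
∑-powerSumError c zero    N = sym (trans (cong (λ x → 0ℚ ℚ.+ x) (ℚₚ.*-zeroʳ (ι (ℤ.- (+ N))))) refl)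
∑-powerSumError c (suc n) N = begin
  ∑ℚ n (λ i → ι (+ c i) ℚ.* powerSumError i N) ℚ.+ ι (+ c n) ℚ.* powerSumError n N
    ≡⟨ cong (λ x → x ℚ.+ ι (+ c n) ℚ.* powerSumError n N) (∑-powerSumError c n N) ⟩
  (ι s ℚ.+ ι (ℤ.- (+ N)) ℚ.* t) ℚ.+ ι (+ c n) ℚ.* (ι (S n N) ℚ.+ ι (ℤ.- (+ N)) ℚ.* B n)
    ≡⟨ regroup (ι s) (ι (ℤ.- (+ N))) t (ι (+ c n)) (ι (S n N)) (B n) ⟩
  (ι s ℚ.+ ι (+ c n) ℚ.* ι (S n N)) ℚ.+ ι (ℤ.- (+ N)) ℚ.* (t ℚ.+ ι (+ c n) ℚ.* B n)
    ≡⟨ cong (λ x → x ℚ.+ ι (ℤ.- (+ N)) ℚ.* (t ℚ.+ ι (+ c n) ℚ.* B n))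
         (sym (trans (ι-+ s (+ c n ℤ.* S n N)) (cong (λ x → ι s ℚ.+ x) (ι-* (+ c n) (S n N))))) ⟩
  ι (s ℤ.+ + c n ℤ.* S n N) ℚ.+ ι (ℤ.- (+ N)) ℚ.* (t ℚ.+ ι (+ c n) ℚ.* B n) ∎
  where
  open ≡-Reasoning
  s = ∑ n (λ i → + c i ℤ.* S i N)
  t = ∑ℚ n (λ i → ι (+ c i) ℚ.* B i)
  regroup : ∀ s m t c S b → (s ℚ.+ m ℚ.* t) ℚ.+ c ℚ.* (S ℚ.+ m ℚ.* b) ≡ (s ℚ.+ c ℚ.* S) ℚ.+ m ℚ.* (t ℚ.+ c ℚ.* b)
  regroup = RingSolver.solve-∀ ℚ-ring

-- By the two recurrences the errors weighted with C(k+2, i) add up to N^(k+2). So the last error,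
-- times k + 2, is a combination of N^(k+2) and the earlier errors.
powerSumError-quadratic : ∀ k → Quadratic (powerSumError k)
powerSumError-quadratic = <-rec _ step
  where
  step : ∀ k → (∀ {j} → j < k → Quadratic (powerSumError j)) → Quadratic (powerSumError k)
  step zero    _  = quadratic-cong zero-error quadratic-0
    where
    zero-error : ∀ N → 0ℚ ≡ powerSumError 0 N
    zero-error N = sym (begin
      ι (S 0 N) ℚ.+ ι (ℤ.- (+ N)) ℚ.* 1ℚ ≡⟨ cong₂ ℚ._+_ (cong ι (trans (∑-const N 1ℤ) (ℤₚ.*-identityʳ (+ N)))) (ℚₚ.*-identityʳ _) ⟩
      ι (+ N) ℚ.+ ι (ℤ.- (+ N))           ≡⟨ ι-+ (+ N) (ℤ.- (+ N)) ⟨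
      ι (+ N ℤ.+ ℤ.- (+ N))               ≡⟨ cong ι (ℤₚ.+-inverseʳ (+ N)) ⟩
      0ℚ ∎)
      where open ≡-Reasoning
  step (suc k) ih = quadratic-cancel (suc k) (quadratic-cong solve-top
    (quadratic-+ (quadratic-power k)
      (quadratic-* -1ℤ (quadratic-∑ (suc k) (λ i i≤k → quadratic-* (+ c i) (ih i≤k))))))
    where
    open ≡-Reasoning
    c : ℕ → ℕ
    c i = suc (suc k) C i
    lower : ℕ → ℚ
    lower N = ∑ℚ (suc k) (λ i → ι (+ c i) ℚ.* powerSumError i N)
    total : ∀ N → lower N ℚ.+ ι (+ suc (suc k)) ℚ.* powerSumError (suc k) N ≡ ι ((+ N) ℤ.^ suc (suc k))
    total N = begin
      lower N ℚ.+ ι (+ suc (suc k)) ℚ.* powerSumError (suc k) N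
        ≡⟨ cong (λ x → lower N ℚ.+ ι (+ x) ℚ.* powerSumError (suc k) N) (nC[n-1]≡n (suc k)) ⟨
      ∑ℚ (suc (suc k)) (λ i → ι (+ c i) ℚ.* powerSumError i N)
        ≡⟨ ∑-powerSumError c (suc (suc k)) N ⟩
      ι (∑ (suc (suc k)) (λ i → + c i ℤ.* S i N)) ℚ.+ ι (ℤ.- (+ N)) ℚ.* ∑ℚ (suc (suc k)) (λ i → ι (+ c i) ℚ.* B i)
        ≡⟨ cong₂ (λ x y → ι x ℚ.+ ι (ℤ.- (+ N)) ℚ.* y) (power-sum-recurrence (suc k) N) (bernoulli-recurrence k) ⟩
      ι ((+ N) ℤ.^ suc (suc k)) ℚ.+ ι (ℤ.- (+ N)) ℚ.* 0ℚ
        ≡⟨ cong (λ x → ι ((+ N) ℤ.^ suc (suc k)) ℚ.+ x) (ℚₚ.*-zeroʳ (ι (ℤ.- (+ N)))) ⟩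
      ι ((+ N) ℤ.^ suc (suc k)) ℚ.+ 0ℚ
        ≡⟨ ℚₚ.+-identityʳ _ ⟩
      ι ((+ N) ℤ.^ suc (suc k)) ∎
    solve-top : ∀ N → ι ((+ N) ℤ.^ suc (suc k)) ℚ.+ ι -1ℤ ℚ.* lower N ≡ ι (+ suc (suc k)) ℚ.* powerSumError (suc k) N
    solve-top N = begin
      ι ((+ N) ℤ.^ suc (suc k)) ℚ.+ ι -1ℤ ℚ.* lower N ≡⟨ cong (λ x → x ℚ.+ ι -1ℤ ℚ.* lower N) (total N) ⟨
      (lower N ℚ.+ e) ℚ.+ ι -1ℤ ℚ.* lower N           ≡⟨ cong (λ x → (lower N ℚ.+ e) ℚ.+ x) (negate (lower N)) ⟩
      (lower N ℚ.+ e) ℚ.+ (ℚ.- lower N)                ≡⟨ cancel (lower N) e ⟩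
      e ∎
      where
      e = ι (+ suc (suc k)) ℚ.* powerSumError (suc k) N
      negate : ∀ x → ι -1ℤ ℚ.* x ≡ ℚ.- x
      negate x = trans (sym (ℚₚ.neg-distribˡ-* 1ℚ x)) (cong ℚ.-_ (ℚₚ.*-identityˡ x))
      cancel : ∀ x e → (x ℚ.+ e) ℚ.+ (ℚ.- x) ≡ e
      cancel = RingSolver.solve-∀ ℚ-ring

V : ℕ → ℕ
V k = ℚ.↧ₙ (B k)

-- The factor d + 1 clears the denominators of the remainder polynomial. It may be divisible by p;
-- later uses compensate for this by taking N divisible by a higher power of p.
power-sum-bernoulli : ∀ k → ∃ λ d → ∀ N → (+ suc d ℤ.* + V k) ℤ.* S k N ≅ (+ suc d ℤ.* U k) ℤ.* + N [ + N ℤ.* + N ]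
power-sum-bernoulli k with powerSumError-quadratic k
... | d , h = d , λ N → congruent (dividesℤ (+ V k ℤ.* proj₁ (h N)) (ι-injective (begin
  ι ((D ℤ.* + V k) ℤ.* S k N ℤ.- (D ℤ.* U k) ℤ.* + N)
    ≡⟨ cong ι (integers D (+ V k) (S k N) (U k) (+ N)) ⟩
  ι (D ℤ.* (+ V k ℤ.* S k N) ℤ.+ D ℤ.* (ℤ.- (+ N) ℤ.* U k))
    ≡⟨ trans (ι-+ (D ℤ.* (+ V k ℤ.* S k N)) (D ℤ.* (ℤ.- (+ N) ℤ.* U k))) (cong₂ ℚ._+_
         (trans (ι-* D (+ V k ℤ.* S k N)) (cong (λ x → ι D ℚ.* x) (ι-* (+ V k) (S k N))))
         (trans (ι-* D (ℤ.- (+ N) ℤ.* U k)) (cong (λ x → ι D ℚ.* x) (ι-* (ℤ.- (+ N)) (U k))))) ⟩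
  ι D ℚ.* (ι (+ V k) ℚ.* ι (S k N)) ℚ.+ ι D ℚ.* (ι (ℤ.- (+ N)) ℚ.* ι (U k))
    ≡⟨ cong (λ x → ι D ℚ.* (ι (+ V k) ℚ.* ι (S k N)) ℚ.+ ι D ℚ.* (ι (ℤ.- (+ N)) ℚ.* x)) (denominator-* (B k)) ⟨
  ι D ℚ.* (ι (+ V k) ℚ.* ι (S k N)) ℚ.+ ι D ℚ.* (ι (ℤ.- (+ N)) ℚ.* (ι (+ V k) ℚ.* B k))
    ≡⟨ rationals (ι D) (ι (+ V k)) (ι (S k N)) (ι (ℤ.- (+ N))) (B k) ⟩
  ι (+ V k) ℚ.* (ι D ℚ.* powerSumError k N)
    ≡⟨ cong (λ x → ι (+ V k) ℚ.* x) (proj₂ (h N)) ⟩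
  ι (+ V k) ℚ.* ι ((+ N ℤ.* + N) ℤ.* proj₁ (h N))
    ≡⟨ ι-* (+ V k) ((+ N ℤ.* + N) ℤ.* proj₁ (h N)) ⟨
  ι (+ V k ℤ.* ((+ N ℤ.* + N) ℤ.* proj₁ (h N)))
    ≡⟨ cong ι (assoc (+ V k) (+ N ℤ.* + N) (proj₁ (h N))) ⟩
  ι ((+ V k ℤ.* proj₁ (h N)) ℤ.* (+ N ℤ.* + N)) ∎)))
  where
  open ≡-Reasoning
  D = + suc d
  integers : ∀ D v s u n → (D ℤ.* v) ℤ.* s ℤ.- (D ℤ.* u) ℤ.* n ≡ D ℤ.* (v ℤ.* s) ℤ.+ D ℤ.* (ℤ.- n ℤ.* u)
  integers = ring-ℤ
  rationals : ∀ D v s n b → D ℚ.* (v ℚ.* s) ℚ.+ D ℚ.* (n ℚ.* (v ℚ.* b)) ≡ v ℚ.* (D ℚ.* (s ℚ.+ n ℚ.* b))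
  rationals = RingSolver.solve-∀ ℚ-ring
  assoc : ∀ v n z → v ℤ.* (n ℤ.* z) ≡ (v ℤ.* z) ℤ.* n
  assoc = ring-ℤ

-- Valuations

prime-cases : ∀ {p} → Prime p → ∃ λ q → p ≡ suc (suc q)
prime-cases {zero}        pr = ⊥-elim (Primality.¬prime[0] pr)
prime-cases {suc zero}    pr = ⊥-elim (Primality.¬prime[1] pr)
prime-cases {suc (suc q)} pr = q , refl

1<p : ∀ {p} → Prime p → 1 < p
1<p pr with prime-cases pr
... | q , refl = s≤s (s≤s z≤n)

∤-positive : ∀ {p i} → 0 < i → i < p → p ∤ i
∤-positive {i = suc i} _ i<p p∣i = ℕₚ.<⇒≱ i<p (ℕ∣.∣⇒≤ p∣i)

prime-power-cancel : ∀ {p} → Prime p → ∀ {c} → p ∤ c → ∀ e {z} → p ^ e ∣ c * z → p ^ e ∣ z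
prime-power-cancel pr p∤c zero    h = ℕ∣.1∣ _
prime-power-cancel {p} pr {c} p∤c (suc e) {z} h with Primality.euclidsLemma c z pr (ℕ∣.∣-trans (ℕ∣.m∣m*n (p ^ e)) h)
... | inj₁ p∣c = contradiction p∣c p∤c
... | inj₂ (divides z′ refl) = subst (p * p ^ e ∣_) (ℕₚ.*-comm p z′)
  (ℕ∣.*-monoʳ-∣ p (prime-power-cancel pr p∤c e (ℕ∣.*-cancelˡ-∣ p {{Primality.prime⇒nonZero pr}} (subst (p * p ^ e ∣_) (lemma c z′ p) h))))
  where
  lemma : ∀ c z p → c * (z * p) ≡ p * (c * z)
  lemma = ring-ℕ

prime-power-cancelℤ : ∀ {p} → Prime p → ∀ c → p ∤ ℤ.∣ c ∣ → ∀ e {z} → + (p ^ e) ∣ℤ c ℤ.* z → + (p ^ e) ∣ℤ z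
prime-power-cancelℤ {p} pr c p∤c e {z} h =
  ℤ∣.∣ᵤ⇒∣ (prime-power-cancel pr p∤c e (subst (p ^ e ∣_) (ℤₚ.abs-* c z) (ℤ∣.∣⇒∣ᵤ h)))

prime-cancelℤ : ∀ {p} → Prime p → ∀ c → p ∤ ℤ.∣ c ∣ → ∀ {z} → + p ∣ℤ c ℤ.* z → + p ∣ℤ z
prime-cancelℤ {p} pr c p∤c {z} h = subst (λ x → + x ∣ℤ z) (ℕₚ.*-identityʳ p)
  (prime-power-cancelℤ pr c p∤c 1 (subst (λ x → + x ∣ℤ c ℤ.* z) (sym (ℕₚ.*-identityʳ p)) h))

prime-∤-* : ∀ {p} → Prime p → ∀ {a b} → p ∤ a → p ∤ b → p ∤ a * b
prime-∤-* pr {a} {b} p∤a p∤b h with Primality.euclidsLemma a b pr h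
... | inj₁ x = p∤a x
... | inj₂ y = p∤b y

prime-∤-^ : ∀ {p} → Prime p → ∀ {a} → p ∤ a → ∀ k → p ∤ a ^ k
prime-∤-^ pr p∤a zero    h = ℕₚ.<⇒≢ (1<p pr) (sym (ℕ∣.∣1⇒≡1 h))
prime-∤-^ pr p∤a (suc k) h = prime-∤-* pr p∤a (prime-∤-^ pr p∤a k) h

m≤n⇒p^m∣p^n : ∀ p {m n} → m ≤ n → p ^ m ∣ p ^ n
m≤n⇒p^m∣p^n p {m} {n} m≤n = subst (p ^ m ∣_) (trans (sym (ℕₚ.^-distribˡ-+-* p m (n ∸ m))) (cong (p ^_) (ℕₚ.m+[n∸m]≡n m≤n))) (ℕ∣.m∣m*n (p ^ (n ∸ m)))

p^ord∣ : ∀ f p n → p ^ ordF f p n ∣ n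
p^ord∣ zero    p             n    = ℕ∣.1∣ n
p^ord∣ (suc f) zero          n    = ℕ∣.1∣ n
p^ord∣ (suc f) (suc zero)    n    = ℕ∣.1∣ n
p^ord∣ (suc f) (suc (suc q)) zero = ℕ∣.1∣ 0
p^ord∣ (suc f) (suc (suc q)) (suc n) with suc (suc q) ∣? suc n
... | no  _   = ℕ∣.1∣ (suc n)
... | yes p∣n = subst (suc (suc q) ^ suc (ordF f (suc (suc q)) (suc n ℕ./ suc (suc q))) ∣_)
  (trans (ℕₚ.*-comm (suc (suc q)) (suc n ℕ./ suc (suc q))) (ℕ/.m/n*n≡m p∣n))
  (ℕ∣.*-monoʳ-∣ (suc (suc q)) (p^ord∣ f (suc (suc q)) (suc n ℕ./ suc (suc q))))

-- The fuel never runs out: each division by `suc (suc q)` strictly lowers the argument, so the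
-- bound on f passes to the quotient.
p^e∣⇒e≤ord : ∀ f q n e → suc n ≤ f → suc (suc q) ^ e ∣ suc n → e ≤ ordF f (suc (suc q)) (suc n)
p^e∣⇒e≤ord f       q n zero    _         _ = z≤n
p^e∣⇒e≤ord (suc f) q n (suc e) (s≤s n≤f) h with suc (suc q) ∣? suc n
... | no  p∤n = contradiction (ℕ∣.∣-trans (ℕ∣.m∣m*n (suc (suc q) ^ e)) h) p∤n
... | yes p∣n with suc n ℕ./ suc (suc q) in eq
...   | zero  = contradiction (trans (sym (ℕ/.m/n*n≡m p∣n)) (cong (_* suc (suc q)) eq)) (λ ())
...   | suc m = s≤s (p^e∣⇒e≤ord f q m e (ℕₚ.≤-trans m<n n≤f) smaller)
  where
  m<n : suc m ≤ n
  m<n = ℕₚ.≤-pred (subst (_< suc n) eq (ℕ/.m/n<m (suc n) (suc (suc q)) (s≤s (s≤s z≤n))))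
  smaller : suc (suc q) ^ e ∣ suc m
  smaller = ℕ∣.*-cancelˡ-∣ (suc (suc q)) (subst (suc (suc q) ^ suc e ∣_)
    (trans (sym (ℕ/.m/n*n≡m p∣n)) (trans (cong (_* suc (suc q)) eq) (ℕₚ.*-comm (suc m) (suc (suc q))))) h)

ord-maximal : ∀ {p} → Prime p → ∀ {n} e → 0 < n → p ^ e ∣ n → e ≤ ordℕ p n
ord-maximal pr {suc n} e _ h with prime-cases pr
... | q , refl = p^e∣⇒e≤ord (suc n) q n e ℕₚ.≤-refl h

p-part : ∀ {p} → Prime p → ∀ n → 0 < n → ∃ λ n′ → n ≡ p ^ ordℕ p n * n′ × p ∤ n′
p-part {p} pr n n>0 with p^ord∣ n p n
... | divides n′ eq = n′ , eq′ , λ p∣n′ → ℕₚ.<-irrefl refl (ord-maximal pr (suc (ordℕ p n)) n>0 (maximal p∣n′))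
  where
  eq′ : n ≡ p ^ ordℕ p n * n′
  eq′ = trans eq (ℕₚ.*-comm n′ _)
  maximal : p ∣ n′ → p * p ^ ordℕ p n ∣ n
  maximal p∣n′ = subst (p * p ^ ordℕ p n ∣_) (sym eq) (ℕ∣.*-monoˡ-∣ (p ^ ordℕ p n) p∣n′)

c+e≤[1+c]^e : ∀ c e → 0 < c → 0 < e → c + e ≤ suc c ^ e
c+e≤[1+c]^e c (suc zero)    c>0 _ = ℕₚ.≤-reflexive (trans (ℕₚ.+-comm c 1) (sym (ℕₚ.*-identityʳ (suc c))))
c+e≤[1+c]^e c (suc (suc e)) c>0 _ = begin
  c + suc (suc e)          ≡⟨ ℕₚ.+-suc c (suc e) ⟩
  suc (c + suc e)          ≤⟨ ℕₚ.+-mono-≤ (ℕₚ.m^n>0 (suc c) (suc e)) (c+e≤[1+c]^e c (suc e) c>0 (s≤s z≤n)) ⟩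
  suc c ^ suc e + suc c ^ suc e      ≤⟨ ℕₚ.+-monoʳ-≤ (suc c ^ suc e) (ℕₚ.m≤n*m (suc c ^ suc e) c {{ℕ.>-nonZero c>0}}) ⟩
  suc c ^ suc (suc e)      ∎
  where
  open ℕₚ.≤-Reasoning

-- For e ≥ 1, i ≥ p^e ≥ (c+1)^e ≥ c + e. This slack pays for ord_p i when i C(k,i) = k C(k-1,i-1) is
-- divided by i.
power-divisor-bound : ∀ {p c i} e → 0 < c → c < p → c ≤ i → p ^ e ∣ i → c + e ≤ i
power-divisor-bound {c = c} zero    c>0 c<p c≤i h = ℕₚ.≤-trans (ℕₚ.≤-reflexive (ℕₚ.+-identityʳ c)) c≤i
power-divisor-bound {p} {c} {i} (suc e) c>0 c<p c≤i h = ℕₚ.≤-trans (c+e≤[1+c]^e c (suc e) c>0 (s≤s z≤n))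
  (ℕₚ.≤-trans (ℕₚ.^-monoˡ-≤ (suc e) c<p) (ℕ∣.∣⇒≤ {{ℕ.>-nonZero (ℕₚ.<-≤-trans c>0 c≤i)}} h))

-- Uses i C(k,i) = k C(k-1,i-1): the p-part p^e of i that may be missing from C(k,i) is made up for by y^i.
binomial-power-∣ : ∀ {p} → Prime p → ∀ {c i k o v} {y : ℤ} → suc c < p → suc c ≤ i → 0 < v →
  + (p ^ v) ∣ℤ y → p ^ o ∣ k → + (p ^ (c * v + 1 + o)) ∣ℤ + (k C i) ℤ.* y ℤ.^ i
binomial-power-∣ {p} pr {c} {suc i} {zero} {o} {v} {y} _ _ _ _ _ = subst (λ b → + (p ^ (c * v + 1 + o)) ∣ℤ + b ℤ.* y ℤ.^ suc i)
  (sym (k>n⇒nCk≡0 {0} {suc i} (s≤s z≤n))) (dividesℤ 0ℤ refl)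
binomial-power-∣ {p} pr {c} {suc i} {suc k} {o} {v} {y} c<p c≤i v>0 (dividesℤ w y≡) p^o∣k
  with p-part pr (suc i) (s≤s z≤n)
... | i′ , i≡ , p∤i′ = subst (+ (p ^ (c * v + 1 + o)) ∣ℤ_) factor (ℤ∣.∣m⇒∣m*n (w ℤ.^ suc i) (∣-pos natural))
  where
  e = ordℕ p (suc i)
  b = suc k C suc i
  rearrange : ∀ i′ a b → i′ * (a * b) ≡ (a * i′) * b
  rearrange = ring-ℕ
  p^o∣ : p ^ o ∣ p ^ e * b
  p^o∣ = prime-power-cancel pr p∤i′ o (subst (p ^ o ∣_)
    (trans (sym (C-absorption k i)) (trans (cong (_* b) i≡) (sym (rearrange i′ (p ^ e) b)))) (ℕ∣.∣m⇒∣m*n (k C i) p^o∣k))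
  -- Of the v (i+1) factors p in the power of y, c v + 1 go into the claim and e repay the p-part of
  -- i + 1.
  exponent : c * v + 1 + e ≤ v * suc i
  exponent = begin
    c * v + 1 + e           ≤⟨ ℕₚ.+-mono-≤ (ℕₚ.+-monoʳ-≤ (c * v) v>0) (ℕₚ.m≤m*n e v {{ℕ.>-nonZero v>0}}) ⟩
    c * v + v + e * v       ≡⟨ collect c v e ⟩
    v * (suc c + e)         ≤⟨ ℕₚ.*-monoʳ-≤ v (power-divisor-bound e (s≤s z≤n) c<p c≤i (p^ord∣ (suc i) p (suc i))) ⟩
    v * suc i               ∎
    where
    open ℕₚ.≤-Reasoning
    collect : ∀ c v e → c * v + v + e * v ≡ v * (suc c + e)
    collect = ring-ℕ
  natural : p ^ (c * v + 1 + o) ∣ b * p ^ (v * suc i)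
  natural = subst₂ _∣_ (sym (ℕₚ.^-distribˡ-+-* p (c * v + 1) o)) (ℕₚ.*-comm (p ^ (v * suc i)) b)
    (ℕ∣.∣-trans (ℕ∣.*-monoʳ-∣ (p ^ (c * v + 1)) p^o∣)
      (subst (_∣ p ^ (v * suc i) * b) (trans (cong (_* b) (ℕₚ.^-distribˡ-+-* p (c * v + 1) e)) (ℕₚ.*-assoc (p ^ (c * v + 1)) (p ^ e) b))
        (ℕ∣.*-monoˡ-∣ b (m≤n⇒p^m∣p^n p exponent))))
  shuffle : ∀ b a w → (b ℤ.* a) ℤ.* w ≡ b ℤ.* (w ℤ.* a)
  shuffle = ring-ℤ
  factor : + (b * p ^ (v * suc i)) ℤ.* w ℤ.^ suc i ≡ + b ℤ.* y ℤ.^ suc i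
  factor = begin
    + (b * p ^ (v * suc i)) ℤ.* w ℤ.^ suc i                   ≡⟨ cong (λ x → x ℤ.* w ℤ.^ suc i) (ℤₚ.pos-* b (p ^ (v * suc i))) ⟩
    (+ b ℤ.* + (p ^ (v * suc i))) ℤ.* w ℤ.^ suc i             ≡⟨ shuffle (+ b) (+ (p ^ (v * suc i))) (w ℤ.^ suc i) ⟩
    + b ℤ.* (w ℤ.^ suc i ℤ.* + (p ^ (v * suc i)))             ≡⟨ cong (λ x → + b ℤ.* (w ℤ.^ suc i ℤ.* + x)) (ℕₚ.^-*-assoc p v (suc i)) ⟨
    + b ℤ.* (w ℤ.^ suc i ℤ.* + ((p ^ v) ^ suc i))             ≡⟨ cong (λ x → + b ℤ.* (w ℤ.^ suc i ℤ.* x)) (pos-^ (p ^ v) (suc i)) ⟩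
    + b ℤ.* (w ℤ.^ suc i ℤ.* (+ (p ^ v)) ℤ.^ suc i)           ≡⟨ cong (λ x → + b ℤ.* x) (^-distribʳ-* w (+ (p ^ v)) (suc i)) ⟨
    + b ℤ.* (w ℤ.* + (p ^ v)) ℤ.^ suc i                       ≡⟨ cong (λ x → + b ℤ.* x ℤ.^ suc i) y≡ ⟨
    + b ℤ.* y ℤ.^ suc i                                       ∎
    where open ≡-Reasoning

-- Power sums modulo prime powers

prime-∣-C : ∀ {p} → Prime p → ∀ i → suc i < p → p ∣ p C suc i
prime-∣-C {suc q} pr i i<p with Primality.euclidsLemma (suc i) (suc q C suc i) pr
  (subst (suc q ∣_) (sym (C-absorption q i)) (ℕ∣.m∣m*n (q C i)))
... | inj₁ h = contradiction h (∤-positive (s≤s z≤n) i<p)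
... | inj₂ h = h

freshman : ∀ {p} → Prime p → ∀ y → (1ℤ ℤ.+ y) ℤ.^ p ≅ 1ℤ ℤ.+ y ℤ.^ p [ + p ]
freshman {suc q} pr y = ≅-trans (≅-reflexive (trans (binomial-theorem 1ℤ y p) (cong (λ s → s ℤ.+ t p) (∑-first q t))))
  (≅-+ (≅-trans (≅-+-multiple (t 0) middle) (≅-reflexive first)) (≅-reflexive final))
  where
  p = suc q
  t = binomialTerm 1ℤ y p
  first : t 0 ≡ 1ℤ
  first = trans (ℤₚ.*-identityˡ (1ℤ ℤ.^ p ℤ.* 1ℤ)) (trans (ℤₚ.*-identityʳ (1ℤ ℤ.^ p)) (ℤₚ.^-zeroˡ p))
  final : t p ≡ y ℤ.^ p
  final = trans (cong₂ (λ c e → + c ℤ.* (1ℤ ℤ.^ e ℤ.* y ℤ.^ p)) (nCn≡1 p) (ℕₚ.n∸n≡0 p))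
    (trans (ℤₚ.*-identityˡ (1ℤ ℤ.* y ℤ.^ p)) (ℤₚ.*-identityˡ (y ℤ.^ p)))
  middle : + p ∣ℤ ∑ q (t ∘ suc)
  middle = ∑-∣ q (λ i i<q → ℤ∣.∣m⇒∣m*n (1ℤ ℤ.^ (p ∸ suc i) ℤ.* y ℤ.^ suc i) (∣-pos (prime-∣-C pr i (s≤s i<q))))

fermat : ∀ {p} → Prime p → ∀ a → (+ a) ℤ.^ p ≅ + a [ + p ]
fermat {suc q} pr zero    = ≅-refl
fermat {p}     pr (suc a) = ≅-trans (freshman pr (+ a)) (≅-+ (≅-refl {1ℤ}) (fermat pr a))

-- Based on a^p ≡ a and positive exponents, so that it also covers a divisible by p and can be
-- applied termwise to sums over all residues.
fermat-periodic : ∀ {q} → Prime (suc q) → ∀ a r c → (+ a) ℤ.^ (suc r + c * q) ≅ (+ a) ℤ.^ suc r [ + suc q ]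
fermat-periodic {q} pr a r zero    = ≅-reflexive (cong ((+ a) ℤ.^_) (ℕₚ.+-identityʳ (suc r)))
fermat-periodic {q} pr a r (suc c) = ≅-trans (≅-reflexive (begin
  (+ a) ℤ.^ (suc r + (q + c * q))        ≡⟨ cong ((+ a) ℤ.^_) (exponent r q (c * q)) ⟩
  (+ a) ℤ.^ (r + c * q + suc q)          ≡⟨ ℤₚ.^-distribˡ-+-* (+ a) (r + c * q) (suc q) ⟩
  (+ a) ℤ.^ (r + c * q) ℤ.* (+ a) ℤ.^ suc q ∎))
  (≅-trans (≅-*ˡ ((+ a) ℤ.^ (r + c * q)) (fermat pr a))
    (≅-trans (≅-reflexive (ℤₚ.*-comm ((+ a) ℤ.^ (r + c * q)) (+ a))) (fermat-periodic pr a r c)))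
  where
  open ≡-Reasoning
  exponent : ∀ r q x → suc r + (q + x) ≡ r + x + suc q
  exponent = ring-ℕ

fermat-unit : ∀ {q} → Prime (suc q) → ∀ a → suc q ∤ a → (+ a) ℤ.^ q ≅ 1ℤ [ + suc q ]
fermat-unit {q} pr a p∤a = congruent (prime-cancelℤ pr (+ a) p∤a
  (subst (+ suc q ∣ℤ_) (lemma (+ a) ((+ a) ℤ.^ q)) (_≅_[_].difference (fermat pr a))))
  where
  lemma : ∀ a b → a ℤ.* b ℤ.- a ≡ a ℤ.* (b ℤ.- 1ℤ)
  lemma = ring-ℤ

S-periodic : ∀ {q} → Prime (suc q) → ∀ r c N → S (suc r + c * q) N ≅ S (suc r) N [ + suc q ]
S-periodic pr r c N = ≅-∑ N (λ a _ → fermat-periodic pr a r c)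

-- The recurrence expresses (i+1) S_i(p) through p^(i+1) and multiples of lower power sums, all
-- divisible by p, and i + 1 < p can be cancelled.
p∣S-small : ∀ {p} → Prime p → ∀ i → suc i < p → + p ∣ℤ S i p
p∣S-small {p} pr = <-rec _ step
  where
  step : ∀ i → (∀ {j} → j < i → suc j < p → + p ∣ℤ S j p) → suc i < p → + p ∣ℤ S i p
  step i ih i<p = prime-cancelℤ pr (+ (suc i C i))
    (subst (p ∤_) (sym (nC[n-1]≡n i)) (∤-positive (s≤s z≤n) i<p))
    (ℤ∣.∣m+n∣m⇒∣n (subst (+ p ∣ℤ_) (sym (power-sum-recurrence i p)) (ℤ∣.∣m⇒∣m*n ((+ p) ℤ.^ i) ℤ∣.∣-refl))
      (∑-∣ i (λ j j<i → ℤ∣.∣n⇒∣m*n (+ (suc i C j)) (ih j<i (ℕₚ.<-trans (s≤s j<i) i<p)))))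

p∣S : ∀ {q} → Prime (suc q) → ∀ r c → suc r < q → + suc q ∣ℤ S (suc r + c * q) (suc q)
p∣S {q} pr r c r<q = ≅-∣-resp (S-periodic pr r c (suc q)) (p∣S-small pr (suc r) (s≤s r<q))

ones-sum : ∀ {q r} → 0 < r → (∀ i → suc i < suc q → (+ suc i) ℤ.^ r ≅ 1ℤ [ + suc q ]) → S r (suc q) ≅ + suc q ℤ.- 1ℤ [ + suc q ]
ones-sum {q} {suc r} _ h = ≅-trans (≅-reflexive (∑-first q (λ j → (+ j) ℤ.^ suc r)))
  (≅-trans (≅-+ (≅-refl {0ℤ}) (≅-∑ q {g = λ _ → 1ℤ} (λ i i<q → h i (s≤s i<q))))
    (≅-reflexive (trans (ℤₚ.+-identityˡ (∑ q (λ _ → 1ℤ))) (trans (∑-const q 1ℤ) (lemma (+ q))))))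
  where
  lemma : ∀ q → q ℤ.* 1ℤ ≡ (1ℤ ℤ.+ q) ℤ.- 1ℤ
  lemma = ring-ℤ

p∤ones-sum : ∀ {p} → Prime p → ∀ {s} → s ≅ + p ℤ.- 1ℤ [ + p ] → ¬ (+ p ∣ℤ s)
p∤ones-sum {p} pr {s} h p∣s = ℕₚ.<⇒≢ (1<p pr) (sym (ℕ∣.∣1⇒≡1 (ℤ∣.∣⇒∣ᵤ {+ p} { -1ℤ} p∣-1)))
  where
  lemma : ∀ p → p ℤ.- 1ℤ ≡ p ℤ.+ -1ℤ
  lemma = ring-ℤ
  p∣-1 : + p ∣ℤ -1ℤ
  p∣-1 = ℤ∣.∣m+n∣m⇒∣n {+ p} {+ p} (≅-∣-resp (≅-trans (≅-reflexive (sym (lemma (+ p)))) (≅-sym h)) p∣s) ℤ∣.∣-refl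

p∤S : ∀ {q} → Prime (suc q) → 0 < q → ∀ c → ¬ (+ suc q ∣ℤ S (suc c * q) (suc q))
p∤S {suc q} pr _ c = p∤ones-sum pr (≅-trans (S-periodic pr q c (suc (suc q)))
  (ones-sum {r = suc q} (s≤s z≤n) (λ i i<p → fermat-unit pr (suc i) (∤-positive (s≤s z≤n) i<p))))

-- If all nonzero residues satisfied x^r ≡ 1, `ones-sum` would give S_r(p) ≡ -1, against
-- `p∣S-small`. The resulting g plays the part of a primitive root in Kummer's congruence.
non-root : ∀ {q} → Prime (suc q) → ∀ r → 0 < r → r < q → ∃ λ g → suc q ∤ g × ¬ (+ suc q ∣ℤ (+ g) ℤ.^ r ℤ.- 1ℤ)
non-root {q} pr r r>0 r<q with ℕₚ.anyUpTo? (λ i → ¬? (+ suc q ℤ∣.∣? (+ suc i) ℤ.^ r ℤ.- 1ℤ)) q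
... | yes (i , i<q , h) = suc i , ∤-positive (s≤s z≤n) (s≤s i<q) , h
... | no  none = contradiction (p∣S-small pr r (s≤s r<q)) (p∤ones-sum pr (ones-sum {r = r} r>0 root))
  where
  root : ∀ i → suc i < suc q → (+ suc i) ℤ.^ r ≅ 1ℤ [ + suc q ]
  root i (s≤s i<q) with + suc q ℤ∣.∣? (+ suc i) ℤ.^ r ℤ.- 1ℤ
  ... | yes h = congruent h
  ... | no ¬h = contradiction (i , i<q , ¬h) none

-- Power sums over several blocks

taylor₁ : ∀ k x y → (x ℤ.+ y) ℤ.^ suc k ≅ x ℤ.^ suc k ℤ.+ (+ suc k ℤ.* y) ℤ.* x ℤ.^ k [ y ℤ.* y ]
taylor₁ zero    x y = ≅-reflexive (lemma x y)
  where
  lemma : ∀ x y → (x ℤ.+ y) ℤ.* 1ℤ ≡ x ℤ.* 1ℤ ℤ.+ (1ℤ ℤ.* y) ℤ.* 1ℤ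
  lemma = ring-ℤ
taylor₁ (suc k) x y = ≅-trans (≅-*ˡ (x ℤ.+ y) (taylor₁ k x y))
  (≅-trans (≅-reflexive (expand x y (x ℤ.^ k) (+ suc k)))
    (≅-+-multiple (x ℤ.* (x ℤ.* x ℤ.^ k) ℤ.+ ((1ℤ ℤ.+ + suc k) ℤ.* y) ℤ.* (x ℤ.* x ℤ.^ k))
      (ℤ∣.∣n⇒∣m*n (+ suc k ℤ.* x ℤ.^ k) ℤ∣.∣-refl)))
  where
  expand : ∀ x y u n → (x ℤ.+ y) ℤ.* (x ℤ.* u ℤ.+ (n ℤ.* y) ℤ.* u)
    ≡ (x ℤ.* (x ℤ.* u) ℤ.+ ((1ℤ ℤ.+ n) ℤ.* y) ℤ.* (x ℤ.* u)) ℤ.+ (n ℤ.* u) ℤ.* (y ℤ.* y)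
  expand = ring-ℤ

S-suc-block : ∀ k M N → S k (suc M * N) ≡ S k (M * N) ℤ.+ ∑ N (λ j → (+ j ℤ.+ + (M * N)) ℤ.^ k)
S-suc-block k M N = trans (cong (S k) (ℕₚ.+-comm N (M * N))) (trans (∑-split (M * N) N (λ j → (+ j) ℤ.^ k))
  (cong (λ x → S k (M * N) ℤ.+ x) (∑-cong N (λ j _ → cong (ℤ._^ k) (trans (ℤₚ.pos-+ (M * N) j) (ℤₚ.+-comm (+ (M * N)) (+ j)))))))

S-blocks : ∀ k M N → S k (M * N) ≅ + M ℤ.* S k N [ + N ]
S-blocks k zero    N = ≅-refl
S-blocks k (suc M) N = ≅-trans (≅-reflexive (S-suc-block k M N))
  (≅-trans (≅-+ (S-blocks k M N) (≅-∑ N (λ j _ → ≅-^ k (≅-+-multiple (+ j) (∣-pos (ℕ∣.n∣m*n M))))))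
    (≅-reflexive (lemma (+ M) (S k N))))
  where
  lemma : ∀ m s → m ℤ.* s ℤ.+ s ≡ (1ℤ ℤ.+ m) ℤ.* s
  lemma = ring-ℤ

-- Each block is expanded to first order in its shift; the shifts i N with i < M add up to N S_1(M).
S-blocks₁ : ∀ k M N → S (suc k) (M * N) ≅ + M ℤ.* S (suc k) N ℤ.+ (+ suc k ℤ.* + N) ℤ.* (S k N ℤ.* S 1 M) [ + N ℤ.* + N ]
S-blocks₁ k zero    N = ≅-reflexive (sym (lemma (S (suc k) N) (+ suc k ℤ.* + N) (S k N)))
  where
  lemma : ∀ a b c → 0ℤ ℤ.* a ℤ.+ b ℤ.* (c ℤ.* 0ℤ) ≡ 0ℤ
  lemma = ring-ℤ
S-blocks₁ k (suc M) N = ≅-trans (≅-reflexive (S-suc-block (suc k) M N))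
  (≅-trans (≅-+ (S-blocks₁ k M N) block)
    (≅-reflexive (trans (cong (λ x → rest ℤ.+ (S (suc k) N ℤ.+ (+ suc k ℤ.* x) ℤ.* S k N)) (ℤₚ.pos-* M N))
      (lemma (+ M) (S (suc k) N) (+ suc k) (+ N) (S k N) (S 1 M)))))
  where
  rest = + M ℤ.* S (suc k) N ℤ.+ (+ suc k ℤ.* + N) ℤ.* (S k N ℤ.* S 1 M)
  square : + N ℤ.* + N ∣ℤ + (M * N) ℤ.* + (M * N)
  square = subst (_∣ℤ + (M * N) ℤ.* + (M * N)) (ℤₚ.pos-* N N)
    (subst (+ (N * N) ∣ℤ_) (ℤₚ.pos-* (M * N) (M * N)) (∣-pos (ℕ∣.*-pres-∣ (ℕ∣.n∣m*n M) (ℕ∣.n∣m*n M))))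
  block : ∑ N (λ j → (+ j ℤ.+ + (M * N)) ℤ.^ suc k) ≅ S (suc k) N ℤ.+ (+ suc k ℤ.* + (M * N)) ℤ.* S k N [ + N ℤ.* + N ]
  block = ≅-trans (≅-∑ N (λ j _ → ≅-∣ square (taylor₁ k (+ j) (+ (M * N)))))
    (≅-reflexive (trans (∑-distrib-+ N (λ j → (+ j) ℤ.^ suc k) (λ j → (+ suc k ℤ.* + (M * N)) ℤ.* (+ j) ℤ.^ k))
      (cong (λ x → S (suc k) N ℤ.+ x) (∑-*ˡ N (+ suc k ℤ.* + (M * N)) (λ j → (+ j) ℤ.^ k)))))
  lemma : ∀ m s k n u t → (m ℤ.* s ℤ.+ (k ℤ.* n) ℤ.* (u ℤ.* t)) ℤ.+ (s ℤ.+ (k ℤ.* (m ℤ.* n)) ℤ.* u)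
    ≡ (1ℤ ℤ.+ m) ℤ.* s ℤ.+ (k ℤ.* n) ℤ.* (u ℤ.* (t ℤ.+ m ℤ.* 1ℤ))
  lemma = ring-ℤ

-- Reduction to one period modulo p, by `S-blocks₁` with M = p. Its linear correction contains
-- S_1(p), divisible by p as p > 2, and so vanishes modulo p N. Here q is an arbitrary cofactor.
S-prime-power : ∀ {p} → Prime p → 2 < p → ∀ k q v → S (suc k) (q * p ^ suc v) ≅ + (q * p ^ v) ℤ.* S (suc k) p [ + (p ^ suc v) ]
S-prime-power {p} pr p>2 k q zero = subst₂ (λ x y → S (suc k) (q * x) ≅ + y ℤ.* S (suc k) p [ + x ])
  (sym (ℕₚ.*-identityʳ p)) (sym (ℕₚ.*-identityʳ q)) (S-blocks (suc k) q p)
S-prime-power {p} pr p>2 k q (suc v) = ≅-trans (≅-reflexive (cong (S (suc k)) (swap q p (p ^ suc v))))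
  (≅-trans (≅-∣ square (S-blocks₁ k p N))
    (≅-trans (≅-+-multiple (+ p ℤ.* S (suc k) N) carry)
      (≅-trans multiple (≅-reflexive regroup))))
  where
  N = q * p ^ suc v
  swap : ∀ q p x → q * (p * x) ≡ p * (q * x)
  swap = ring-ℕ
  p∣N : + p ∣ℤ + N
  p∣N = ∣-pos (ℕ∣.∣n⇒∣m*n q (ℕ∣.m∣m*n (p ^ v)))
  pN : + (p ^ suc (suc v)) ∣ℤ + p ℤ.* + N
  pN = subst (+ (p ^ suc (suc v)) ∣ℤ_) (ℤₚ.pos-* p N) (∣-pos (ℕ∣.*-monoʳ-∣ p (ℕ∣.n∣m*n q)))
  square : + (p ^ suc (suc v)) ∣ℤ + N ℤ.* + N
  square = ℤ∣.∣-trans pN (ℤ∣.*-monoˡ-∣ (+ N) p∣N)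
  rearrange : ∀ k n u t → (n ℤ.* k) ℤ.* (u ℤ.* t) ≡ (k ℤ.* u) ℤ.* (t ℤ.* n)
  rearrange = ring-ℤ
  carry : + (p ^ suc (suc v)) ∣ℤ (+ suc k ℤ.* + N) ℤ.* (S k N ℤ.* S 1 p)
  carry = ℤ∣.∣-trans pN (subst (+ p ℤ.* + N ∣ℤ_)
    (sym (trans (cong (ℤ._* (S k N ℤ.* S 1 p)) (ℤₚ.*-comm (+ suc k) (+ N))) (rearrange (+ suc k) (+ N) (S k N) (S 1 p))))
    (ℤ∣.∣n⇒∣m*n (+ suc k ℤ.* S k N) (ℤ∣.*-monoˡ-∣ (+ N) (p∣S-small pr 1 p>2))))
  distrib : ∀ a b c → a ℤ.* (b ℤ.- c) ≡ a ℤ.* b ℤ.- a ℤ.* c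
  distrib = ring-ℤ
  multiple : + p ℤ.* S (suc k) N ≅ + p ℤ.* (+ (q * p ^ v) ℤ.* S (suc k) p) [ + (p ^ suc (suc v)) ]
  multiple with S-prime-power pr p>2 k q v
  ... | congruent d = congruent (subst₂ _∣ℤ_ (sym (ℤₚ.pos-* p (p ^ suc v)))
    (distrib (+ p) (S (suc k) N) (+ (q * p ^ v) ℤ.* S (suc k) p)) (ℤ∣.*-monoʳ-∣ (+ p) d))
  regroup : + p ℤ.* (+ (q * p ^ v) ℤ.* S (suc k) p) ≡ + (q * p ^ suc v) ℤ.* S (suc k) p
  regroup = trans (sym (ℤₚ.*-assoc (+ p) (+ (q * p ^ v)) (S (suc k) p)))
    (cong (ℤ._* S (suc k) p) (trans (sym (ℤₚ.pos-* p (q * p ^ v))) (cong +_ (sym (swap q p (p ^ v))))))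

-- Sums of powers of odd numbers

odd : ℕ → ℤ
odd i = + 2 ℤ.* + i ℤ.+ 1ℤ

pos-odd : ∀ i → + (2 * i + 1) ≡ odd i
pos-odd i = trans (ℤₚ.pos-+ (2 * i) 1) (cong (λ x → x ℤ.+ 1ℤ) (ℤₚ.pos-* 2 i))

T-∑ : ∀ k m → + T k m ≡ ∑ m (λ i → odd i ℤ.^ k)
T-∑ k zero    = refl
T-∑ k (suc m) = trans (ℤₚ.pos-+ (T k m) ((2 * m + 1) ^ k))
  (cong₂ ℤ._+_ (T-∑ k m) (trans (pos-^ (2 * m + 1) k) (cong (ℤ._^ k) (pos-odd m))))

neg-even-power : ∀ {k} → 2 ∣ k → ∀ x → (ℤ.- x) ℤ.^ k ≡ x ℤ.^ k
neg-even-power {k} (divides q refl) x = begin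
  (ℤ.- x) ℤ.^ (q * 2)   ≡⟨ cong ((ℤ.- x) ℤ.^_) (ℕₚ.*-comm q 2) ⟩
  (ℤ.- x) ℤ.^ (2 * q)   ≡⟨ ℤₚ.^-*-assoc (ℤ.- x) 2 q ⟨
  ((ℤ.- x) ℤ.^ 2) ℤ.^ q ≡⟨ cong (ℤ._^ q) (lemma x) ⟩
  (x ℤ.^ 2) ℤ.^ q       ≡⟨ ℤₚ.^-*-assoc x 2 q ⟩
  x ℤ.^ (2 * q)         ≡⟨ cong (x ℤ.^_) (ℕₚ.*-comm 2 q) ⟩
  x ℤ.^ (q * 2)         ∎
  where
  open ≡-Reasoning
  lemma : ∀ x → (ℤ.- x) ℤ.* ((ℤ.- x) ℤ.* 1ℤ) ≡ x ℤ.* (x ℤ.* 1ℤ)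
  lemma = ring-ℤ

-- The offsets 2j + 1 - 2m are the odd numbers from -(2m-1) to 2m - 1; the induction strips the two
-- outermost.
∑-pairs : ∀ m (F : ℤ → ℤ) x → ∑ (m + m) (λ j → F (x ℤ.+ (+ 2 ℤ.* + j ℤ.+ 1ℤ ℤ.- + 2 ℤ.* + m)))
  ≡ ∑ m (λ i → F (x ℤ.+ odd i) ℤ.+ F (x ℤ.- odd i))
∑-pairs zero    F x = refl
∑-pairs (suc m) F x = begin
  ∑ (suc m + suc m) f
    ≡⟨ cong (λ l → ∑ (suc l) f) (ℕₚ.+-suc m m) ⟩
  ∑ (suc (m + m)) f ℤ.+ f (suc (m + m))
    ≡⟨ cong₂ ℤ._+_ (trans (∑-first (m + m) f) (cong₂ ℤ._+_ (cong F (lowest x (+ m))) (trans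
         (∑-cong (m + m) (λ j _ → cong F (shift x (+ j) (+ m)))) (∑-pairs m F x))))
       (cong F (trans (cong (λ l → x ℤ.+ (+ 2 ℤ.* (1ℤ ℤ.+ l) ℤ.+ 1ℤ ℤ.- + 2 ℤ.* + suc m)) (ℤₚ.pos-+ m m)) (highest x (+ m)))) ⟩
  (F (x ℤ.- odd m) ℤ.+ rest) ℤ.+ F (x ℤ.+ odd m)
    ≡⟨ regroup (F (x ℤ.- odd m)) rest (F (x ℤ.+ odd m)) ⟩
  rest ℤ.+ (F (x ℤ.+ odd m) ℤ.+ F (x ℤ.- odd m)) ∎
  where
  open ≡-Reasoning
  f : ℕ → ℤ
  f j = F (x ℤ.+ (+ 2 ℤ.* + j ℤ.+ 1ℤ ℤ.- + 2 ℤ.* + suc m))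
  rest = ∑ m (λ i → F (x ℤ.+ odd i) ℤ.+ F (x ℤ.- odd i))
  lowest : ∀ x m → x ℤ.+ (+ 2 ℤ.* 0ℤ ℤ.+ 1ℤ ℤ.- + 2 ℤ.* (1ℤ ℤ.+ m)) ≡ x ℤ.- (+ 2 ℤ.* m ℤ.+ 1ℤ)
  lowest = ring-ℤ
  shift : ∀ x j m → x ℤ.+ (+ 2 ℤ.* (1ℤ ℤ.+ j) ℤ.+ 1ℤ ℤ.- + 2 ℤ.* (1ℤ ℤ.+ m)) ≡ x ℤ.+ (+ 2 ℤ.* j ℤ.+ 1ℤ ℤ.- + 2 ℤ.* m)
  shift = ring-ℤ
  highest : ∀ x m → x ℤ.+ (+ 2 ℤ.* (1ℤ ℤ.+ (m ℤ.+ m)) ℤ.+ 1ℤ ℤ.- + 2 ℤ.* (1ℤ ℤ.+ m)) ≡ x ℤ.+ (+ 2 ℤ.* m ℤ.+ 1ℤ)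
  highest = ring-ℤ
  regroup : ∀ a r b → (a ℤ.+ r) ℤ.+ b ≡ r ℤ.+ (b ℤ.+ a)
  regroup = ring-ℤ

-- With an odd number of offsets one of them, -(2m+1), has no partner and is split off.
∑-centred : ∀ m (F : ℤ → ℤ) x → ∑ (2 * m + 1) (λ j → F (x ℤ.+ (+ 2 ℤ.* + j ℤ.- odd m)))
  ≡ F (x ℤ.- odd m) ℤ.+ ∑ m (λ i → F (x ℤ.+ odd i) ℤ.+ F (x ℤ.- odd i))
∑-centred m F x = trans (cong (λ l → ∑ l f) (size m)) (trans (∑-first (m + m) f)
  (cong₂ ℤ._+_ (cong F (lowest x (+ m))) (trans (∑-cong (m + m) (λ j _ → cong F (shift x (+ j) (+ m)))) (∑-pairs m F x))))
  where
  f : ℕ → ℤ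
  f j = F (x ℤ.+ (+ 2 ℤ.* + j ℤ.- odd m))
  size : ∀ m → 2 * m + 1 ≡ suc (m + m)
  size = ring-ℕ
  lowest : ∀ x m → x ℤ.+ (+ 2 ℤ.* 0ℤ ℤ.- (+ 2 ℤ.* m ℤ.+ 1ℤ)) ≡ x ℤ.- (+ 2 ℤ.* m ℤ.+ 1ℤ)
  lowest = ring-ℤ
  shift : ∀ x j m → x ℤ.+ (+ 2 ℤ.* (1ℤ ℤ.+ j) ℤ.- (+ 2 ℤ.* m ℤ.+ 1ℤ)) ≡ x ℤ.+ (+ 2 ℤ.* j ℤ.+ 1ℤ ℤ.- + 2 ℤ.* m)
  shift = ring-ℤ

-- As k is even, x - w may be replaced by w - x, and the two linear terms in x cancel.
pair₁ : ∀ {k} → 2 ∣ k → 0 < k → ∀ x w → (x ℤ.+ w) ℤ.^ k ℤ.+ (x ℤ.- w) ℤ.^ k ≅ + 2 ℤ.* w ℤ.^ k [ x ℤ.* x ]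
pair₁ {suc k} 2∣k _ x w = ≅-trans
  (≅-reflexive (cong₂ ℤ._+_ (cong (ℤ._^ suc k) (ℤₚ.+-comm x w))
    (trans (sym (neg-even-power 2∣k (x ℤ.- w))) (cong (ℤ._^ suc k) (flip x w)))))
  (≅-trans (≅-+ (taylor₁ k w x) (≅-∣ (ℤ∣.∣-reflexive (square x)) (taylor₁ k w (ℤ.- x))))
    (≅-reflexive (cancel (w ℤ.^ suc k) (+ suc k) x (w ℤ.^ k))))
  where
  flip : ∀ x w → ℤ.- (x ℤ.- w) ≡ w ℤ.+ ℤ.- x
  flip = ring-ℤ
  square : ∀ x → x ℤ.* x ≡ (ℤ.- x) ℤ.* (ℤ.- x)
  square = ring-ℤ
  cancel : ∀ a k x b → (a ℤ.+ (k ℤ.* x) ℤ.* b) ℤ.+ (a ℤ.+ (k ℤ.* (ℤ.- x)) ℤ.* b) ≡ + 2 ℤ.* a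
  cancel = ring-ℤ

-- The left side is the sum of the (2j)^k. Writing 2j = n + (2j - n) with n = 2m + 1 gives the
-- centred form around x = n, whose unpaired summand is (n - n)^k = 0.
S-T : ∀ {k} → 2 ∣ k → 0 < k → ∀ m → (+ 2) ℤ.^ k ℤ.* S k (2 * m + 1) ≅ + 2 ℤ.* + T k m [ odd m ℤ.* odd m ]
S-T {k} 2∣k k>0 m = ≅-trans (≅-reflexive doubled) (≅-trans (≅-+ (≅-refl {0ℤ}) (≅-∑ m (λ i _ → pair₁ 2∣k k>0 (odd m) (odd i))))
  (≅-reflexive (trans (ℤₚ.+-identityˡ (∑ m (λ i → + 2 ℤ.* odd i ℤ.^ k)))
    (trans (∑-*ˡ m (+ 2) (λ i → odd i ℤ.^ k)) (cong (λ x → + 2 ℤ.* x) (sym (T-∑ k m)))))))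
  where
  open ≡-Reasoning
  vanish : ∀ {k} → 0 < k → 0ℤ ℤ.^ k ≡ 0ℤ
  vanish {suc _} _ = refl
  centre : ∀ j n → + 2 ℤ.* j ≡ n ℤ.+ (+ 2 ℤ.* j ℤ.- n)
  centre = ring-ℤ
  doubled : (+ 2) ℤ.^ k ℤ.* S k (2 * m + 1) ≡ 0ℤ ℤ.+ ∑ m (λ i → (odd m ℤ.+ odd i) ℤ.^ k ℤ.+ (odd m ℤ.- odd i) ℤ.^ k)
  doubled = begin
    (+ 2) ℤ.^ k ℤ.* S k (2 * m + 1)
      ≡⟨ ∑-*ˡ (2 * m + 1) ((+ 2) ℤ.^ k) (λ j → (+ j) ℤ.^ k) ⟨
    ∑ (2 * m + 1) (λ j → (+ 2) ℤ.^ k ℤ.* (+ j) ℤ.^ k)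
      ≡⟨ ∑-cong (2 * m + 1) (λ j _ → trans (sym (^-distribʳ-* (+ 2) (+ j) k)) (cong (ℤ._^ k) (centre (+ j) (odd m)))) ⟩
    ∑ (2 * m + 1) (λ j → (odd m ℤ.+ (+ 2 ℤ.* + j ℤ.- odd m)) ℤ.^ k)
      ≡⟨ ∑-centred m (ℤ._^ k) (odd m) ⟩
    (odd m ℤ.- odd m) ℤ.^ k ℤ.+ ∑ m (λ i → (odd m ℤ.+ odd i) ℤ.^ k ℤ.+ (odd m ℤ.- odd i) ℤ.^ k)
      ≡⟨ cong (λ x → x ℤ.+ ∑ m (λ i → (odd m ℤ.+ odd i) ℤ.^ k ℤ.+ (odd m ℤ.- odd i) ℤ.^ k))
           (trans (cong (ℤ._^ k) (ℤₚ.+-inverseʳ (odd m))) (vanish k>0)) ⟩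
    0ℤ ℤ.+ ∑ m (λ i → (odd m ℤ.+ odd i) ℤ.^ k ℤ.+ (odd m ℤ.- odd i) ℤ.^ k) ∎

∣-*-pres : ∀ {a b c d} → a ∣ℤ b → c ∣ℤ d → a ℤ.* c ∣ℤ b ℤ.* d
∣-*-pres {a} {b} {c} {d} h h′ = ℤ∣.∣-trans (ℤ∣.*-monoʳ-∣ a h′) (ℤ∣.*-monoˡ-∣ d h)

pos-^-+ : ∀ p m n → + (p ^ (m + n)) ≡ + (p ^ m) ℤ.* + (p ^ n)
pos-^-+ p m n = trans (cong +_ (ℕₚ.^-distribˡ-+-* p m n)) (ℤₚ.pos-* (p ^ m) (p ^ n))

-- Orders 1 and 3 cancel between x and -x; orders 4 and above vanish by `binomial-power-∣` with c =
-- 3, whose condition on p is 4 < p. Only the quadratic term survives.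
pair₃ : ∀ {p} → Prime p → 4 < p → ∀ k v o → 2 ∣ 4 + k → 0 < v → p ^ o ∣ 4 + k → ∀ {x} w → + (p ^ v) ∣ℤ x →
  (x ℤ.+ w) ℤ.^ (4 + k) ℤ.+ (x ℤ.- w) ℤ.^ (4 + k)
    ≅ + 2 ℤ.* w ℤ.^ (4 + k) ℤ.+ (+ ((4 + k) * (3 + k)) ℤ.* (x ℤ.* x)) ℤ.* w ℤ.^ (2 + k) [ + (p ^ (3 * v + 1 + o)) ]
pair₃ {p} pr p>4 k v o 2∣k v>0 p^o∣k {x} w p^v∣x = ≅-trans
  (≅-reflexive (cong₂ ℤ._+_ (cong (ℤ._^ (4 + k)) (ℤₚ.+-comm x w))
    (trans (sym (neg-even-power 2∣k (x ℤ.- w))) (cong (ℤ._^ (4 + k)) (flip x w)))))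
  (≅-trans (≅-+ (cubic x p^v∣x) (cubic (ℤ.- x) (ℤ∣.∣m⇒∣-m p^v∣x)))
    (≅-reflexive (trans (cancel (+ ((4 + k) C 0)) (+ ((4 + k) C 1)) (+ ((4 + k) C 2)) (+ ((4 + k) C 3))
        (w ℤ.^ (4 + k)) (w ℤ.^ (3 + k)) (w ℤ.^ (2 + k)) (w ℤ.^ (1 + k)) x)
      (cong (λ c → + 2 ℤ.* w ℤ.^ (4 + k) ℤ.+ (c ℤ.* (x ℤ.* x)) ℤ.* w ℤ.^ (2 + k)) two-choose))))
  where
  flip : ∀ x w → ℤ.- (x ℤ.- w) ≡ w ℤ.+ ℤ.- x
  flip = ring-ℤ
  cubic : ∀ y → + (p ^ v) ∣ℤ y → (w ℤ.+ y) ℤ.^ (4 + k) ≅ ∑ 4 (binomialTerm w y (4 + k)) [ + (p ^ (3 * v + 1 + o)) ]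
  cubic y p^v∣y = ≅-trans (≅-reflexive (trans (binomial-theorem w y (4 + k)) (∑-split 4 (suc k) (binomialTerm w y (4 + k)))))
    (≅-+-multiple (∑ 4 (binomialTerm w y (4 + k))) (∑-∣ (suc k) (λ i _ → subst (+ (p ^ (3 * v + 1 + o)) ∣ℤ_)
      (rotate (+ ((4 + k) C (4 + i))) (w ℤ.^ ((4 + k) ∸ (4 + i))) (y ℤ.^ (4 + i)))
      (ℤ∣.∣m⇒∣m*n (w ℤ.^ ((4 + k) ∸ (4 + i)))
        (binomial-power-∣ pr {c = 3} {i = 4 + i} p>4 (s≤s (s≤s (s≤s (s≤s z≤n)))) v>0 p^v∣y p^o∣k)))))
    where
    rotate : ∀ c u y → (c ℤ.* y) ℤ.* u ≡ c ℤ.* (u ℤ.* y)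
    rotate = ring-ℤ
  cancel : ∀ c₀ c₁ c₂ c₃ u₀ u₁ u₂ u₃ x →
    ((((0ℤ ℤ.+ 1ℤ ℤ.* (u₀ ℤ.* 1ℤ)) ℤ.+ c₁ ℤ.* (u₁ ℤ.* (x ℤ.* 1ℤ))) ℤ.+ c₂ ℤ.* (u₂ ℤ.* (x ℤ.* (x ℤ.* 1ℤ)))) ℤ.+ c₃ ℤ.* (u₃ ℤ.* (x ℤ.* (x ℤ.* (x ℤ.* 1ℤ)))))
    ℤ.+ ((((0ℤ ℤ.+ 1ℤ ℤ.* (u₀ ℤ.* 1ℤ)) ℤ.+ c₁ ℤ.* (u₁ ℤ.* ((ℤ.- x) ℤ.* 1ℤ))) ℤ.+ c₂ ℤ.* (u₂ ℤ.* ((ℤ.- x) ℤ.* ((ℤ.- x) ℤ.* 1ℤ)))) ℤ.+ c₃ ℤ.* (u₃ ℤ.* ((ℤ.- x) ℤ.* ((ℤ.- x) ℤ.* ((ℤ.- x) ℤ.* 1ℤ)))))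
    ≡ + 2 ℤ.* u₀ ℤ.+ ((+ 2 ℤ.* c₂) ℤ.* (x ℤ.* x)) ℤ.* u₂
  cancel = ring-ℤ
  two-choose : + 2 ℤ.* + ((4 + k) C 2) ≡ + ((4 + k) * (3 + k))
  two-choose = trans (sym (ℤₚ.pos-* 2 ((4 + k) C 2))) (cong +_ (trans (C-absorption (3 + k) 1) (cong ((4 + k) *_) (nC1≡n (3 + k)))))

squares : ℕ → ℤ
squares t = ∑ t (λ s → + suc s ℤ.* + suc s)

squares-closed : ∀ t → + 6 ℤ.* squares t ≡ (+ t ℤ.* (1ℤ ℤ.+ + t)) ℤ.* odd t
squares-closed zero    = refl
squares-closed (suc t) = trans (ℤₚ.*-distribˡ-+ (+ 6) (squares t) (+ suc t ℤ.* + suc t))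
  (trans (cong (λ x → x ℤ.+ + 6 ℤ.* (+ suc t ℤ.* + suc t)) (squares-closed t)) (lemma (+ t)))
  where
  lemma : ∀ t → (t ℤ.* (1ℤ ℤ.+ t)) ℤ.* (+ 2 ℤ.* t ℤ.+ 1ℤ) ℤ.+ + 6 ℤ.* ((1ℤ ℤ.+ t) ℤ.* (1ℤ ℤ.+ t))
    ≡ ((1ℤ ℤ.+ t) ℤ.* (1ℤ ℤ.+ (1ℤ ℤ.+ t))) ℤ.* (+ 2 ℤ.* (1ℤ ℤ.+ t) ℤ.+ 1ℤ)
  lemma = ring-ℤ

-- The closed form of 6 times the sum contains 2h + 1 = p, and 6 is prime to p ≥ 5. This gives the
-- error of a step from n to p n its extra factor p.
p∣squares : ∀ {p} → Prime p → 4 < p → ∀ h → p ≡ 2 * h + 1 → + p ∣ℤ squares h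
p∣squares {p} pr p>4 h p≡ = prime-cancelℤ pr (+ 6) p∤6 (subst (+ p ∣ℤ_) (sym (squares-closed h))
  (ℤ∣.∣n⇒∣m*n (+ h ℤ.* (1ℤ ℤ.+ + h)) (ℤ∣.∣-reflexive (trans (cong +_ p≡) (pos-odd h)))))
  where
  p∤6 : p ∤ 6
  p∤6 = prime-∤-* pr {2} {3} (∤-positive (s≤s z≤n) (ℕₚ.<-trans (s≤s (s≤s (s≤s z≤n))) p>4)) (∤-positive (s≤s z≤n) (ℕₚ.<-trans (s≤s (s≤s (s≤s (s≤s z≤n)))) p>4))

-- Each block of n = 2m + 1 consecutive odd numbers consists of pairs x ± (2i + 1), i < m, around x = 2(t + 1)n and the number x - n;
-- in even powers the odd-order terms cancel, which is what saves the error of order n.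
T-blocks : ∀ {p} → Prime p → 4 < p → ∀ k v o → 2 ∣ 4 + k → 0 < v → p ^ o ∣ 4 + k → ∀ m → + (p ^ v) ∣ℤ odd m → ∀ t →
  + T (4 + k) (m + t * (2 * m + 1))
    ≅ odd t ℤ.* + T (4 + k) m ℤ.+ (+ ((4 + k) * (3 + k)) ℤ.* (+ 4 ℤ.* (odd m ℤ.* odd m)) ℤ.* + T (2 + k) m) ℤ.* squares t
    [ + (p ^ (3 * v + 1 + o)) ]
T-blocks pr p>4 k v o 2∣k v>0 p^o∣k m p^v∣n zero = ≅-reflexive (trans (cong (λ l → + T (4 + k) l) (ℕₚ.+-identityʳ m))
  (lemma (+ T (4 + k) m) (+ ((4 + k) * (3 + k)) ℤ.* (+ 4 ℤ.* (odd m ℤ.* odd m)) ℤ.* + T (2 + k) m)))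
  where
  lemma : ∀ a b → a ≡ 1ℤ ℤ.* a ℤ.+ b ℤ.* 0ℤ
  lemma = ring-ℤ
T-blocks {p} pr p>4 k v o 2∣k v>0 p^o∣k m p^v∣n (suc t) = ≅-trans (≅-reflexive split)
  (≅-trans (≅-+ (T-blocks pr p>4 k v o 2∣k v>0 p^o∣k m p^v∣n t) (≅-+ lowest (≅-∑ m (λ i _ → pair₃ pr p>4 k v o 2∣k v>0 p^o∣k (odd i) p^v∣x))))
    (≅-reflexive (trans (cong (λ s → before ℤ.+ (0ℤ ℤ.+ s)) pairs)
      (collect (+ t) (+ T (4 + k) m) (+ T (2 + k) m) (+ ((4 + k) * (3 + k))) (odd m) (squares t)))))
  where
  n = 2 * m + 1
  x = (+ 2 ℤ.* + suc t) ℤ.* odd m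
  F : ℤ → ℤ
  F = ℤ._^ (4 + k)
  before = odd t ℤ.* + T (4 + k) m ℤ.+ (+ ((4 + k) * (3 + k)) ℤ.* (+ 4 ℤ.* (odd m ℤ.* odd m)) ℤ.* + T (2 + k) m) ℤ.* squares t
  a = + ((4 + k) * (3 + k)) ℤ.* (x ℤ.* x)
  p^v∣x : + (p ^ v) ∣ℤ x
  p^v∣x = ℤ∣.∣n⇒∣m*n (+ 2 ℤ.* + suc t) p^v∣n
  pairs : ∑ m (λ i → + 2 ℤ.* odd i ℤ.^ (4 + k) ℤ.+ a ℤ.* odd i ℤ.^ (2 + k)) ≡ + 2 ℤ.* + T (4 + k) m ℤ.+ a ℤ.* + T (2 + k) m
  pairs = trans (∑-distrib-+ m (λ i → + 2 ℤ.* odd i ℤ.^ (4 + k)) (λ i → a ℤ.* odd i ℤ.^ (2 + k)))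
    (cong₂ ℤ._+_ (trans (∑-*ˡ m (+ 2) (λ i → odd i ℤ.^ (4 + k))) (cong (λ y → + 2 ℤ.* y) (sym (T-∑ (4 + k) m))))
      (trans (∑-*ˡ m a (λ i → odd i ℤ.^ (2 + k))) (cong (λ y → a ℤ.* y) (sym (T-∑ (2 + k) m)))))
  collect : ∀ t T₀ T₂ c n q → ((+ 2 ℤ.* t ℤ.+ 1ℤ) ℤ.* T₀ ℤ.+ (c ℤ.* (+ 4 ℤ.* (n ℤ.* n)) ℤ.* T₂) ℤ.* q)
      ℤ.+ (0ℤ ℤ.+ (+ 2 ℤ.* T₀ ℤ.+ (c ℤ.* (((+ 2 ℤ.* (1ℤ ℤ.+ t)) ℤ.* n) ℤ.* ((+ 2 ℤ.* (1ℤ ℤ.+ t)) ℤ.* n))) ℤ.* T₂))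
    ≡ (+ 2 ℤ.* (1ℤ ℤ.+ t) ℤ.+ 1ℤ) ℤ.* T₀ ℤ.+ (c ℤ.* (+ 4 ℤ.* (n ℤ.* n)) ℤ.* T₂) ℤ.* (q ℤ.+ (1ℤ ℤ.+ t) ℤ.* (1ℤ ℤ.+ t))
  collect = ring-ℤ
  lowest : F (x ℤ.- odd m) ≅ 0ℤ [ + (p ^ (3 * v + 1 + o)) ]
  lowest = ∣⇒≅0 (subst (+ (p ^ (3 * v + 1 + o)) ∣ℤ_) (trans (cong (λ c → + c ℤ.* F (x ℤ.- odd m)) (nCn≡1 (4 + k))) (ℤₚ.*-identityˡ (F (x ℤ.- odd m))))
    (binomial-power-∣ pr {c = 3} {i = 4 + k} p>4 (s≤s (s≤s (s≤s (s≤s z≤n)))) v>0 (ℤ∣.∣m∣n⇒∣m-n p^v∣x p^v∣n) p^o∣k))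
  sizes : ∀ m t n → m + suc t * n ≡ (m + t * n) + n
  sizes = ring-ℕ
  base = m + t * n
  centre : ∀ m t j → + 2 ℤ.* (m ℤ.+ t ℤ.* (+ 2 ℤ.* m ℤ.+ 1ℤ) ℤ.+ j) ℤ.+ 1ℤ
    ≡ (+ 2 ℤ.* (1ℤ ℤ.+ t)) ℤ.* (+ 2 ℤ.* m ℤ.+ 1ℤ) ℤ.+ (+ 2 ℤ.* j ℤ.- (+ 2 ℤ.* m ℤ.+ 1ℤ))
  centre = ring-ℤ
  centred : ∀ j → odd (base + j) ≡ x ℤ.+ (+ 2 ℤ.* + j ℤ.- odd m)
  centred j = trans (cong (λ y → + 2 ℤ.* y ℤ.+ 1ℤ) (trans (ℤₚ.pos-+ base j) (cong (λ y → y ℤ.+ + j)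
    (trans (ℤₚ.pos-+ m (t * n)) (cong (λ y → + m ℤ.+ y) (trans (ℤₚ.pos-* t n) (cong (λ y → + t ℤ.* y) (pos-odd m))))))))
    (centre (+ m) (+ t) (+ j))
  open ≡-Reasoning
  split : + T (4 + k) (m + suc t * n) ≡ + T (4 + k) base ℤ.+ (F (x ℤ.- odd m) ℤ.+ ∑ m (λ i → F (x ℤ.+ odd i) ℤ.+ F (x ℤ.- odd i)))
  split = begin
    + T (4 + k) (m + suc t * n)
      ≡⟨ cong (λ l → + T (4 + k) l) (sizes m t n) ⟩
    + T (4 + k) (base + n)
      ≡⟨ T-∑ (4 + k) (base + n) ⟩
    ∑ (base + n) (λ i → F (odd i))
      ≡⟨ ∑-split base n (λ i → F (odd i)) ⟩
    ∑ base (λ i → F (odd i)) ℤ.+ ∑ n (λ j → F (odd (base + j)))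
      ≡⟨ cong₂ ℤ._+_ (sym (T-∑ (4 + k) base)) (trans (∑-cong n (λ j _ → cong F (centred j))) (∑-centred m F x)) ⟩
    + T (4 + k) base ℤ.+ (F (x ℤ.- odd m) ℤ.+ ∑ m (λ i → F (x ℤ.+ odd i) ℤ.+ F (x ℤ.- odd i))) ∎

-- The choice t = h makes `odd t` equal to p, so the main term gains one p. In the error, k, n²,
-- T_{k-2} and the squares contribute o, 2v, u and 1, whence the condition on e.
T-step : ∀ {p} → Prime p → 4 < p → ∀ h → p ≡ 2 * h + 1 → ∀ k v o u e → 2 ∣ 4 + k → 0 < v → p ^ o ∣ 4 + k → u ≤ v →
  ∀ m → + (p ^ v) ∣ℤ odd m → + (p ^ u) ∣ℤ + T (2 + k) m → e ≤ 2 * v + u + o → + (p ^ e) ∣ℤ + T (4 + k) m →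
  + (p ^ suc e) ∣ℤ + T (4 + k) (m + h * (2 * m + 1))
T-step {p} pr p>4 h p≡ k v o u e 2∣k v>0 p^o∣k u≤v m p^v∣n p^u∣T e≤ p^e∣T =
  ≅-∣-resp (≅-∣ (∣-pos (m≤n⇒p^m∣p^n p modulus)) (T-blocks pr p>4 k v o 2∣k v>0 p^o∣k m p^v∣n h))
    (ℤ∣.∣m∣n⇒∣m+n
      (subst (λ x → x ∣ℤ odd h ℤ.* + T (4 + k) m) (sym (ℤₚ.pos-* p (p ^ e)))
        (∣-*-pres (ℤ∣.∣-reflexive (trans (cong +_ p≡) (pos-odd h))) p^e∣T))
      (ℤ∣.∣-trans (∣-pos (m≤n⇒p^m∣p^n p exponent)) (subst (λ x → x ∣ℤ second) (sym powers)
        (∣-*-pres (∣-*-pres (∣-*-pres (∣-pos (ℕ∣.∣m⇒∣m*n (3 + k) p^o∣k))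
          (ℤ∣.∣n⇒∣m*n (+ 4) (∣-*-pres p^v∣n p^v∣n))) p^u∣T)
          (subst (λ x → + x ∣ℤ squares h) (sym (ℕₚ.*-identityʳ p)) (p∣squares pr p>4 h p≡))))))
  where
  second = (+ ((4 + k) * (3 + k)) ℤ.* (+ 4 ℤ.* (odd m ℤ.* odd m)) ℤ.* + T (2 + k) m) ℤ.* squares h
  powers : + (p ^ (o + (v + v) + u + 1)) ≡ + (p ^ o) ℤ.* (+ (p ^ v) ℤ.* + (p ^ v)) ℤ.* + (p ^ u) ℤ.* + (p ^ 1)
  powers = trans (pos-^-+ p (o + (v + v) + u) 1) (cong (λ x → x ℤ.* + (p ^ 1))
    (trans (pos-^-+ p (o + (v + v)) u) (cong (λ x → x ℤ.* + (p ^ u))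
      (trans (pos-^-+ p o (v + v)) (cong (λ x → + (p ^ o) ℤ.* x) (pos-^-+ p v v))))))
  reorder : ∀ v u o → suc (2 * v + u + o) ≡ o + (v + v) + u + 1
  reorder = ring-ℕ
  exponent : suc e ≤ o + (v + v) + u + 1
  exponent = ℕₚ.≤-trans (s≤s e≤) (ℕₚ.≤-reflexive (reorder v u o))
  enlarge : ∀ v o → suc (2 * v + v + o) ≡ 3 * v + 1 + o
  enlarge = ring-ℕ
  -- Here u ≤ v enters: `T-blocks` is valid only modulo p^(3v+1+o).
  modulus : suc e ≤ 3 * v + 1 + o
  modulus = ℕₚ.≤-trans (s≤s (ℕₚ.≤-trans e≤ (ℕₚ.+-monoˡ-≤ o (ℕₚ.+-monoʳ-≤ (2 * v) u≤v)))) (ℕₚ.≤-reflexive (enlarge v o))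

-- Multiplying n by powers of p, and the numerator of B_k

scale : ℕ → ℕ → ℕ → ℕ
scale h zero    m = m
scale h (suc s) m = scale h s m + h * (2 * scale h s m + 1)

scale-odd : ∀ h s m → 2 * scale h s m + 1 ≡ (2 * h + 1) ^ s * (2 * m + 1)
scale-odd h zero    m = sym (ℕₚ.+-identityʳ (2 * m + 1))
scale-odd h (suc s) m = trans (lemma h (scale h s m)) (trans (cong ((2 * h + 1) *_) (scale-odd h s m))
  (sym (ℕₚ.*-assoc (2 * h + 1) ((2 * h + 1) ^ s) (2 * m + 1))))
  where
  lemma : ∀ h m → 2 * (m + h * (2 * m + 1)) + 1 ≡ (2 * h + 1) * (2 * m + 1)
  lemma = ring-ℕ

-- At level s the exponent v has grown to v + s, so `T-step` allows up to 2(v+s) + u + o, more than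
-- the 2v + u + o + s carried along. Since u stays fixed while m changes, the divisibility of
-- T_{k-2} is assumed for all m with p^v | 2m + 1.
T-scale-∣ : ∀ {p} → Prime p → 4 < p → ∀ h → p ≡ 2 * h + 1 → ∀ k v o u → 2 ∣ 4 + k → 0 < v → p ^ o ∣ 4 + k → u ≤ v →
  (∀ m → p ^ v ∣ 2 * m + 1 → + (p ^ u) ∣ℤ + T (2 + k) m) →
  ∀ m → p ^ v ∣ 2 * m + 1 → + (p ^ (2 * v + u + o)) ∣ℤ + T (4 + k) m →
  ∀ s → + (p ^ (2 * v + u + o + s)) ∣ℤ + T (4 + k) (scale h s m)
T-scale-∣ {p} pr p>4 h p≡ k v o u 2∣k v>0 p^o∣k u≤v p^u∣T m p^v∣n base zero =
  subst (λ e → + (p ^ e) ∣ℤ + T (4 + k) m) (sym (ℕₚ.+-identityʳ (2 * v + u + o))) base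
T-scale-∣ {p} pr p>4 h p≡ k v o u 2∣k v>0 p^o∣k u≤v p^u∣T m p^v∣n base (suc s) =
  subst (λ e → + (p ^ e) ∣ℤ + T (4 + k) (scale h (suc s) m)) (sym (ℕₚ.+-suc (2 * v + u + o) s))
    (T-step pr p>4 h p≡ k (v + s) o u (2 * v + u + o + s) 2∣k (ℕₚ.<-≤-trans v>0 (ℕₚ.m≤m+n v s)) p^o∣k
      (ℕₚ.≤-trans u≤v (ℕₚ.m≤m+n v s)) mₛ (subst (+ (p ^ (v + s)) ∣ℤ_) (pos-odd mₛ) (∣-pos p^v+s∣))
      (p^u∣T mₛ (ℕ∣.∣-trans (m≤n⇒p^m∣p^n p (ℕₚ.m≤m+n v s)) p^v+s∣)) exponent
      (T-scale-∣ pr p>4 h p≡ k v o u 2∣k v>0 p^o∣k u≤v p^u∣T m p^v∣n base s))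
  where
  mₛ = scale h s m
  p^v+s∣ : p ^ (v + s) ∣ 2 * mₛ + 1
  p^v+s∣ = subst₂ _∣_ (trans (sym (ℕₚ.^-distribˡ-+-* p s v)) (cong (p ^_) (ℕₚ.+-comm s v)))
    (sym (trans (scale-odd h s m) (cong (λ q → q ^ s * (2 * m + 1)) (sym p≡)))) (ℕ∣.*-monoʳ-∣ (p ^ s) p^v∣n)
  double : ∀ v s u o → 2 * v + u + o + s + s ≡ 2 * (v + s) + u + o
  double = ring-ℕ
  exponent : 2 * v + u + o + s ≤ 2 * (v + s) + u + o
  exponent = ℕₚ.≤-trans (ℕₚ.m≤m+n (2 * v + u + o + s) s) (ℕₚ.≤-reflexive (double v s u o))

T-bernoulli : ∀ {k} → 2 ∣ k → 0 < k → ∃ λ d → ∀ m →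
  (+ 2 ℤ.* (+ suc d ℤ.* + V k)) ℤ.* + T k m ≅ ((+ 2) ℤ.^ k ℤ.* (+ suc d ℤ.* U k)) ℤ.* odd m [ odd m ℤ.* odd m ]
T-bernoulli {k} 2∣k k>0 = proj₁ (power-sum-bernoulli k) , λ m → relation m (+ suc (proj₁ (power-sum-bernoulli k)) ℤ.* + V k)
  (+ suc (proj₁ (power-sum-bernoulli k)) ℤ.* U k) (proj₂ (power-sum-bernoulli k) (2 * m + 1))
  where
  move : ∀ a t → (+ 2 ℤ.* a) ℤ.* t ≡ a ℤ.* (+ 2 ℤ.* t)
  move = ring-ℤ
  swap : ∀ a b c → a ℤ.* (b ℤ.* c) ≡ b ℤ.* (a ℤ.* c)
  swap = ring-ℤ
  relation : ∀ m v u → v ℤ.* S k (2 * m + 1) ≅ u ℤ.* + (2 * m + 1) [ + (2 * m + 1) ℤ.* + (2 * m + 1) ] →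
    (+ 2 ℤ.* v) ℤ.* + T k m ≅ ((+ 2) ℤ.^ k ℤ.* u) ℤ.* odd m [ odd m ℤ.* odd m ]
  relation m v u h = ≅-trans (≅-reflexive (move v (+ T k m)))
    (≅-trans (≅-*ˡ v (≅-sym (S-T 2∣k k>0 m)))
      (≅-trans (≅-reflexive (swap v ((+ 2) ℤ.^ k) (S k (2 * m + 1))))
        (≅-trans (≅-*ˡ ((+ 2) ℤ.^ k) (subst (λ n → v ℤ.* S k (2 * m + 1) ≅ u ℤ.* n [ n ℤ.* n ]) (pos-odd m) h))
          (≅-reflexive (sym (ℤₚ.*-assoc ((+ 2) ℤ.^ k) u (odd m)))))))

abs-2^ : ∀ k → ℤ.∣ (+ 2) ℤ.^ k ∣ ≡ 2 ^ k
abs-2^ k = cong ℤ.∣_∣ (sym (pos-^ 2 k))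

-- Evaluation at the level s = u + o + δ with δ = ord_p (d+1). Then 2(v+s) = δ + (v+s) + (v+u+o), so
-- the modulus is just large enough: p^(δ+v+s) is taken by d + 1 and `odd mₛ`, and p^(v+u+o) is left
-- for U.
p^∣numerator : ∀ {p} → Prime p → ∀ h → p ≡ 2 * h + 1 → ∀ v o u m n′ → 2 * m + 1 ≡ p ^ v * n′ → p ∤ n′ →
  ∀ d {c U V : ℤ} (t : ℕ → ℤ) → (∀ m → (+ 2 ℤ.* (+ suc d ℤ.* V)) ℤ.* t m ≅ (c ℤ.* (+ suc d ℤ.* U)) ℤ.* odd m [ odd m ℤ.* odd m ]) →
  p ∤ ℤ.∣ c ∣ → (∀ s → + (p ^ (2 * v + u + o + s)) ∣ℤ t (scale h s m)) → + (p ^ (v + u + o)) ∣ℤ U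
p^∣numerator {p} pr h p≡ v o u m n′ n≡ p∤n′ d {c} {U} {V} t t≅ p∤c p^∣t with p-part pr (suc d) (s≤s z≤n)
... | d′ , d≡ , p∤d′ = prime-power-cancelℤ pr unit p∤unit (v + u + o)
  (ℤ∣.*-cancelˡ-∣ (+ (p ^ (δ + (v + s)))) {{ℤ.≢-nonZero (λ e → p^≢0 (ℤₚ.+-injective e))}} (subst₂ _∣ℤ_ (pos-^-+ p (δ + (v + s)) (v + u + o)) target divides-right))
  where
  δ = ordℕ p (suc d)
  s = u + o + δ
  mₛ = scale h s m
  e = δ + (v + s) + (v + u + o)
  unit = c ℤ.* + (d′ * n′)
  p^≢0 : p ^ (δ + (v + s)) ≢ 0
  p^≢0 = ℕ.≢-nonZero⁻¹ _ {{ℕₚ.m^n≢0 p (δ + (v + s)) {{Primality.prime⇒nonZero pr}}}}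
  p∤unit : p ∤ ℤ.∣ unit ∣
  p∤unit = subst (p ∤_) (sym (ℤₚ.abs-* c (+ (d′ * n′)))) (prime-∤-* pr p∤c (prime-∤-* pr p∤d′ p∤n′))
  size : 2 * mₛ + 1 ≡ p ^ (v + s) * n′
  size = trans (scale-odd h s m) (trans (cong₂ (λ q n → q ^ s * n) (sym p≡) n≡) (trans (sym (ℕₚ.*-assoc (p ^ s) (p ^ v) n′))
    (cong (_* n′) (trans (ℕₚ.*-comm (p ^ s) (p ^ v)) (sym (ℕₚ.^-distribˡ-+-* p v s))))))
  sizeℤ : odd mₛ ≡ + (p ^ (v + s)) ℤ.* + n′
  sizeℤ = trans (sym (pos-odd mₛ)) (trans (cong +_ size) (ℤₚ.pos-* (p ^ (v + s)) n′))
  D≡ : + suc d ≡ + (p ^ δ) ℤ.* + d′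
  D≡ = trans (cong +_ d≡) (ℤₚ.pos-* (p ^ δ) d′)
  exponent₁ : ∀ v u o δ s → δ + (v + s) + (v + u + o) ≡ δ + (2 * v + u + o + s)
  exponent₁ = ring-ℕ
  exponent₂ : ∀ v u o δ → δ + (v + (u + o + δ)) + (v + u + o) ≡ (v + (u + o + δ)) + (v + (u + o + δ))
  exponent₂ = ring-ℕ
  left : + (p ^ e) ∣ℤ (+ 2 ℤ.* (+ suc d ℤ.* V)) ℤ.* t mₛ
  left = subst (λ x → x ∣ℤ (+ 2 ℤ.* (+ suc d ℤ.* V)) ℤ.* t mₛ)
    (trans (sym (pos-^-+ p δ (2 * v + u + o + s))) (cong (λ x → + (p ^ x)) (sym (exponent₁ v u o δ s))))
    (∣-*-pres (ℤ∣.∣n⇒∣m*n (+ 2) (ℤ∣.∣m⇒∣m*n V (∣-pos (p^ord∣ (suc d) p (suc d))))) (p^∣t s))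
  p^v+s∣ : + (p ^ (v + s)) ∣ℤ odd mₛ
  p^v+s∣ = subst (+ (p ^ (v + s)) ∣ℤ_) (sym sizeℤ) (ℤ∣.∣m⇒∣m*n (+ n′) ℤ∣.∣-refl)
  modulus : + (p ^ e) ∣ℤ odd mₛ ℤ.* odd mₛ
  modulus = subst (λ x → x ∣ℤ odd mₛ ℤ.* odd mₛ)
    (trans (sym (pos-^-+ p (v + s) (v + s))) (cong (λ x → + (p ^ x)) (sym (exponent₂ v u o δ))))
    (∣-*-pres p^v+s∣ p^v+s∣)
  divides-right : + (p ^ e) ∣ℤ (c ℤ.* (+ suc d ℤ.* U)) ℤ.* odd mₛ
  divides-right = ≅-∣-resp (≅-sym (≅-∣ modulus (t≅ mₛ))) left
  rearrange : ∀ t D d′ u N n′ → (t ℤ.* ((D ℤ.* d′) ℤ.* u)) ℤ.* (N ℤ.* n′) ≡ (D ℤ.* N) ℤ.* ((t ℤ.* (d′ ℤ.* n′)) ℤ.* u)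
  rearrange = ring-ℤ
  target : (c ℤ.* (+ suc d ℤ.* U)) ℤ.* odd mₛ ≡ + (p ^ (δ + (v + s))) ℤ.* (unit ℤ.* U)
  target = trans (cong₂ (λ x y → (c ℤ.* (x ℤ.* U)) ℤ.* y) D≡ sizeℤ)
    (trans (rearrange c (+ (p ^ δ)) (+ d′) U (+ (p ^ (v + s))) (+ n′))
      (cong₂ (λ x y → x ℤ.* ((c ℤ.* y) ℤ.* U)) (sym (pos-^-+ p δ (v + s))) (sym (ℤₚ.pos-* d′ n′))))

p^∣U : ∀ {p} → Prime p → 4 < p → ∀ h → p ≡ 2 * h + 1 → ∀ k v o u → 2 ∣ 4 + k → 0 < v → p ^ o ∣ 4 + k → u ≤ v →
  (∀ m → p ^ v ∣ 2 * m + 1 → + (p ^ u) ∣ℤ + T (2 + k) m) →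
  ∀ m n′ → 2 * m + 1 ≡ p ^ v * n′ → p ∤ n′ → + (p ^ (2 * v + u + o)) ∣ℤ + T (4 + k) m →
  + (p ^ (v + u + o)) ∣ℤ U (4 + k)
p^∣U {p} pr p>4 h p≡ k v o u 2∣k v>0 p^o∣k u≤v p^u∣T m n′ n≡ p∤n′ base =
  p^∣numerator pr h p≡ v o u m n′ n≡ p∤n′ (proj₁ relation) {(+ 2) ℤ.^ (4 + k)} {U (4 + k)} {+ V (4 + k)} (λ m → + T (4 + k) m) (proj₂ relation)
    (subst (p ∤_) (sym (abs-2^ (4 + k))) (prime-∤-^ pr (∤-positive (s≤s z≤n) (ℕₚ.<-trans (s≤s (s≤s (s≤s z≤n))) p>4)) (4 + k)))
    (T-scale-∣ pr p>4 h p≡ k v o u 2∣k v>0 p^o∣k u≤v p^u∣T m (subst (p ^ v ∣_) (sym n≡) (ℕ∣.m∣m*n n′)) base)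
  where
  relation = T-bernoulli {4 + k} 2∣k (s≤s z≤n)

-- Voronoi's and Kummer's congruences

∑-∑ᶠ : ∀ n f → ∑ n f ≡ ∑ᶠ {n} (f ∘ toℕ)
∑-∑ᶠ zero    f = refl
∑-∑ᶠ (suc n) f = trans (∑-first n f) (cong (λ s → f 0 ℤ.+ s) (∑-∑ᶠ n (f ∘ suc)))

coprime-prime-power : ∀ {p g} → Prime p → p ∤ g → ∀ s → Coprime g (p ^ s)
coprime-prime-power {p} {g} pr p∤g s (d∣g , d∣p^s) = ℕ∣.∣1⇒≡1 (reduce d∣g s d∣p^s)
  where
  coprime : ∀ {d} → d ∣ g → Coprime d p
  coprime d∣g (e∣d , e∣p) with Primality.prime⇒irreducible pr e∣p
  ... | inj₁ e≡1  = e≡1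
  ... | inj₂ refl = contradiction (ℕ∣.∣-trans e∣d d∣g) p∤g
  reduce : ∀ {d} → d ∣ g → ∀ s → d ∣ p ^ s → d ∣ 1
  reduce d∣g zero    h = h
  reduce d∣g (suc s) h = reduce d∣g s (Coprimality.coprime-divisor (coprime d∣g) h)


-- g h ≡ 1 modulo N, with multiples of N on both sides to stay within the natural numbers.
InverseMod : ℕ → ℕ → ℕ → Set
InverseMod N g h = ∃ λ a → ∃ λ b → g * h + a * N ≡ 1 + b * N

inverse-mod : ∀ {g} N .{{_ : NonZero N}} → Coprime g N → ∃ λ h → InverseMod N g h
inverse-mod {g} (suc N) co with Coprimality.coprime-Bézout co
... | Bézout.+- x y eq = x , 0 , y , trans (ℕₚ.+-identityʳ (g * x)) (trans (ℕₚ.*-comm g x) (sym eq))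
-- Here g x ≡ -1 modulo N + 1; the factor N ≡ -1 corrects the sign.
... | Bézout.-+ x y eq = x * N , 1 , y * N , trans (lemma g x N) (cong suc (trans (cong (_* N) eq) (swap y (suc N) N)))
  where
  lemma : ∀ g x N → g * (x * N) + 1 * suc N ≡ suc ((1 + x * g) * N)
  lemma = ring-ℕ
  swap : ∀ y M N → y * M * N ≡ y * N * M
  swap = ring-ℕ

inverse-sym : ∀ {N g h} → InverseMod N g h → InverseMod N h g
inverse-sym {N} {g} {h} (a , b , eq) = a , b , trans (cong (_+ a * N) (ℕₚ.*-comm h g)) eq

%-*-absorb : ∀ g x N .{{_ : NonZero N}} → (g * (x ℕ.% N)) ℕ.% N ≡ (g * x) ℕ.% N
%-*-absorb g x N = begin
  (g * (x ℕ.% N)) ℕ.% N                     ≡⟨ ℕ/.%-distribˡ-* g (x ℕ.% N) N ⟩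
  ((g ℕ.% N) * (x ℕ.% N ℕ.% N)) ℕ.% N       ≡⟨ cong (λ y → ((g ℕ.% N) * y) ℕ.% N) (ℕ/.m%n%n≡m%n x N) ⟩
  ((g ℕ.% N) * (x ℕ.% N)) ℕ.% N             ≡⟨ ℕ/.%-distribˡ-* g x N ⟨
  (g * x) ℕ.% N                             ∎
  where open ≡-Reasoning

inverse-cancel : ∀ {N} .{{_ : NonZero N}} {g h} → InverseMod N g h → ∀ {i} → i < N → (g * ((h * i) ℕ.% N)) ℕ.% N ≡ i
inverse-cancel {N} {g} {h} (a , b , eq) {i} i<N = begin
  (g * ((h * i) ℕ.% N)) ℕ.% N       ≡⟨ %-*-absorb g (h * i) N ⟩
  (g * (h * i)) ℕ.% N               ≡⟨ ℕ/.[m+kn]%n≡m%n (g * (h * i)) (a * i) N ⟨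
  (g * (h * i) + a * i * N) ℕ.% N   ≡⟨ cong (ℕ._% N) (trans (lemma₁ g h i a N) (trans (cong (_* i) eq) (lemma₂ b N i))) ⟩
  (i + b * i * N) ℕ.% N             ≡⟨ ℕ/.[m+kn]%n≡m%n i (b * i) N ⟩
  i ℕ.% N                           ≡⟨ ℕ/.m<n⇒m%n≡m i<N ⟩
  i                                 ∎
  where
  open ≡-Reasoning
  lemma₁ : ∀ g h i a N → g * (h * i) + a * i * N ≡ (g * h + a * N) * i
  lemma₁ = ring-ℕ
  lemma₂ : ∀ b N i → (1 + b * N) * i ≡ i + b * i * N
  lemma₂ = ring-ℕ

∑-permute : ∀ N .{{_ : NonZero N}} {g h} → InverseMod N g h → ∀ f → ∑ N (λ j → f ((g * j) ℕ.% N)) ≡ ∑ N f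
∑-permute N {g} {h} inv f = begin
  ∑ N (λ j → f ((g * j) ℕ.% N))         ≡⟨ ∑-∑ᶠ N (λ j → f ((g * j) ℕ.% N)) ⟩
  ∑ᶠ {N} (λ i → f ((g * toℕ i) ℕ.% N))  ≡⟨ sum-cong-≗ {N} (λ i → cong f (Finₚ.toℕ-fromℕ< (ℕ/.m%n<n (g * toℕ i) N))) ⟨
  ∑ᶠ {N} (λ i → f (toℕ (to g i)))       ≡⟨ sum-permute (f ∘ toℕ) π ⟨
  ∑ᶠ {N} (f ∘ toℕ)                      ≡⟨ ∑-∑ᶠ N f ⟨
  ∑ N f                                 ∎
  where
  open ≡-Reasoning
  to : ℕ → Fin N → Fin N
  to c i = fromℕ< (ℕ/.m%n<n (c * toℕ i) N)
  cancel : ∀ {c d} → InverseMod N c d → ∀ i → to c (to d i) ≡ i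
  cancel {c} {d} inv i = Finₚ.toℕ-injective (trans (Finₚ.toℕ-fromℕ< (ℕ/.m%n<n (c * toℕ (to d i)) N))
    (trans (cong (λ x → (c * x) ℕ.% N) (Finₚ.toℕ-fromℕ< (ℕ/.m%n<n (d * toℕ i) N))) (inverse-cancel {N} {c} {d} inv (Finₚ.toℕ<n i))))
  π : Permutation N N
  π = permutation (to g) (to h) (cancel {g} {h} inv) (cancel {h} {g} (inverse-sym {N} {g} {h} inv))

-- The sum in Voronoi's congruence. Its powers have the residue of g j as base where the classical
-- form has g j; the two agree modulo N.
voronoiSum : ∀ N .{{_ : NonZero N}} → ℕ → ℕ → ℤ
voronoiSum N g k = ∑ N (λ j → + ((g * j) ℕ./ N) ℤ.* (+ ((g * j) ℕ.% N)) ℤ.^ k)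

-- The linear term is divisible by p^(s+o) and all later ones by one more p. That single power is
-- what determines the Voronoi sum modulo p.
taylor-prime : ∀ {p} → Prime p → 2 < p → ∀ k s o → 0 < s → p ^ o ∣ suc k → ∀ x {y} → + (p ^ s) ∣ℤ y →
  (x ℤ.+ y) ℤ.^ suc k ≅ x ℤ.^ suc k ℤ.+ (+ suc k ℤ.* y) ℤ.* x ℤ.^ k [ + (p ^ (1 * s + 1 + o)) ]
taylor-prime {p} pr p>2 k s o s>0 p^o∣k x {y} p^s∣y = ≅-trans
  (≅-reflexive (trans (binomial-theorem x y (suc k)) (∑-split 2 k (binomialTerm x y (suc k)))))
  (≅-trans (≅-+-multiple (∑ 2 (binomialTerm x y (suc k))) (∑-∣ k (λ i _ → subst (+ (p ^ (1 * s + 1 + o)) ∣ℤ_)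
      (rotate (+ (suc k C (2 + i))) (x ℤ.^ (suc k ∸ (2 + i))) (y ℤ.^ (2 + i)))
      (ℤ∣.∣m⇒∣m*n (x ℤ.^ (suc k ∸ (2 + i)))
        (binomial-power-∣ pr {c = 1} {i = 2 + i} p>2 (s≤s (s≤s z≤n)) s>0 p^s∣y p^o∣k)))))
    (≅-reflexive (trans (cong (λ c → ((0ℤ ℤ.+ 1ℤ ℤ.* (x ℤ.^ suc k ℤ.* 1ℤ)) ℤ.+ + c ℤ.* (x ℤ.^ k ℤ.* (y ℤ.* 1ℤ)))) (nC1≡n (suc k)))
      (simplify (x ℤ.^ suc k) (x ℤ.^ k) (+ suc k) y))))
  where
  rotate : ∀ c u y → (c ℤ.* y) ℤ.* u ≡ c ℤ.* (u ℤ.* y)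
  rotate = ring-ℤ
  simplify : ∀ a b c y → (0ℤ ℤ.+ 1ℤ ℤ.* (a ℤ.* 1ℤ)) ℤ.+ c ℤ.* (b ℤ.* (y ℤ.* 1ℤ)) ≡ a ℤ.+ (c ℤ.* y) ℤ.* b
  simplify = ring-ℤ

-- Multiplication by g permutes the residues modulo N = p^s; comparing (g j)^(k+1) with the power of its residue gives Voronoi's congruence.
S-voronoi : ∀ {p} → Prime p → 2 < p → ∀ {g} → p ∤ g → ∀ k s o → 0 < s → p ^ o ∣ suc k → .{{_ : NonZero (p ^ s)}} →
  (+ g) ℤ.^ suc k ℤ.* S (suc k) (p ^ s) ≅ S (suc k) (p ^ s) ℤ.+ (+ suc k ℤ.* + (p ^ s)) ℤ.* voronoiSum (p ^ s) g k
    [ + (p ^ (1 * s + 1 + o)) ]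
S-voronoi {p} pr p>2 {g} p∤g k s o s>0 p^o∣k with inverse-mod (p ^ s) (coprime-prime-power pr p∤g s)
... | h , inv = ≅-trans (≅-reflexive multiply) (≅-trans
  (≅-∑ N (λ j _ → taylor-prime pr p>2 k s o s>0 p^o∣k (+ r j) (ℤ∣.∣n⇒∣m*n (+ q j) ℤ∣.∣-refl)))
  (≅-reflexive (trans (∑-distrib-+ N (λ j → (+ r j) ℤ.^ suc k) (λ j → (+ suc k ℤ.* (+ q j ℤ.* + N)) ℤ.* (+ r j) ℤ.^ k))
    (cong₂ ℤ._+_ (∑-permute N {g} {h} inv (λ j → (+ j) ℤ.^ suc k))
      (trans (∑-cong N (λ j _ → regroup (+ suc k) (+ q j) (+ N) ((+ r j) ℤ.^ k)))
        (∑-*ˡ N (+ suc k ℤ.* + N) (λ j → + q j ℤ.* (+ r j) ℤ.^ k)))))))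
  where
  N = p ^ s
  q r : ℕ → ℕ
  q j = (g * j) ℕ./ N
  r j = (g * j) ℕ.% N
  regroup : ∀ k q N u → (k ℤ.* (q ℤ.* N)) ℤ.* u ≡ (k ℤ.* N) ℤ.* (q ℤ.* u)
  regroup = ring-ℤ
  division : ∀ j → + g ℤ.* + j ≡ + r j ℤ.+ + q j ℤ.* + N
  division j = trans (sym (ℤₚ.pos-* g j)) (trans (cong +_ (ℕ/.m≡m%n+[m/n]*n (g * j) N))
    (trans (ℤₚ.pos-+ (r j) (q j * N)) (cong (λ x → + r j ℤ.+ x) (ℤₚ.pos-* (q j) N))))
  multiply : (+ g) ℤ.^ suc k ℤ.* S (suc k) N ≡ ∑ N (λ j → (+ r j ℤ.+ + q j ℤ.* + N) ℤ.^ suc k)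
  multiply = trans (sym (∑-*ˡ N ((+ g) ℤ.^ suc k) (λ j → (+ j) ℤ.^ suc k)))
    (∑-cong N (λ j _ → trans (sym (^-distribʳ-* (+ g) (+ j) (suc k))) (cong (ℤ._^ suc k) (division j))))

≅-cancelˡ : ∀ c .{{_ : ℤ.NonZero c}} {a b d} → c ℤ.* a ≅ c ℤ.* b [ c ℤ.* d ] → a ≅ b [ d ]
≅-cancelˡ c {a} {b} {d} (congruent h) = congruent (ℤ∣.*-cancelˡ-∣ c (subst (c ℤ.* d ∣ℤ_) (lemma c a b) h))
  where
  lemma : ∀ c a b → c ℤ.* a ℤ.- c ℤ.* b ≡ c ℤ.* (a ℤ.- b)
  lemma = ring-ℤ

≅-*-scale : ∀ c {a b d} → a ≅ b [ d ] → c ℤ.* a ≅ c ℤ.* b [ c ℤ.* d ]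
≅-*-scale c {a} {b} {d} (congruent h) = congruent (subst (c ℤ.* d ∣ℤ_) (lemma c a b) (ℤ∣.*-monoʳ-∣ c h))
  where
  lemma : ∀ c a b → c ℤ.* (a ℤ.- b) ≡ c ℤ.* a ℤ.- c ℤ.* b
  lemma = ring-ℤ

prime-power-≅-cancel : ∀ {p} → Prime p → ∀ c → p ∤ ℤ.∣ c ∣ → ∀ e {a b} → c ℤ.* a ≅ c ℤ.* b [ + (p ^ e) ] → a ≅ b [ + (p ^ e) ]
prime-power-≅-cancel {p} pr c p∤c e {a} {b} (congruent h) = congruent (prime-power-cancelℤ pr c p∤c e (subst (+ (p ^ e) ∣ℤ_) (lemma c a b) h))
  where
  lemma : ∀ c a b → c ℤ.* a ℤ.- c ℤ.* b ≡ c ℤ.* (a ℤ.- b)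
  lemma = ring-ℤ

-- The relation between S and U is multiplied by g^(k+1) - 1 and combined with `S-voronoi`; then
-- p^(δ+s), δ = ord_p (d+1), is cancelled. The lower bound on s makes p^(2s) a multiple of
-- p^(δ+s+o+1).
voronoi : ∀ {p} → Prime p → 2 < p → ∀ k o → p ^ o ∣ suc k → ∀ d {U V : ℤ} →
  (∀ N → (+ suc d ℤ.* V) ℤ.* S (suc k) N ≅ (+ suc d ℤ.* U) ℤ.* + N [ + N ℤ.* + N ]) →
  ∀ {g} → p ∤ g → ∀ s → suc o + ordℕ p (suc d) ≤ s → .{{_ : NonZero (p ^ s)}} →
  ((+ g) ℤ.^ suc k ℤ.- 1ℤ) ℤ.* U ≅ V ℤ.* (+ suc k ℤ.* voronoiSum (p ^ s) g k) [ + (p ^ suc o) ]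
voronoi {p} pr p>2 k o p^o∣k d {U} {V} S≅ {g} p∤g s s₀≤s with p-part pr (suc d) (s≤s z≤n)
... | d′ , d≡ , p∤d′ = prime-power-≅-cancel pr (+ d′) p∤d′ (suc o) (≅-cancelˡ (+ (p ^ (δ + s)))
  {{ℤ.≢-nonZero (λ e → ℕ.≢-nonZero⁻¹ _ {{ℕₚ.m^n≢0 p (δ + s) {{Primality.prime⇒nonZero pr}}}} (ℤₚ.+-injective e))}}
  (≅-trans (≅-reflexive lhs) (≅-trans (≅-trans (≅-sym (≅-*ˡ ((+ g) ℤ.^ suc k ℤ.- 1ℤ) (≅-∣ modulus (S≅ (p ^ s))))) (≅-trans
      (≅-reflexive (rearrange ((+ g) ℤ.^ suc k) (+ suc d) (V) (S (suc k) (p ^ s)))) (≅-∣ modulus′ (≅-*-scale (+ suc d ℤ.* V) difference-form))))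
    (≅-reflexive rhs))))
  where
  δ = ordℕ p (suc d)
  D≡ : + suc d ≡ + (p ^ δ) ℤ.* + d′
  D≡ = trans (cong +_ d≡) (ℤₚ.pos-* (p ^ δ) d′)
  rearrange : ∀ g D V S → (g ℤ.- 1ℤ) ℤ.* ((D ℤ.* V) ℤ.* S) ≡ (D ℤ.* V) ℤ.* (g ℤ.* S ℤ.- S)
  rearrange = ring-ℤ
  difference-form : (+ g) ℤ.^ suc k ℤ.* S (suc k) (p ^ s) ℤ.- S (suc k) (p ^ s) ≅ (+ suc k ℤ.* + (p ^ s)) ℤ.* voronoiSum (p ^ s) g k [ + (p ^ (1 * s + 1 + o)) ]
  difference-form = ≅-trans (≅-+ (S-voronoi pr p>2 p∤g k s o (ℕₚ.<-≤-trans (s≤s z≤n) s₀≤s) p^o∣k) (≅-refl {ℤ.- S (suc k) (p ^ s)}))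
    (≅-reflexive (cancel (S (suc k) (p ^ s)) ((+ suc k ℤ.* + (p ^ s)) ℤ.* voronoiSum (p ^ s) g k)))
    where
    cancel : ∀ a b → (a ℤ.+ b) ℤ.+ ℤ.- a ≡ b
    cancel = ring-ℤ
  modulus : + (p ^ (δ + s)) ℤ.* + (p ^ suc o) ∣ℤ + (p ^ s) ℤ.* + (p ^ s)
  modulus = subst₂ _∣ℤ_ (pos-^-+ p (δ + s) (suc o)) (pos-^-+ p s s) (∣-pos (m≤n⇒p^m∣p^n p
    (ℕₚ.≤-trans (ℕₚ.≤-reflexive (reorder δ s o)) (ℕₚ.+-monoˡ-≤ s s₀≤s))))
    where
    reorder : ∀ δ s o → δ + s + suc o ≡ suc o + δ + s
    reorder = ring-ℕ
  modulus′ : + (p ^ (δ + s)) ℤ.* + (p ^ suc o) ∣ℤ (+ suc d ℤ.* V) ℤ.* + (p ^ (1 * s + 1 + o))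
  modulus′ = subst (λ x → x ∣ℤ (+ suc d ℤ.* V) ℤ.* + (p ^ (1 * s + 1 + o)))
    (trans (sym (pos-^-+ p δ (1 * s + 1 + o))) (trans (cong (λ e → + (p ^ e)) (reorder δ s o)) (pos-^-+ p (δ + s) (suc o))))
    (∣-*-pres (ℤ∣.∣m⇒∣m*n (V) (subst (+ (p ^ δ) ∣ℤ_) (sym D≡) (ℤ∣.∣m⇒∣m*n (+ d′) ℤ∣.∣-refl))) ℤ∣.∣-refl)
    where
    reorder : ∀ δ s o → δ + (1 * s + 1 + o) ≡ δ + s + suc o
    reorder = ring-ℕ
  lhs : + (p ^ (δ + s)) ℤ.* (+ d′ ℤ.* (((+ g) ℤ.^ suc k ℤ.- 1ℤ) ℤ.* U))
    ≡ ((+ g) ℤ.^ suc k ℤ.- 1ℤ) ℤ.* ((+ suc d ℤ.* U) ℤ.* + (p ^ s))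
  lhs = trans (cong (λ x → x ℤ.* (+ d′ ℤ.* (((+ g) ℤ.^ suc k ℤ.- 1ℤ) ℤ.* U))) (pos-^-+ p δ s))
    (trans (lemma (+ (p ^ δ)) (+ (p ^ s)) (+ d′) ((+ g) ℤ.^ suc k) (U))
      (cong (λ x → ((+ g) ℤ.^ suc k ℤ.- 1ℤ) ℤ.* ((x ℤ.* U) ℤ.* + (p ^ s))) (sym D≡)))
    where
    lemma : ∀ a b d g u → (a ℤ.* b) ℤ.* (d ℤ.* ((g ℤ.- 1ℤ) ℤ.* u)) ≡ (g ℤ.- 1ℤ) ℤ.* (((a ℤ.* d) ℤ.* u) ℤ.* b)
    lemma = ring-ℤ
  rhs : (+ suc d ℤ.* V) ℤ.* ((+ suc k ℤ.* + (p ^ s)) ℤ.* voronoiSum (p ^ s) g k)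
    ≡ + (p ^ (δ + s)) ℤ.* (+ d′ ℤ.* (V ℤ.* (+ suc k ℤ.* voronoiSum (p ^ s) g k)))
  rhs = trans (cong (λ x → (x ℤ.* V) ℤ.* ((+ suc k ℤ.* + (p ^ s)) ℤ.* voronoiSum (p ^ s) g k)) D≡)
    (trans (lemma (+ (p ^ δ)) (+ (p ^ s)) (+ d′) (V) (+ suc k) (voronoiSum (p ^ s) g k))
      (cong (λ x → x ℤ.* (+ d′ ℤ.* (V ℤ.* (+ suc k ℤ.* voronoiSum (p ^ s) g k)))) (sym (pos-^-+ p δ s))))
    where
    lemma : ∀ a b d v k w → ((a ℤ.* d) ℤ.* v) ℤ.* ((k ℤ.* b) ℤ.* w) ≡ (a ℤ.* b) ℤ.* (d ℤ.* (v ℤ.* (k ℤ.* w)))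
    lemma = ring-ℤ

↥-↧-coprime : ∀ q → Coprime ℤ.∣ ℚ.↥ q ∣ (ℚ.↧ₙ q)
↥-↧-coprime (ℚ.mkℚ _ _ coprime) = Coprimality.recompute coprime

p∣U⇒p∤V : ∀ {p} → Prime p → ∀ {k} → + p ∣ℤ U k → p ∤ V k
p∣U⇒p∤V pr {k} p∣U p∣V = ℕₚ.<⇒≢ (1<p pr) (sym (↥-↧-coprime (B k) (ℤ∣.∣⇒∣ᵤ p∣U , p∣V)))

-- At the large exponent, p^o cancels against the p-part of the exponent and p divides the Voronoi
-- sum. That sum is unchanged modulo p when the exponent drops by a multiple of p - 1, so p divides
-- (g^(2+r) - 1) Uᵣ, whose first factor is prime to p.
kummer-step : ∀ {q} → Prime (suc q) → ∀ {r c o k′ s g} {Uₖ Uᵣ Vₖ Vᵣ : ℤ} .{{_ : NonZero (suc q ^ s)}} →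
  2 + r + c * q ≡ suc q ^ o * k′ → suc q ∤ k′ → suc q ∤ ℤ.∣ Vₖ ∣ → + (suc q ^ suc o) ∣ℤ Uₖ →
  ((+ g) ℤ.^ (2 + r + c * q) ℤ.- 1ℤ) ℤ.* Uₖ ≅ Vₖ ℤ.* (+ (2 + r + c * q) ℤ.* voronoiSum (suc q ^ s) g (suc r + c * q)) [ + (suc q ^ suc o) ] →
  ((+ g) ℤ.^ (2 + r) ℤ.- 1ℤ) ℤ.* Uᵣ ≅ Vᵣ ℤ.* (+ (2 + r) ℤ.* voronoiSum (suc q ^ s) g (suc r)) [ + (suc q ^ 1) ] →
  ¬ (+ suc q ∣ℤ (+ g) ℤ.^ (2 + r) ℤ.- 1ℤ) → + suc q ∣ℤ Uᵣ
kummer-step {q} pr {r} {c} {o} {k′} {s} {g} {Uₖ} {Uᵣ} {Vₖ} {Vᵣ} k≡ p∤k′ p∤Vₖ p∣U at-k at-r p∤g^r-1 =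
  prime-cancelℤ pr ((+ g) ℤ.^ (2 + r) ℤ.- 1ℤ) (λ h → p∤g^r-1 (ℤ∣.∣ᵤ⇒∣ h))
    (≅-∣-resp (subst (λ x → ((+ g) ℤ.^ (2 + r) ℤ.- 1ℤ) ℤ.* Uᵣ ≅ Vᵣ ℤ.* (+ (2 + r) ℤ.* W (suc r)) [ + x ]) (ℕₚ.*-identityʳ p) at-r)
      (ℤ∣.∣n⇒∣m*n Vᵣ (ℤ∣.∣n⇒∣m*n (+ (2 + r)) p∣Wᵣ)))
  where
  p = suc q
  W : ℕ → ℤ
  W = voronoiSum (p ^ s) g
  k = 2 + r + c * q
  rearrange : ∀ v o k w → v ℤ.* ((o ℤ.* k) ℤ.* w) ≡ o ℤ.* ((v ℤ.* k) ℤ.* w)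
  rearrange = ring-ℤ
  p∣VkW : + (p ^ o) ℤ.* + p ∣ℤ + (p ^ o) ℤ.* ((Vₖ ℤ.* + k′) ℤ.* W (suc r + c * q))
  p∣VkW = subst₂ _∣ℤ_ (trans (cong +_ (ℕₚ.*-comm p (p ^ o))) (ℤₚ.pos-* (p ^ o) p))
    (trans (cong (λ x → Vₖ ℤ.* (x ℤ.* W (suc r + c * q))) (trans (cong +_ k≡) (ℤₚ.pos-* (p ^ o) k′)))
      (rearrange Vₖ (+ (p ^ o)) (+ k′) (W (suc r + c * q))))
    (≅-∣-resp (≅-sym at-k) (ℤ∣.∣n⇒∣m*n ((+ g) ℤ.^ k ℤ.- 1ℤ) p∣U))
  p∣Wₖ : + p ∣ℤ W (suc r + c * q)
  p∣Wₖ = prime-cancelℤ pr (Vₖ ℤ.* + k′) (subst (p ∤_) (sym (ℤₚ.abs-* Vₖ (+ k′))) (prime-∤-* pr p∤Vₖ p∤k′))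
    (ℤ∣.*-cancelˡ-∣ (+ (p ^ o)) {{ℤ.≢-nonZero (λ e → ℕ.≢-nonZero⁻¹ _ {{ℕₚ.m^n≢0 p o}} (ℤₚ.+-injective e))}} p∣VkW)
  p∣Wᵣ : + p ∣ℤ W (suc r)
  p∣Wᵣ = ≅-∣-resp (≅-sym (≅-∑ (p ^ s) (λ j _ → ≅-*ˡ (+ ((g * j) ℕ./ (p ^ s))) (fermat-periodic pr ((g * j) ℕ.% (p ^ s)) r c)))) p∣Wₖ

kummer : ∀ {q} → Prime (suc q) → 2 < suc q → ∀ r c → 2 + r < q → ∀ o k′ →
  2 + r + c * q ≡ suc q ^ o * k′ → suc q ∤ k′ → + (suc q ^ suc o) ∣ℤ U (2 + r + c * q) → + suc q ∣ℤ U (2 + r)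
kummer {q} pr p>2 r c r<q o k′ k≡ p∤k′ p∣U with non-root pr (2 + r) (s≤s z≤n) r<q
... | g , p∤g , p∤g^r-1 = kummer-step pr {r} {c} {o} {k′} {s} {g} {U k} {U (2 + r)} {+ V k} {+ V (2 + r)} {{ℕₚ.m^n≢0 (suc q) s}} k≡ p∤k′
  (p∣U⇒p∤V pr {k} (ℤ∣.∣-trans (∣-pos (ℕ∣.m∣m*n (suc q ^ o))) p∣U)) p∣U
  (voronoi pr p>2 (suc r + c * q) o (subst (suc q ^ o ∣_) (sym k≡) (ℕ∣.m∣m*n k′)) (proj₁ at-k) {U k} {+ V k} (proj₂ at-k) p∤g s (ℕₚ.m≤m+n s₁ s₂) {{ℕₚ.m^n≢0 (suc q) s}})
  (voronoi pr p>2 (suc r) 0 (ℕ∣.1∣ (2 + r)) (proj₁ at-r) {U (2 + r)} {+ V (2 + r)} (proj₂ at-r) p∤g s (ℕₚ.m≤n+m s₂ s₁) {{ℕₚ.m^n≢0 (suc q) s}})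
  p∤g^r-1
  where
  k = 2 + r + c * q
  at-k = power-sum-bernoulli k
  at-r = power-sum-bernoulli (2 + r)
  s₁ = suc o + ordℕ (suc q) (suc (proj₁ at-k))
  s₂ = 1 + ordℕ (suc q) (suc (proj₁ at-r))
  -- The two Voronoi sums are compared term by term, so one modulus p^s must exceed both thresholds.
  s = s₁ + s₂

-- Consequences of the equation

parity : ∀ n → 2 ∣ n ⊎ (∃ λ h → n ≡ 2 * h + 1)
parity zero    = inj₁ (2 ℕ∣.∣0)
parity (suc n) with parity n
... | inj₁ (divides h eq) = inj₂ (h , trans (cong suc (trans eq (ℕₚ.*-comm h 2))) (ℕₚ.+-comm 1 (2 * h)))
... | inj₂ (h , eq)       = inj₁ (divides (suc h) (trans (cong suc eq) (lemma h)))
  where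
  lemma : ∀ h → suc (2 * h + 1) ≡ suc h * 2
  lemma = ring-ℕ

2∤2m+1 : ∀ m → 2 ∤ 2 * m + 1
2∤2m+1 m h with ℕ∣.∣1⇒≡1 (ℕ∣.∣m+n∣m⇒∣n h (ℕ∣.m∣m*n m))
... | ()

pos-^-nonZero : ∀ {p} → Prime p → ∀ e → ℤ.NonZero (+ (p ^ e))
pos-^-nonZero {p} pr e = ℤ.≢-nonZero (λ eq → ℕ.≢-nonZero⁻¹ (p ^ e) {{ℕₚ.m^n≢0 p e {{Primality.prime⇒nonZero pr}}}} (ℤₚ.+-injective eq))

-- Modulo p^(v+1) the sum is n′ p^v times the sum over one period, and the latter is ≡ -1 modulo p
-- for a positive multiple of p - 1 as exponent.
p^∤S : ∀ {q} → Prime (2 + q) → 2 < 2 + q → ∀ c v n′ → 2 + q ∤ n′ →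
  ¬ (+ ((2 + q) ^ suc v) ∣ℤ S (suc c * suc q) (n′ * (2 + q) ^ suc v))
p^∤S {q} pr p>2 c v n′ p∤n′ h = p∤S pr (s≤s z≤n) c (prime-cancelℤ pr (+ n′) p∤n′
  (ℤ∣.*-cancelˡ-∣ (+ (p ^ v)) {{pos-^-nonZero pr v}}
    (subst₂ _∣ℤ_ (trans (cong +_ (ℕₚ.*-comm p (p ^ v))) (ℤₚ.pos-* (p ^ v) p))
      (trans (cong (λ x → x ℤ.* Sₚ) (trans (ℤₚ.pos-* n′ (p ^ v)) (ℤₚ.*-comm (+ n′) (+ (p ^ v))))) (ℤₚ.*-assoc (+ (p ^ v)) (+ n′) Sₚ))
      (≅-∣-resp (≅-sym (S-prime-power pr p>2 (q + c * suc q) n′ v)) h))))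
  where
  p = 2 + q
  Sₚ = S (suc c * suc q) p

p^∣odd² : ∀ {p v m} → p ^ v ∣ 2 * m + 1 → + (p ^ v) ∣ℤ odd m ℤ.* odd m
p^∣odd² {p} {v} {m} h = ℤ∣.∣m⇒∣m*n (odd m) (subst (+ (p ^ v) ∣ℤ_) (pos-odd m) (∣-pos h))

p^∤T : ∀ {q} → Prime (2 + q) → 2 < 2 + q → ∀ c → 2 ∣ suc c * suc q → ∀ v m n′ → 2 * m + 1 ≡ (2 + q) ^ suc v * n′ → 2 + q ∤ n′ →
  ¬ (+ ((2 + q) ^ suc v) ∣ℤ + T (suc c * suc q) m)
p^∤T {q} pr p>2 c 2∣k v m n′ n≡ p∤n′ h = p^∤S pr p>2 c v n′ p∤n′ (subst (λ N → + (p ^ suc v) ∣ℤ S k N) (trans n≡ (ℕₚ.*-comm (p ^ suc v) n′))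
  (prime-power-cancelℤ pr ((+ 2) ℤ.^ k) (subst (p ∤_) (sym (abs-2^ k)) (prime-∤-^ pr (∤-positive (s≤s z≤n) p>2) k)) (suc v)
    (≅-∣-resp (≅-∣ (p^∣odd² {p} {suc v} {m} (subst (p ^ suc v ∣_) (sym n≡) (ℕ∣.m∣m*n n′))) (S-T 2∣k (s≤s z≤n) m)) (ℤ∣.∣n⇒∣m*n (+ 2) h))))
  where
  p = 2 + q
  k = suc c * suc q

-- The counterpart of `p^∤T`: for an exponent not divisible by p - 1 the sum over one period is
-- divisible by p, which completes p^v to p^(v+1).
p^∣T : ∀ {q} → Prime (suc q) → 2 < suc q → ∀ r c → suc r < q → 2 ∣ suc r + c * q → ∀ v m → suc q ^ suc v ∣ 2 * m + 1 →
  + (suc q ^ suc v) ∣ℤ + T (suc r + c * q) m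
p^∣T {q} pr p>2 r c r<q 2∣k v m p^v∣n@(divides n′ n≡) = prime-power-cancelℤ pr (+ 2) (∤-positive (s≤s z≤n) p>2) (suc v)
  (≅-∣-resp (≅-sym (≅-∣ (p^∣odd² {p} {suc v} {m} p^v∣n) (S-T 2∣k (s≤s z≤n) m))) (ℤ∣.∣n⇒∣m*n ((+ 2) ℤ.^ k)
    (subst (λ N → + (p ^ suc v) ∣ℤ S k N) (sym n≡) (≅-∣-resp (S-prime-power pr p>2 (r + c * q) n′ v)
      (subst₂ _∣ℤ_ (trans (sym (ℤₚ.pos-* (p ^ v) p)) (cong +_ (ℕₚ.*-comm (p ^ v) p))) refl
        (∣-*-pres (∣-pos (ℕ∣.n∣m*n n′)) (p∣S pr r c r<q)))))))
  where
  p = suc q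
  k = suc r + c * q

-- By a 3-adic argument: 3 - 1 divides every even exponent, so S_k(3^s) is never divisible by 3^s.
numerator≢0 : ∀ c d {U V : ℤ} → V ≢ 0ℤ →
  (∀ N → (+ suc d ℤ.* V) ℤ.* S (suc c * 2) N ≅ (+ suc d ℤ.* U) ℤ.* + N [ + N ℤ.* + N ]) → U ≢ 0ℤ
numerator≢0 c d {U} {V} V≢0 S≅ refl with p-part prime-3 (ℤ.∣ + suc d ℤ.* V ∣) (ℕₚ.n≢0⇒n>0 (λ e → V≢0 (nonzero (ℤₚ.∣i∣≡0⇒i≡0 e))))
  where
  prime-3 : Prime 3
  prime-3 = from-yes (Primality.prime? 3)
  nonzero : + suc d ℤ.* V ≡ 0ℤ → V ≡ 0ℤ
  nonzero e with ℤₚ.i*j≡0⇒i≡0∨j≡0 (+ suc d) e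
  ... | inj₂ V≡0 = V≡0
... | x , D≡ , 3∤x = p^∤S prime-3 (s≤s (s≤s (s≤s z≤n))) c δ 1 (λ h → contradiction (ℕ∣.∣1⇒≡1 h) (λ ()))
    (subst (λ N → + (3 ^ suc δ) ∣ℤ S (suc c * 2) N) (sym (ℕₚ.+-identityʳ (3 ^ suc δ)))
      (ℤ∣.∣ᵤ⇒∣ (prime-power-cancel prime-3 3∤x (suc δ) (ℕ∣.*-cancelˡ-∣ (3 ^ δ) {{ℕₚ.m^n≢0 3 δ}}
        (subst₂ _∣_ refl abs≡ (ℤ∣.∣⇒∣ᵤ divides-left))))))
  where
  prime-3 : Prime 3
  prime-3 = from-yes (Primality.prime? 3)
  E = + suc d ℤ.* V
  δ = ordℕ 3 ℤ.∣ E ∣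
  N = 3 ^ suc δ
  abs≡ : ℤ.∣ E ℤ.* S (suc c * 2) N ∣ ≡ 3 ^ δ * (x * ℤ.∣ S (suc c * 2) N ∣)
  abs≡ = trans (ℤₚ.abs-* E (S (suc c * 2) N)) (trans (cong (_* ℤ.∣ S (suc c * 2) N ∣) D≡) (ℕₚ.*-assoc (3 ^ δ) x ℤ.∣ S (suc c * 2) N ∣))
  divides-left : + (3 ^ δ * 3 ^ suc δ) ∣ℤ E ℤ.* S (suc c * 2) N
  divides-left = ≅-∣-resp (≅-∣ (subst (+ (3 ^ δ * N) ∣ℤ_) (ℤₚ.pos-* N N) (∣-pos (ℕ∣.*-monoˡ-∣ N (m≤n⇒p^m∣p^n 3 (ℕₚ.n≤1+n δ))))) (S≅ N))
    (ℤ∣.∣m⇒∣m*n (+ N) (subst (+ (3 ^ δ * N) ∣ℤ_) (sym (ℤₚ.*-zeroʳ (+ suc d))) (dividesℤ 0ℤ refl)))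

U-even≢0 : ∀ {k} → 0 < k → 2 ∣ k → U k ≢ 0ℤ
U-even≢0 k>0 (divides zero refl)    = contradiction k>0 (λ ())
U-even≢0 k>0 (divides (suc c) refl) = numerator≢0 c (proj₁ (power-sum-bernoulli k)) {U k} {+ V k} (λ ()) (proj₂ (power-sum-bernoulli k))
  where
  k = suc c * 2

-- Size estimates and the p-part of T_k(m)

^-distribʳ-*ℕ : ∀ m n k → (m * n) ^ k ≡ m ^ k * n ^ k
^-distribʳ-*ℕ m n zero    = refl
^-distribʳ-*ℕ m n (suc k) = trans (cong (m * n *_) (^-distribʳ-*ℕ m n k)) (lemma m n (m ^ k) (n ^ k))
  where
  lemma : ∀ a b c d → a * b * (c * d) ≡ a * c * (b * d)
  lemma = ring-ℕ

-- The last summand (n - 2)^k of T_k(m), n = 2m + 1 ≥ 5, already forces a ≤ (n/(n - 2))^k ≤ (5/3)^k.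
a*3^k≤5^k : ∀ {a m k} → 1 < m → a * T k m ≡ (2 * m + 1) ^ k → a * 3 ^ k ≤ 5 ^ k
a*3^k≤5^k {a} {suc m} {k} (s≤s m>0) eq = ℕₚ.*-cancelʳ-≤ (a * 3 ^ k) (5 ^ k) (l ^ k) {{ℕ.>-nonZero (ℕₚ.m^n>0 l {{ℕ.>-nonZero (ℕₚ.m≤n+m 1 (2 * m))}} k)}} (begin
  a * 3 ^ k * l ^ k                 ≡⟨ swap a (3 ^ k) (l ^ k) ⟩
  3 ^ k * (a * l ^ k)               ≤⟨ ℕₚ.*-monoʳ-≤ (3 ^ k) (ℕₚ.*-monoʳ-≤ a (ℕₚ.m≤n+m (l ^ k) (T k m))) ⟩
  3 ^ k * (a * T k (suc m))         ≡⟨ cong (3 ^ k *_) eq ⟩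
  3 ^ k * (2 * suc m + 1) ^ k       ≡⟨ ^-distribʳ-*ℕ 3 (2 * suc m + 1) k ⟨
  (3 * (2 * suc m + 1)) ^ k         ≤⟨ ℕₚ.^-monoˡ-≤ k bound ⟩
  (5 * l) ^ k                       ≡⟨ ^-distribʳ-*ℕ 5 l k ⟩
  5 ^ k * l ^ k                     ∎)
  where
  open ℕₚ.≤-Reasoning
  l = 2 * m + 1
  swap : ∀ a b c → a * b * c ≡ b * (a * c)
  swap = ring-ℕ
  expand : ∀ m → 3 * (2 * suc m + 1) ≡ 6 * m + 5 + 4 * 1
  expand = ring-ℕ
  collect : ∀ m → 6 * m + 5 + 4 * m ≡ 5 * (2 * m + 1)
  collect = ring-ℕ
  bound : 3 * (2 * suc m + 1) ≤ 5 * l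
  bound = begin
    3 * (2 * suc m + 1)   ≡⟨ expand m ⟩
    6 * m + 5 + 4 * 1     ≤⟨ ℕₚ.+-monoʳ-≤ (6 * m + 5) (ℕₚ.*-monoʳ-≤ 4 m>0) ⟩
    6 * m + 5 + 4 * m     ≡⟨ collect m ⟩
    5 * l                 ∎

-- Otherwise p^x 3^k ≥ 9^k > 5^k.
p^x*3^k≤5^k⇒x<k : ∀ {p x k} → 2 < p → 0 < k → p ^ x * 3 ^ k ≤ 5 ^ k → x < k
p^x*3^k≤5^k⇒x<k {p} {x} {k} p>2 k>0 h = ℕₚ.≰⇒> λ k≤x → ℕₚ.<-irrefl refl (begin-strict
  5 ^ k           <⟨ ℕₚ.^-monoˡ-< k {{ℕ.>-nonZero k>0}} (s≤s (s≤s (s≤s (s≤s (s≤s (s≤s z≤n)))))) ⟩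
  (3 * 3) ^ k     ≡⟨ ^-distribʳ-*ℕ 3 3 k ⟩
  3 ^ k * 3 ^ k   ≤⟨ ℕₚ.*-monoˡ-≤ (3 ^ k) (ℕₚ.≤-trans (ℕₚ.^-monoʳ-≤ 3 k≤x) (ℕₚ.^-monoˡ-≤ x p>2)) ⟩
  p ^ x * 3 ^ k   ≤⟨ h ⟩
  5 ^ k           ∎)
  where open ℕₚ.≤-Reasoning

-- Otherwise cubing gives 125^k ≥ p^(3x) 27^k ≥ 135^k.
p^x*3^k≤5^k⇒3x<k : ∀ {p x k} → 4 < p → 0 < k → p ^ x * 3 ^ k ≤ 5 ^ k → x * 3 < k
p^x*3^k≤5^k⇒3x<k {p} {x} {k} p>4 k>0 h = ℕₚ.≰⇒> λ k≤3x → ℕₚ.<-irrefl refl (begin-strict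
  125 ^ k                <⟨ ℕₚ.^-monoˡ-< k {{ℕ.>-nonZero k>0}} (ℕₚ.m<m+n 125 {10} (s≤s z≤n)) ⟩
  (5 * 27) ^ k           ≡⟨ ^-distribʳ-*ℕ 5 27 k ⟩
  5 ^ k * 27 ^ k         ≤⟨ ℕₚ.*-monoˡ-≤ (27 ^ k) (ℕₚ.≤-trans (ℕₚ.^-monoʳ-≤ 5 k≤3x) (ℕₚ.^-monoˡ-≤ (x * 3) p>4)) ⟩
  p ^ (x * 3) * 27 ^ k   ≡⟨ cong₂ _*_ (sym (ℕₚ.^-*-assoc p x 3)) (cube 3) ⟩
  (p ^ x) ^ 3 * (3 ^ k) ^ 3   ≡⟨ ^-distribʳ-*ℕ (p ^ x) (3 ^ k) 3 ⟨
  (p ^ x * 3 ^ k) ^ 3    ≤⟨ ℕₚ.^-monoˡ-≤ 3 h ⟩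
  (5 ^ k) ^ 3            ≡⟨ cube 5 ⟨
  125 ^ k                ∎)
  where
  open ℕₚ.≤-Reasoning
  cube : ∀ b → (b ^ 3) ^ k ≡ (b ^ k) ^ 3
  cube b = trans (ℕₚ.^-*-assoc b 3 k) (trans (cong (b ^_) (ℕₚ.*-comm 3 k)) (sym (ℕₚ.^-*-assoc b k 3)))

5*e≤5^e : ∀ e → 5 * suc e ≤ 5 ^ suc e
5*e≤5^e zero    = ℕₚ.≤-refl
5*e≤5^e (suc e) = ℕₚ.*-monoʳ-≤ 5 (begin
  suc (suc e)           ≤⟨ ℕₚ.m≤m+n (suc (suc e)) (3 + 4 * e) ⟩
  suc (suc e) + (3 + 4 * e) ≡⟨ lemma e ⟩
  5 * suc e             ≤⟨ 5*e≤5^e e ⟩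
  5 ^ suc e             ∎)
  where
  open ℕₚ.≤-Reasoning
  lemma : ∀ e → suc (suc e) + (3 + 4 * e) ≡ 5 * suc e
  lemma = ring-ℕ

-- After 3v is set aside, (1+k) v has to cover o + x. From 5o ≤ 4 + k and 3x + 1 ≤ 4 + k follows
-- 15(o+x) + 5 ≤ 8(4+k) < 15(2+k) + 5.
exponent-bound : ∀ {p o x} k v → 4 < p → p ^ o ∣ 4 + k → x * 3 < 4 + k → 0 < v → 3 * v + o + x ≤ (4 + k) * v
exponent-bound {p} {o} {x} k v p>4 p^o∣k 3x<k v>0 = begin
  3 * v + o + x           ≡⟨ ℕₚ.+-assoc (3 * v) o x ⟩
  3 * v + (o + x)         ≤⟨ ℕₚ.+-monoʳ-≤ (3 * v) (ℕₚ.≤-trans o+x≤1+k (ℕₚ.m≤m*n (1 + k) v {{ℕ.>-nonZero v>0}})) ⟩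
  3 * v + (1 + k) * v     ≡⟨ ℕₚ.*-distribʳ-+ v 3 (1 + k) ⟨
  (4 + k) * v             ∎
  where
  open ℕₚ.≤-Reasoning
  5o≤k : ∀ o → p ^ o ∣ 4 + k → 5 * o ≤ 4 + k
  5o≤k zero    _ = z≤n
  5o≤k (suc o) h = ℕₚ.≤-trans (5*e≤5^e o) (ℕₚ.≤-trans (ℕₚ.^-monoˡ-≤ (suc o) p>4) (ℕ∣.∣⇒≤ h))
  lhs : ∀ o x → 3 * (5 * o) + 5 * suc (x * 3) ≡ 15 * (o + x) + 5
  lhs = ring-ℕ
  rhs : ∀ k → 3 * (4 + k) + 5 * (4 + k) + 3 + 7 * k ≡ 15 * (2 + k) + 5
  rhs = ring-ℕ
  combined : 15 * (o + x) + 5 < 15 * (2 + k) + 5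
  combined = begin-strict
    15 * (o + x) + 5                      ≡⟨ lhs o x ⟨
    3 * (5 * o) + 5 * suc (x * 3)         ≤⟨ ℕₚ.+-mono-≤ (ℕₚ.*-monoʳ-≤ 3 (5o≤k o p^o∣k)) (ℕₚ.*-monoʳ-≤ 5 3x<k) ⟩
    3 * (4 + k) + 5 * (4 + k)             <⟨ ℕₚ.m<m+n (3 * (4 + k) + 5 * (4 + k)) {3} (s≤s z≤n) ⟩
    3 * (4 + k) + 5 * (4 + k) + 3         ≤⟨ ℕₚ.m≤m+n (3 * (4 + k) + 5 * (4 + k) + 3) (7 * k) ⟩
    3 * (4 + k) + 5 * (4 + k) + 3 + 7 * k ≡⟨ rhs k ⟩
    15 * (2 + k) + 5                      ∎
  o+x≤1+k : o + x ≤ 1 + k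
  o+x≤1+k = ℕₚ.≤-pred (ℕₚ.*-cancelˡ-< 15 (o + x) (2 + k) (ℕₚ.+-cancelʳ-< 5 (15 * (o + x)) (15 * (2 + k)) combined))

p^∣T-of-equation : ∀ {p} → Prime p → ∀ {a t n k v e a′} x → a * t ≡ n ^ k → p ^ v ∣ n → a ≡ p ^ x * a′ → p ∤ a′ →
  e + x ≤ k * v → + (p ^ e) ∣ℤ + t
p^∣T-of-equation {p} pr {a} {t} {n} {k} {v} {e} {a′} x eq (divides n′ n≡) a≡ p∤a′ e≤ =
  ∣-pos (prime-power-cancel pr p∤a′ e (ℕ∣.*-cancelˡ-∣ (p ^ x) {{ℕₚ.m^n≢0 p x {{Primality.prime⇒nonZero pr}}}}
    (subst₂ _∣_ (trans (cong (p ^_) (ℕₚ.+-comm e x)) (ℕₚ.^-distribˡ-+-* p x e))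
      (trans (sym eq) (trans (cong (_* t) a≡) (ℕₚ.*-assoc (p ^ x) a′ t)))
      (ℕ∣.∣-trans (m≤n⇒p^m∣p^n p e≤) p^kv∣n^k))))
  where
  p^kv∣n^k : p ^ (k * v) ∣ n ^ k
  p^kv∣n^k = subst₂ _∣_ (trans (ℕₚ.^-*-assoc p v k) (cong (p ^_) (ℕₚ.*-comm v k)))
    (trans (sym (^-distribʳ-*ℕ n′ (p ^ v) k)) (cong (_^ k) (sym n≡))) (ℕ∣.n∣m*n (n′ ^ k))

T₂-closed : ∀ m → 3 * T 2 (suc m) ≡ suc m * (2 * m + 1) * (2 * suc m + 1)
T₂-closed zero    = refl
T₂-closed (suc m) = trans (ℕₚ.*-distribˡ-+ 3 (T 2 (suc m)) ((2 * suc m + 1) ^ 2))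
  (trans (cong (_+ 3 * (2 * suc m + 1) ^ 2) (T₂-closed m)) (lemma m))
  where
  lemma : ∀ m → suc m * (2 * m + 1) * (2 * suc m + 1) + 3 * ((2 * suc m + 1) * ((2 * suc m + 1) * 1))
    ≡ suc (suc m) * (2 * suc m + 1) * (2 * suc (suc m) + 1)
  lemma = ring-ℕ

-- The closed form of T_2 reduces the equation to 3(2m+1) = a m (2m-1). For m = 2 and m = 3 this
-- fails by divisibility (6 and 15, 15 and 21), for m ≥ 4 by size.
k≢2 : ∀ {a m} → 1 ≤ a → 1 < m → a * T 2 m ≢ (2 * m + 1) ^ 2
k≢2 {a} {suc m} a>0 (s≤s m>0) eq = cases m m>0 reduced
  where
  n = 2 * suc m + 1
  swap : ∀ a t → 3 * (a * t) ≡ a * (3 * t)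
  swap = ring-ℕ
  assoc : ∀ a b n → a * (b * n) ≡ a * b * n
  assoc = ring-ℕ
  reduced : 3 * n ≡ a * (suc m * (2 * m + 1))
  reduced = ℕₚ.*-cancelʳ-≡ (3 * n) (a * (suc m * (2 * m + 1))) n (begin
    3 * n * n                          ≡⟨ square n ⟩
    3 * n ^ 2                          ≡⟨ cong (3 *_) eq ⟨
    3 * (a * T 2 (suc m))              ≡⟨ swap a (T 2 (suc m)) ⟩
    a * (3 * T 2 (suc m))              ≡⟨ cong (a *_) (T₂-closed m) ⟩
    a * (suc m * (2 * m + 1) * n)      ≡⟨ assoc a (suc m * (2 * m + 1)) n ⟩
    a * (suc m * (2 * m + 1)) * n      ∎)
    where
    open ≡-Reasoning
    square : ∀ n → 3 * n * n ≡ 3 * (n * (n * 1))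
    square = ring-ℕ
  cases : ∀ m → 0 < m → 3 * (2 * suc m + 1) ≡ a * (suc m * (2 * m + 1)) → ⊥
  cases (suc zero)             _ e = from-no (6 ∣? 15) (divides a e)
  cases (suc (suc zero))       _ e = from-no (15 ∣? 21) (divides a e)
  cases (suc (suc (suc m)))    _ e = ℕₚ.<⇒≢ (begin-strict
    3 * (2 * (4 + m) + 1)                ≡⟨ expand m ⟩
    27 + 6 * m                           <⟨ ℕₚ.m<m+n (27 + 6 * m) {suc (m * (2 * m + 9))} (s≤s z≤n) ⟩
    27 + 6 * m + suc (m * (2 * m + 9))   ≡⟨ collect m ⟩
    (4 + m) * (2 * (3 + m) + 1)          ≤⟨ ℕₚ.m≤n*m ((4 + m) * (2 * (3 + m) + 1)) a {{ℕ.>-nonZero a>0}} ⟩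
    a * ((4 + m) * (2 * (3 + m) + 1))    ∎) e
    where
    open ℕₚ.≤-Reasoning
    expand : ∀ m → 3 * (2 * (4 + m) + 1) ≡ 27 + 6 * m
    expand = ring-ℕ
    collect : ∀ m → 27 + 6 * m + suc (m * (2 * m + 9)) ≡ (4 + m) * (2 * (3 + m) + 1)
    collect = ring-ℕ

-- The valuation of B_k/k

≃-cross : ∀ q {r} → ℚ.toℚᵘ q ℚᵘ.≃ r → ℚ.↥ q ℤ.* ℚᵘ.↧ r ≡ ℚᵘ.↥ r ℤ.* ℚ.↧ q
≃-cross record{} (ℚᵘ.*≡* eq) = eq

divℕ-cross : ∀ b k → ℚ.↥ (divℕ b (suc k)) ℤ.* (ℚ.↧ b ℤ.* + suc k) ≡ ℚ.↥ b ℤ.* ℚ.↧ (divℕ b (suc k))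
divℕ-cross b@record{} k = trans
  (≃-cross (divℕ b (suc k)) (ℚᵘₚ.≃-trans (ℚₚ.toℚᵘ-homo-* b (+ 1 ℚ./ suc k)) (ℚᵘₚ.*-congˡ {ℚ.toℚᵘ b} (ℚₚ.toℚᵘ-fromℚᵘ (ℚᵘ.mkℚᵘ (+ 1) k)))))
  (cong (λ x → x ℤ.* ℚ.↧ (divℕ b (suc k))) (ℤₚ.*-identityʳ (ℚ.↥ b)))

-- The reduced fraction is reached through X w k = u Y alone: p^(e+o) divides u and p^y divides Y,
-- so after the p^o of k is cancelled p^(e+y) divides X. That b is nonzero matters because `ordℕ` is
-- 0 at 0.
ordℚ-divℕ : ∀ {p} → Prime p → ∀ {k k′ o e} b → 0 < k → k ≡ p ^ o * k′ → p ∤ k′ → p ∤ ℚ.↧ₙ b → ℚ.↥ b ≢ 0ℤ →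
  + (p ^ (e + o)) ∣ℤ ℚ.↥ b → + e ℤ.≤ ordℚ p (divℕ b k)
ordℚ-divℕ {p} pr {suc k} {k′} {o} {e} b _ k≡ p∤k′ p∤V U≢0 p∣U = ℤₚ.≤-trans
  (ℤₚ.≤-reflexive (add-cancel (+ e) (+ y))) (ℤₚ.+-monoˡ-≤ (ℤ.- (+ y)) (ℤₚ.≤-trans (ℤₚ.≤-reflexive (sym (ℤₚ.pos-+ e y)))
    (ℤ.+≤+ (ord-maximal pr (e + y) (ℕₚ.n≢0⇒n>0 numerator≢0′) p^∣X))))
  where
  X = ℤ.∣ ℚ.↥ (divℕ b (suc k)) ∣
  Y = ℚ.↧ₙ (divℕ b (suc k))
  u = ℤ.∣ ℚ.↥ b ∣
  w = ℚ.↧ₙ b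
  y = ordℕ p Y
  add-cancel : ∀ e y → e ≡ (e ℤ.+ y) ℤ.- y
  add-cancel = ring-ℤ
  cross : X * (w * suc k) ≡ u * Y
  cross = trans (cong (X *_) (sym (ℤₚ.abs-* (ℚ.↧ b) (+ suc k)))) (trans (sym (ℤₚ.abs-* (ℚ.↥ (divℕ b (suc k))) (ℚ.↧ b ℤ.* + suc k)))
    (trans (cong ℤ.∣_∣ (divℕ-cross b k)) (ℤₚ.abs-* (ℚ.↥ b) (ℚ.↧ (divℕ b (suc k))))))
  numerator≢0′ : X ≢ 0
  numerator≢0′ X≡0 with ℕₚ.m*n≡0⇒m≡0∨n≡0 u (trans (sym cross) (cong (_* (w * suc k)) X≡0))
  ... | inj₁ u≡0 = U≢0 (ℤₚ.∣i∣≡0⇒i≡0 u≡0)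
  regroup : ∀ X w P k′ → X * (w * (P * k′)) ≡ P * (w * k′ * X)
  regroup = ring-ℕ
  exponents : p ^ (e + o) * p ^ y ≡ p ^ o * p ^ (e + y)
  exponents = trans (sym (ℕₚ.^-distribˡ-+-* p (e + o) y)) (trans (cong (p ^_) (swap e o y)) (ℕₚ.^-distribˡ-+-* p o (e + y)))
    where
    swap : ∀ e o y → e + o + y ≡ o + (e + y)
    swap = ring-ℕ
  p^∣X : p ^ (e + y) ∣ X
  p^∣X = prime-power-cancel pr (prime-∤-* pr p∤V p∤k′) (e + y) (ℕ∣.*-cancelˡ-∣ (p ^ o) {{ℕₚ.m^n≢0 p o {{Primality.prime⇒nonZero pr}}}}
    (subst₂ _∣_ exponents (trans (sym cross) (trans (cong (λ z → X * (w * z)) k≡) (regroup X w (p ^ o) k′)))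
      (ℕ∣.*-pres-∣ (ℤ∣.∣⇒∣ᵤ p∣U) (p^ord∣ Y p Y))))

-- Irregular pairs of small index and residues modulo p - 1

exceptional : List ℕ
exceptional = 0 ∷ 2 ∷ 4 ∷ 6 ∷ 8 ∷ 10 ∷ 14 ∷ []

∤1 : ∀ {p} → Prime p → p ∤ 1
∤1 pr h = ℕₚ.<⇒≢ (1<p pr) (sym (ℕ∣.∣1⇒≡1 h))

∣prime⇒≡ : ∀ {p ℓ} → Prime p → Prime ℓ → p ∣ ℓ → p ≡ ℓ
∣prime⇒≡ pr prℓ h with Primality.prime⇒irreducible prℓ h
... | inj₁ refl = contradiction pr Primality.¬prime[1]
... | inj₂ p≡ℓ  = p≡ℓ

-- U_r is 1 or -1 for r = 0, 2, 4, 6, 8. As U_10 = 5 and U_14 = 7, the last two indices leave only p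
-- = 5 and p = 7, too small for r ≤ p - 3.
exceptional-regular : ∀ {r p} → IrregularPair r p → ¬ (r ∈ exceptional)
exceptional-regular (pr , _ , _ , _ , h) (here refl) = ∤1 pr h
exceptional-regular (pr , _ , _ , _ , h) (there (here refl)) = ∤1 pr h
exceptional-regular (pr , _ , _ , _ , h) (there (there (here refl))) = ∤1 pr h
exceptional-regular (pr , _ , _ , _ , h) (there (there (there (here refl)))) = ∤1 pr h
exceptional-regular (pr , _ , _ , _ , h) (there (there (there (there (here refl))))) = ∤1 pr h
exceptional-regular (pr , _ , _ , r≤ , h) (there (there (there (there (there (here refl)))))) with ∣prime⇒≡ pr (from-yes (Primality.prime? 5)) h
... | refl = from-no (10 ℕ.≤? 2) r≤
exceptional-regular (pr , _ , _ , r≤ , h) (there (there (there (there (there (there (here refl))))))) with ∣prime⇒≡ pr (from-yes (Primality.prime? 7)) h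
... | refl = from-no (14 ℕ.≤? 4) r≤

irregular-index≥12 : ∀ {r p} → IrregularPair r p → 12 ≤ r
irregular-index≥12 {r} pair@(_ , _ , divides q refl , _) = ℕₚ.≮⇒≥ λ r<12 →
  exceptional-regular pair (small q (ℕₚ.*-cancelʳ-< 2 q 6 r<12))
  where
  small : ∀ q → q < 6 → q * 2 ∈ exceptional
  small 0 _ = here refl
  small 1 _ = there (here refl)
  small 2 _ = there (there (here refl))
  small 3 _ = there (there (there (here refl)))
  small 4 _ = there (there (there (there (here refl))))
  small 5 _ = there (there (there (there (there (here refl)))))
  small (suc (suc (suc (suc (suc (suc _)))))) (s≤s (s≤s (s≤s (s≤s (s≤s (s≤s ()))))))

∈exceptional⇒≤14 : ∀ {r} → r ∈ exceptional → r ≤ 14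
∈exceptional⇒≤14 (here refl) = z≤n
∈exceptional⇒≤14 (there (here refl)) = from-yes (2 ℕ.≤? 14)
∈exceptional⇒≤14 (there (there (here refl))) = from-yes (4 ℕ.≤? 14)
∈exceptional⇒≤14 (there (there (there (here refl)))) = from-yes (6 ℕ.≤? 14)
∈exceptional⇒≤14 (there (there (there (there (here refl))))) = from-yes (8 ℕ.≤? 14)
∈exceptional⇒≤14 (there (there (there (there (there (here refl)))))) = from-yes (10 ℕ.≤? 14)
∈exceptional⇒≤14 (there (there (there (there (there (there (here refl))))))) = ℕₚ.≤-refl

≡mod-sym : ∀ {a b n} → a ≡ b [mod n ] → b ≡ a [mod n ]
≡mod-sym {a} {b} {n} h = subst (n ∣_) (trans (sym (ℤₚ.∣-i∣≡∣i∣ (+ a ℤ.- + b))) (cong ℤ.∣_∣ (lemma (+ a) (+ b)))) h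
  where
  lemma : ∀ a b → ℤ.- (a ℤ.- b) ≡ b ℤ.- a
  lemma = ring-ℤ

≡mod-trans : ∀ {a b c n} → a ≡ b [mod n ] → b ≡ c [mod n ] → a ≡ c [mod n ]
≡mod-trans {a} {b} {c} {n} h h′ = ℤ∣.∣⇒∣ᵤ (subst (+ n ∣ℤ_) (lemma (+ a) (+ b) (+ c))
  (ℤ∣.∣m∣n⇒∣m+n (ℤ∣.∣ᵤ⇒∣ {+ n} {+ a ℤ.- + b} h) (ℤ∣.∣ᵤ⇒∣ {+ n} {+ b ℤ.- + c} h′)))
  where
  lemma : ∀ a b c → (a ℤ.- b) ℤ.+ (b ℤ.- c) ≡ a ℤ.- c
  lemma = ring-ℤ

≡mod-≤ : ∀ {a b n} → a < n → b ≤ a → a ≡ b [mod n ] → a ≡ b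
≡mod-≤ {a} {b} {n} a<n b≤a h with a ∸ b in eq | subst (n ∣_) (cong ℤ.∣_∣ (trans (ℤₚ.m-n≡m⊖n a b) (ℤₚ.⊖-≥ b≤a))) h
... | zero  | _  = ℕₚ.≤-antisym (ℕₚ.m∸n≡0⇒m≤n eq) b≤a
... | suc d | h′ = contradiction (ℕₚ.≤-<-trans (ℕₚ.≤-trans (ℕₚ.≤-reflexive (sym eq)) (ℕₚ.m∸n≤m a b)) a<n) (ℕₚ.≤⇒≯ (ℕ∣.∣⇒≤ h′))

≡mod-< : ∀ {a b n} → a < n → b < n → a ≡ b [mod n ] → a ≡ b
≡mod-< {a} {b} a<n b<n h with ℕₚ.≤-total b a
... | inj₁ b≤a = ≡mod-≤ a<n b≤a h
... | inj₂ a≤b = sym (≡mod-≤ b<n a≤b (≡mod-sym {a} {b} h))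

r+cq≡r : ∀ r c q → (r + c * q) ≡ r [mod q ]
r+cq≡r r c q = ℤ∣.∣⇒∣ᵤ (dividesℤ (+ c) (trans (cong (λ x → x ℤ.- + r) (trans (ℤₚ.pos-+ r (c * q)) (cong (λ x → + r ℤ.+ x) (ℤₚ.pos-* c q))))
  (lemma (+ r) (+ c ℤ.* + q))))
  where
  lemma : ∀ r x → (r ℤ.+ x) ℤ.- r ≡ x
  lemma = ring-ℤ

-- If s < p - 1, the residues r and s coincide. Otherwise p - 1 ≤ s ≤ 14, whereas 12 ≤ r ≤ p - 3 and
-- p - 3 = q - 1 with q ≥ 14, which leaves only p = 15.
not-exceptional-mod : ∀ {k r q} → IrregularPair r (suc q) → r < q → k ≡ r [mod q ] → ∀ s → s ∈ exceptional → ¬ (k ≡ s [mod q ])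
not-exceptional-mod {k} {r} {q} pair r<q k≡r s s∈ k≡s with ℕₚ.<-≤-connex s q
... | inj₁ s<q = exceptional-regular pair (subst (_∈ exceptional)
  (sym (≡mod-< r<q s<q (≡mod-trans {r} {k} {s} (≡mod-sym {k} {r} k≡r) k≡s))) s∈)
... | inj₂ q≤s = from-no (Primality.prime? 15) (subst (λ x → Prime (suc x)) q≡14 (proj₁ pair))
  where
  14≤q : 14 ≤ q
  14≤q = even-above (proj₂ (proj₂ pair)) (irregular-index≥12 pair)
    where
    even-above : 2 ∣ r × r ≤ suc q ∸ 3 × (+ suc q) ℤᵘ.∣ U r → 12 ≤ r → 14 ≤ q
    even-above (_ , r≤ , _) 12≤r = ℕₚ.≤-trans (ℕₚ.+-monoˡ-≤ 2 12≤r) (ℕₚ.≤-trans (ℕₚ.+-monoˡ-≤ 2 r≤)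
      (ℕₚ.≤-reflexive (ℕₚ.m∸n+n≡m {q} {2} (ℕₚ.≤-trans (s≤s (s≤s z≤n)) (ℕₚ.≤-trans 12≤r (ℕₚ.<⇒≤ r<q))))))
  q≡14 : q ≡ 14
  q≡14 = ℕₚ.≤-antisym (ℕₚ.≤-trans q≤s (∈exceptional⇒≤14 s∈)) 14≤q

-- The argument for one prime divisor p of 2m + 1

module Solution {q : ℕ} (pr : Prime (2 + q)) {a m k v n′ x a′ : ℕ} (m>1 : 1 < m) (a>0 : 0 < a) (k>0 : 0 < k) (2∣k : 2 ∣ k)
  (equation : a * T k m ≡ (2 * m + 1) ^ k) (n≡ : 2 * m + 1 ≡ (2 + q) ^ suc v * n′) (p∤n′ : 2 + q ∤ n′)
  (a≡ : a ≡ (2 + q) ^ x * a′) (p∤a′ : 2 + q ∤ a′) where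

  -- With this numbering p - 1 is `suc q`, and the exponent of p in 2m + 1 is `suc v`, hence
  -- positive.
  p : ℕ
  p = 2 + q

  p∣n : p ∣ 2 * m + 1
  p∣n = subst (p ∣_) (sym n≡) (ℕ∣.∣m⇒∣m*n n′ (ℕ∣.m∣m*n (p ^ v)))

  p^v∣n : p ^ suc v ∣ 2 * m + 1
  p^v∣n = subst (p ^ suc v ∣_) (sym n≡) (ℕ∣.m∣m*n n′)

  2∤p : 2 ∤ p
  2∤p h = 2∤2m+1 m (ℕ∣.∣-trans h p∣n)

  p-odd : ∃ λ h → p ≡ 2 * h + 1
  p-odd with parity p
  ... | inj₁ 2∣p = contradiction 2∣p 2∤p
  ... | inj₂ odd = odd

  2∣q+1 : 2 ∣ suc q
  2∣q+1 = divides (proj₁ p-odd) (trans (ℕₚ.suc-injective (trans (proj₂ p-odd) (ℕₚ.+-comm _ 1))) (ℕₚ.*-comm 2 (proj₁ p-odd)))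

  p>2 : 2 < p
  p>2 = ℕₚ.≤∧≢⇒< (s≤s (s≤s z≤n)) (λ 2≡p → 2∤p (subst (2 ∣_) 2≡p ℕ∣.∣-refl))

  p^x*3^k≤5^k : p ^ x * 3 ^ k ≤ 5 ^ k
  p^x*3^k≤5^k = ℕₚ.≤-trans (ℕₚ.*-monoˡ-≤ (3 ^ k) (ℕ∣.∣⇒≤ {{ℕ.>-nonZero a>0}} (subst (p ^ x ∣_) (sym a≡) (ℕ∣.m∣m*n a′)))) (a*3^k≤5^k {a} {m} {k} m>1 equation)

  p^e∣T : ∀ e → e + x ≤ k * suc v → + (p ^ e) ∣ℤ + T k m
  p^e∣T e = p^∣T-of-equation pr {a} {T k m} {2 * m + 1} {k} {suc v} x equation p^v∣n a≡ p∤a′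

  -- Only x < k is used, a bound available for p = 3, which is excluded afterwards by means of it.
  v+x≤kv : suc v + x ≤ k * suc v
  v+x≤kv = bound k (p^x*3^k≤5^k⇒x<k {p} {x} p>2 k>0 p^x*3^k≤5^k)
    where
    bound : ∀ k → x < k → suc v + x ≤ k * suc v
    bound (suc k) (s≤s x≤k) = ℕₚ.+-monoʳ-≤ (suc v) (ℕₚ.≤-trans x≤k (ℕₚ.m≤m*n k (suc v)))

  p-1∤k : ∀ c → k ≢ c * suc q
  p-1∤k zero    k≡ = ℕₚ.<⇒≢ k>0 (sym k≡)
  p-1∤k (suc c) k≡ = p^∤T pr p>2 c (subst (2 ∣_) k≡ 2∣k) v m n′ n≡ p∤n′
    (subst (λ j → + (p ^ suc v) ∣ℤ + T j m) k≡ (p^e∣T (suc v) v+x≤kv))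

  p>4 : 4 < p
  p>4 = ℕₚ.≤∧≢⇒< (ℕₚ.≤∧≢⇒< p>2 λ 3≡p → excluded 2∣k (ℕₚ.suc-injective (ℕₚ.suc-injective 3≡p)))
    (λ 4≡p → 2∤p (subst (2 ∣_) 4≡p (divides 2 refl)))
    where
    excluded : 2 ∣ k → 1 ≡ q → ⊥
    excluded (divides c k≡) 1≡q = p-1∤k c (trans k≡ (cong (λ q → c * suc q) 1≡q))

  k≥4 : ∃ λ k₀ → k ≡ 4 + k₀
  k≥4 = at-least-four 2∣k
    where
    at-least-four : 2 ∣ k → ∃ λ k₀ → k ≡ 4 + k₀
    at-least-four (divides zero k≡)          = contradiction (sym k≡) (ℕₚ.<⇒≢ k>0)
    at-least-four (divides (suc zero) k≡)    = contradiction (subst (λ k → a * T k m ≡ (2 * m + 1) ^ k) k≡ equation) (k≢2 a>0 m>1)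
    at-least-four (divides (suc (suc c)) k≡) = c * 2 , k≡

  k₀ = proj₁ k≥4
  k≡4+k₀ = proj₂ k≥4
  o = ordℕ p k

  p^o∣k₀ : p ^ o ∣ 4 + k₀
  p^o∣k₀ = subst (p ^ o ∣_) k≡4+k₀ (p^ord∣ k p k)

  2∣4+k₀ : 2 ∣ 4 + k₀
  2∣4+k₀ = subst (2 ∣_) k≡4+k₀ 2∣k

  p^3v+o∣T : + (p ^ (3 * suc v + o)) ∣ℤ + T k m
  p^3v+o∣T = p^e∣T (3 * suc v + o) (subst (λ j → 3 * suc v + o + x ≤ j * suc v) (sym k≡4+k₀)
    (exponent-bound k₀ (suc v) p>4 p^o∣k₀ (subst (x * 3 <_) k≡4+k₀ (p^x*3^k≤5^k⇒3x<k {p} {x} p>4 k>0 p^x*3^k≤5^k)) (s≤s z≤n)))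

  numerator : ∀ u → u ≤ suc v → (∀ m → p ^ suc v ∣ 2 * m + 1 → + (p ^ u) ∣ℤ + T (2 + k₀) m) → + (p ^ (suc v + u + o)) ∣ℤ U k
  numerator u u≤v p^u∣T = subst (λ j → + (p ^ (suc v + u + o)) ∣ℤ U j) (sym k≡4+k₀)
    (p^∣U pr p>4 (proj₁ p-odd) (proj₂ p-odd) k₀ (suc v) o u 2∣4+k₀ (s≤s z≤n) p^o∣k₀ u≤v p^u∣T m n′ n≡ p∤n′
      (ℤ∣.∣-trans (∣-pos (m≤n⇒p^m∣p^n p exponent)) (subst (λ j → + (p ^ (3 * suc v + o)) ∣ℤ + T j m) k≡4+k₀ p^3v+o∣T)))
    where
    triple : ∀ v → 2 * v + v ≡ 3 * v
    triple = ring-ℕ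
    exponent : 2 * suc v + u + o ≤ 3 * suc v + o
    exponent = ℕₚ.+-monoˡ-≤ o (ℕₚ.≤-trans (ℕₚ.+-monoʳ-≤ (2 * suc v) u≤v) (ℕₚ.≤-reflexive (triple (suc v))))

  -- First round, u = 0: the exponent suc v + o is at least the suc o that Kummer's congruence asks
  -- for.
  p^o+1∣U : + (p ^ suc o) ∣ℤ U k
  p^o+1∣U = ℤ∣.∣-trans (∣-pos (m≤n⇒p^m∣p^n p (s≤s (ℕₚ.m≤n+m o (v + 0))))) (numerator 0 z≤n (λ m _ → dividesℤ (+ T (2 + k₀) m) (sym (ℤₚ.*-identityʳ (+ T (2 + k₀) m)))))

  k-p-part = p-part pr k k>0

  c = k ℕ./ suc q

  k≡r+c[p-1] : k ≡ k ℕ.% suc q + c * suc q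
  k≡r+c[p-1] = ℕ/.m≡m%n+[m/n]*n k (suc q)

  residue : ∃ λ e → k ℕ.% suc q ≡ suc e * 2
  residue with ℕ∣.∣m+n∣m⇒∣n (subst (2 ∣_) (trans k≡r+c[p-1] (ℕₚ.+-comm (k ℕ.% suc q) (c * suc q))) 2∣k) (ℕ∣.∣n⇒∣m*n c 2∣q+1)
  ... | divides zero r≡0   = contradiction (trans k≡r+c[p-1] (cong (_+ c * suc q) r≡0)) (p-1∤k c)
  ... | divides (suc e) r≡ = e , r≡

  e = proj₁ residue

  r : ℕ
  r = 2 + e * 2

  r<p-1 : r < suc q
  r<p-1 = subst (_< suc q) (proj₂ residue) (ℕ/.m%n<n k (suc q))

  k≡ : k ≡ r + c * suc q
  k≡ = trans k≡r+c[p-1] (cong (_+ c * suc q) (proj₂ residue))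

  pair : IrregularPair r p
  pair = pr , 2∤p , divides (suc e) refl , ℕₚ.<⇒≤pred (ℕₚ.≤∧≢⇒< (ℕₚ.≤-pred r<p-1) r≢q) ,
    ℤ∣.∣⇒∣ᵤ (kummer pr p>2 (e * 2) c r<p-1 o (proj₁ k-p-part) (trans (sym k≡) (proj₁ (proj₂ k-p-part))) (proj₂ (proj₂ k-p-part))
      (subst (λ j → + (p ^ suc o) ∣ℤ U j) k≡ p^o+1∣U))
    where
    -- r is even and q = p - 2 is odd, which sharpens r ≤ p - 2 to r ≤ p - 3.
    r≢q : r ≢ q
    r≢q r≡q with ℕ∣.∣1⇒≡1 (ℕ∣.∣m+n∣m⇒∣n (subst (2 ∣_) (ℕₚ.+-comm 1 q) 2∣q+1) (subst (2 ∣_) r≡q (divides (suc e) refl)))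
    ... | ()

  k≡r-mod : k ≡ r [mod suc q ]
  k≡r-mod = subst (λ j → j ≡ r [mod suc q ]) (sym k≡) (r+cq≡r r c (suc q))

  -- The index 2 + k₀ is k - 2, with residue r - 2 modulo p - 1; the case r = 2 contradicts U_2 = 1.
  p^v∣T : ∀ m → p ^ suc v ∣ 2 * m + 1 → + (p ^ suc v) ∣ℤ + T (2 + k₀) m
  p^v∣T m p^v∣n = above-two e refl
    where
    above-two : ∀ e′ → e ≡ e′ → + (p ^ suc v) ∣ℤ + T (2 + k₀) m
    above-two zero    e≡ = ⊥-elim (exceptional-regular pair (there (here (cong (λ e → 2 + e * 2) e≡))))
    above-two (suc e′) e≡ = subst (λ j → + (p ^ suc v) ∣ℤ + T j m) (sym j≡)
      (p^∣T pr p>2 (suc (e′ * 2)) c (ℕₚ.<-trans (ℕₚ.n<1+n _) (ℕₚ.<-trans (ℕₚ.n<1+n _) (subst (λ e → 2 + e * 2 < suc q) e≡ r<p-1)))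
        (subst (2 ∣_) j≡ (ℕ∣.∣m+n∣m⇒∣n {2} {2} 2∣4+k₀ ℕ∣.∣-refl)) v m p^v∣n)
      where
      j≡ : 2 + k₀ ≡ suc (suc (e′ * 2)) + c * suc q
      j≡ = ℕₚ.suc-injective (ℕₚ.suc-injective (trans (sym k≡4+k₀) (trans k≡ (cong (λ e → 2 + e * 2 + c * suc q) e≡))))

  -- Second round, u = suc v: U has p-exponent at least 2 suc v + o, and division by k takes away o.
  ord-bound : + (2 * suc v) ℤ.≤ ordℚ p (divℕ (B k) k)
  ord-bound = ordℚ-divℕ pr (B k) k>0 (proj₁ (proj₂ k-p-part)) (proj₂ (proj₂ k-p-part))
    (p∣U⇒p∤V pr {k} (ℤ∣.∣-trans (∣-pos (ℕ∣.m∣m*n (p ^ o))) p^o+1∣U)) (U-even≢0 k>0 2∣k)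
    (subst (λ w → + (p ^ (w + o)) ∣ℤ U k) (double (suc v)) (numerator (suc v) ℕₚ.≤-refl p^v∣T))
    where
    double : ∀ v → v + v ≡ 2 * v
    double = ring-ℕ

theorem3 : (a m k p : ℕ) → 1 ≤ a → 1 < m → 1 ≤ k → 2 ∣ k →
    a * T k m ≡ (2 * m + 1) ^ k →
    Prime p → p ∣ 2 * m + 1 →
    Irregular p
    × (∀ r → r ∈ (0 ∷ 2 ∷ 4 ∷ 6 ∷ 8 ∷ 10 ∷ 14 ∷ []) → ¬ (k ≡ r [mod p ∸ 1 ]))
    × ((ℤ._≤_ (+ (2 * ordℕ p (2 * m + 1))) (ordℚ p (divℕ (B k) k))) × 2 ≤ 2 * ordℕ p (2 * m + 1))
    × (∃ λ r → IrregularPair r p × k ≡ r [mod p ∸ 1 ])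
theorem3 a m k p a>0 m>1 k>0 2∣k equation pr p∣n with prime-cases pr
... | q , refl = solve (ordℕ p n) refl
  where
  n = 2 * m + 1
  n>0 : 0 < n
  n>0 = ℕₚ.m≤n+m 1 (2 * m)
  n-part = p-part pr n n>0
  a-part = p-part pr a a>0
  solve : ∀ v → ordℕ p n ≡ v →
    Irregular p
    × (∀ r → r ∈ exceptional → ¬ (k ≡ r [mod suc q ]))
    × ((+ (2 * ordℕ p n) ℤ.≤ ordℚ p (divℕ (B k) k)) × 2 ≤ 2 * ordℕ p n)
    × (∃ λ r → IrregularPair r p × k ≡ r [mod suc q ])
  solve zero    ord≡0 = contradiction (subst (1 ≤_) ord≡0 (ord-maximal pr 1 n>0 (subst (_∣ n) (sym (ℕₚ.*-identityʳ p)) p∣n))) (λ ())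
  solve (suc v) ord≡v =
    (pr , Sol.2∤p , Sol.r , proj₂ (proj₂ Sol.pair)) ,
    not-exceptional-mod {k} Sol.pair Sol.r<p-1 Sol.k≡r-mod ,
    (subst (λ w → + (2 * w) ℤ.≤ ordℚ p (divℕ (B k) k)) (sym ord≡v) Sol.ord-bound ,
      subst (λ w → 2 ≤ 2 * w) (sym ord≡v) (ℕₚ.*-monoʳ-≤ 2 {1} {suc v} (s≤s z≤n))) ,
    (Sol.r , Sol.pair , Sol.k≡r-mod)
    where
    module Sol = Solution pr {v = v} {x = ordℕ p a} m>1 a>0 k>0 2∣k equation
      (subst (λ w → n ≡ p ^ w * proj₁ n-part) ord≡v (proj₁ (proj₂ n-part))) (proj₂ (proj₂ n-part))
      (proj₁ (proj₂ a-part)) (proj₂ (proj₂ a-part))
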